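{- For every $\gamma>0$ there exists $n_0$ such that the following holds. Suppose $\mathcal H$ is a $3$-uniform hypergraph on $n>n_0$ vertices with $n$ even and \[\delta_1(\mathcal H)>\left(\frac{7}{16}+\gamma\right)\binom{n}{2}.\] Then $\mathcal H$ contains a loose Hamilton cycle.
   Context: A $3$-uniform hypergraph $\mathcal H=(V,E)$ has $E\subseteq\binom{V}{3}$. For $v\in V$, $\deg(v)$ is the number of edges containing $v$, and $\delta_1(\mathcal H)=\min_{v\in V}\deg(v)$ is the minimum vertex degree. A $3$-uniform hypergraph $\mathcal C$ is a loose cycle if there is a cyclic ordering of its vertices such that every edge consists of $3$ consecutive vertices, every vertex lies in an edge, and two consecutive edges (in the order inherited from the vertex ordering) intersect in exactly one vertex. A loose Hamilton cycle of $\mathcal H$ is a subhypergraph of $\mathcal H$ that is a loose cycle covering all vertices of $\mathcal H$. -}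

module Defs where

open import Data.Nat using (ℕ; zero; suc; _+_; _*_)
open import Data.Bool using (Bool; true; false; _∧_)
open import Data.Fin using (Fin; toℕ)
open import Data.Fin.Subset using (Subset; ⁅_⁆; _∪_; ∣_∣)
open import Data.Vec using (Vec; []; _∷_; lookup)
open import Data.List using (List; [_]; map; _++_; filter; length)
open import Data.Product using (Σ; _×_; ∃)
open import Data.Sum using (_⊎_)
open import Function.Bundles using (_⤖_; Bijection)
open import Relation.Binary.PropositionalEquality using (_≡_)
import Data.Bool as B

record Hypergraph3 (n : ℕ) : Set where
  field
    isEdge  : Subset n → Bool
    uniform : ∀ (s : Subset n) → isEdge s ≡ true → ∣ s ∣ ≡ 3
open Hypergraph3 public

allSubsets : (n : ℕ) → List (Subset n)
allSubsets zero    = [ [] ]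
allSubsets (suc n) = map (true ∷_) (allSubsets n) ++ map (false ∷_) (allSubsets n)

deg : ∀ {n} → Hypergraph3 n → Fin n → ℕ
deg H v = length (filter (λ s → isEdge H s ∧ lookup s v B.≟ true) (allSubsets _))

triple : ∀ {n} → Fin n → Fin n → Fin n → Subset n
triple a b c = ⁅ a ⁆ ∪ ⁅ b ⁆ ∪ ⁅ c ⁆

-- A loose Hamilton cycle (on n vertices, n even): a cyclic ordering
-- σ(0), σ(1), …, σ(n-1) of all vertices (a bijection Fin n → Fin n) such that
-- for every even position i the three consecutive vertices
-- σ(i), σ(i+1), σ(i+2 mod n) form an edge of H.  These n/2 edges are the
-- edges of the loose cycle; consecutive ones share exactly one vertex.
LooseHamiltonCycle : ∀ {n} → Hypergraph3 n → Set
LooseHamiltonCycle {n} H =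
  Σ (Fin n ⤖ Fin n) λ σ →
    ∀ (i j k : Fin n) →
      (∃ λ m → toℕ i ≡ 2 * m) →
      toℕ j ≡ suc (toℕ i) →
      (toℕ k ≡ 2 + toℕ i ⊎ (2 + toℕ i ≡ n × toℕ k ≡ 0)) →
      isEdge H (triple (Bijection.to σ i) (Bijection.to σ j) (Bijection.to σ k)) ≡ true

{-# OPTIONS --safe #-}

-- The cycle is built greedily; potential functions replace the probabilistic and
-- regularity arguments.
--
-- Absorption: a path v₁ … v₇ with edges v₁v₂v₃, v₃v₄v₅, v₅v₆v₇ absorbs {x, y} if
-- v₂xv₄ and v₄yv₆ are edges too.  Every pair is absorbed by a positive proportion
-- of all 7-tuples, so repeatedly choosing a tuple that absorbs much of the weight
-- Σ 2^(- number of chosen tuples absorbing {x, y}), and connecting the tuples,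
-- yields a short path in which every pair has linearly many absorbers.
--
-- Growth: the path is extended by spanning paths of complete tripartite blocks of
-- bounded size until few vertices remain; these are absorbed in pairs after the
-- path has been closed.  For this, the degrees into the set of remaining vertices
-- must stay above the density 7/16.  A block is chosen to be light for the weight
-- w(u) = Σ_v deficit(v) codegree(u, v), which bounds the growth of Σ deficit(v)²,
-- so that only boundedly many vertices ever fall behind.
--
-- Light blocks: for any weight w of mean w̄, some edge abc satisfies
-- w(a) + w(b) + 2w(c) ≤ 4w̄.  Let c have minimal weight w₀.  The link of c has density
-- more than 7/16, so its fractional vertex covers have size more than n/4; hence
-- (w - w₀) / (4(w̄ - w₀)), whose size is n/4, is not one, which gives a and b.  Robustly,
-- a positive proportion of all triples are such edges, and double counting finds a
-- complete tripartite system of them.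
module Submission where

open import Defs

-- Degree conditions are kept in the form `(7 * G + i) * (m * m) ≤ 16 * G * pairs R
-- v`, with `m` the size of `R` and `G` a multiple of the denominator of the given slack. Removing a
-- `1 / (32 * G)` proportion of the vertices lowers `i` by one, so the proof is a budget for `i`: 8
-- at the start, 7 outside the absorbing path, 4 in the quadratic part of the target, 3 for a vertex
-- not far below the target, 2 for the front end of the path once its block is removed, and at least
-- 0 for absorbing and connecting. The constant 7/16 is sharp only for fractional covers: the pairs
-- meeting a fixed quarter of the vertices have density 1 - (3/4)² = 7/16. Absorbers and connections
-- live on the 5/8 of all vertices that have linear codegree with a given one, and (5/8)² = 25/64 is
-- below 7/16. That few vertices fall behind protects no particular vertex. This matters for the two
-- ends of the path: the front end is renewed with every block by a vertex that is good at that
-- time, while the back end is fixed and is given a large multiplicity in the potential.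

module LooseCycles where

  open import Data.Nat using (ℕ; zero; suc; pred; _+_; _*_; _∸_; _^_; _/_; _≤_; _<_; z≤n; s≤s; _⊓_; _⊔_; _≤?_; >-nonZero; NonZero)
  open import Data.Nat.Divisibility using (_∣_; divides; ∣m∣n⇒∣m+n; ∣m+n∣m⇒∣n)
  open import Data.Nat.DivMod using (_%_; m≡m%n+[m/n]*n; m%n<n; m/n*n≤m; m*n/n≡m; /-monoˡ-≤)
  open import Data.Nat.Properties hiding (_≟_)
  open import Data.Nat.Tactic.RingSolver using (solve-∀)
  import Data.Integer as ℤ
  import Data.Integer.Properties as ℤ
  open import Data.Rational using (ℚ; mkℚ; 0ℚ; toℚᵘ)
  import Data.Rational as ℚ
  import Data.Rational.Properties as ℚ
  open import Data.Rational.Unnormalised using (mkℚᵘ)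
  import Data.Rational.Unnormalised as ℚᵘ
  import Data.Rational.Unnormalised.Properties as ℚᵘ
  open import Data.Bool using (Bool; true; false; _∧_; _∨_; not; if_then_else_)
  import Data.Bool as Bool
  open import Data.Bool.ListAction using (all)
  open import Data.Bool.Properties using (∧-comm; ∨-comm)
  open import Data.Fin using (Fin; zero; suc; toℕ; cast)
  import Data.Fin as Fin
  open import Data.Fin.Properties using (toℕ-cast; toℕ-injective)
  open import Data.Fin.Subset using (Subset; ⁅_⁆; _∪_; ∣_∣) renaming (⊥ to ∅)
  open import Data.Fin.Subset.Properties using (∪-comm; ∪-assoc; ∪-idem; ∪-identityˡ; ∪-identityʳ; ∣⁅x⁆∣≡1)
  open import Data.List using (List; []; _∷_; _++_; length; map; filter; lookup; cartesianProduct; replicate; allFin)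
  open import Data.List.Properties using (length-++; ++-assoc; length-replicate; length-tabulate)
  open import Data.List.Relation.Unary.Any using (here; there; index)
  open import Data.List.Relation.Unary.Any.Properties using (lookup-index)
  open import Data.List.Relation.Unary.All using (All; []; _∷_)
  import Data.List.Relation.Unary.All as All
  open import Data.List.Relation.Unary.AllPairs using ([]; _∷_)
  open import Data.List.Relation.Unary.Unique.Propositional using (Unique)
  open import Data.List.Relation.Unary.Unique.Propositional.Properties using (allFin⁺)
  open import Data.List.Membership.Propositional using (_∈_)
  open import Data.List.Membership.Propositional.Properties using (∈-++⁺ˡ; ∈-++⁺ʳ; ∈-++⁻; ∈-lookup; ∈-allFin; ∈-cartesianProduct⁺)
  open import Data.List.Relation.Binary.Permutation.Propositional using (_↭_; prep; swap; ↭-refl; ↭-sym; ↭-trans; ↭-reflexive; ↭⇒↭ₛ; module PermutationReasoning)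
  import Data.List.Relation.Binary.Permutation.Propositional as ↭
  open import Data.List.Relation.Binary.Permutation.Propositional.Properties hiding (++-assoc; ++-identityʳ)
  import Data.List.Relation.Binary.Permutation.Setoid.Properties as SetoidPerm
  open import Data.Vec using (Vec; []; _∷_; toList)
  import Data.Vec as Vec
  open import Data.Vec.Properties using (length-toList)
  open import Data.Product using (Σ; _×_; _,_; proj₁; proj₂; ∃)
  open import Data.Sum using (_⊎_; inj₁; inj₂)
  open import Data.Empty using (⊥; ⊥-elim)
  open import Relation.Nullary using (¬_; yes; no; Dec; does)
  open import Relation.Binary.Definitions using (DecidableEquality)
  open import Relation.Binary.PropositionalEquality hiding ([_]; J)
  open import Function using (_∘_; id; case_of_)
  open import Function.Bundles using (mk⤖)

  -- Inequalities between natural numbers, and sums over lists.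

  private variable
    I J V : Set

  -- If L ≤ R is a nonnegative combination of hypotheses, q - p = (R - L) + s
  -- certifies p ≤ q; stated without subtraction, so that the ring solver applies.
  by-combining : ∀ {L R} p q s → L ≤ R → p + R + s ≡ q + L → p ≤ q
  by-combining {L} {R} p q s L≤R eq = +-cancelʳ-≤ L p q (begin
    p + L      ≤⟨ +-monoʳ-≤ p L≤R ⟩
    p + R      ≤⟨ m≤m+n (p + R) s ⟩
    p + R + s  ≡⟨ eq ⟩
    q + L      ∎)
    where open ≤-Reasoning

  -- The contradictory companion of `by-combining`: a combination of hypotheses whose left side
  -- exceeds its right side by the visibly positive `suc s`.
  refute : ∀ {L R} s → L ≤ R → L ≡ R + suc s → ⊥
  refute {L} {R} s L≤R eq = 1+n≰n (begin
    suc R         ≤⟨ s≤s (m≤m+n R s) ⟩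
    suc (R + s)   ≡⟨ sym (+-suc R s) ⟩
    R + suc s     ≡⟨ sym eq ⟩
    L             ≤⟨ L≤R ⟩
    R             ∎)
    where open ≤-Reasoning

  infixr 5 _⊕_
  _⊕_ : ∀ {a b c d} → a ≤ b → c ≤ d → a + c ≤ b + d
  _⊕_ = +-mono-≤

  infixr 6 _⊛_
  _⊛_ : ∀ k {a b} → a ≤ b → k * a ≤ k * b
  k ⊛ p = *-monoʳ-≤ k p

  𝟙 : Bool → ℕ
  𝟙 true  = 1
  𝟙 false = 0

  𝟙≤1 : ∀ b → 𝟙 b ≤ 1
  𝟙≤1 true  = ≤-refl
  𝟙≤1 false = z≤n

  𝟙-∧ : ∀ a b → 𝟙 (a ∧ b) ≡ 𝟙 a * 𝟙 b
  𝟙-∧ true  b = sym (+-identityʳ (𝟙 b))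
  𝟙-∧ false b = refl

  𝟙-∧≤ˡ : ∀ a b → 𝟙 (a ∧ b) ≤ 𝟙 a
  𝟙-∧≤ˡ true  b = 𝟙≤1 b
  𝟙-∧≤ˡ false b = z≤n

  𝟙-∧≤ʳ : ∀ a b → 𝟙 (a ∧ b) ≤ 𝟙 b
  𝟙-∧≤ʳ true  b = ≤-refl
  𝟙-∧≤ʳ false b = z≤n

  ∑ : List I → (I → ℕ) → ℕ
  ∑ []       f = 0
  ∑ (x ∷ xs) f = f x + ∑ xs f

  infix 6 ∑
  syntax ∑ xs (λ x → e) = ∑[ x ∈ xs ] e

  # : (I → Bool) → List I → ℕ
  # p xs = ∑ xs (𝟙 ∘ p)

  ∑-cong : ∀ (xs : List I) {f g : I → ℕ} → (∀ x → f x ≡ g x) → ∑ xs f ≡ ∑ xs g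
  ∑-cong []       f≗g = refl
  ∑-cong (x ∷ xs) f≗g = cong₂ _+_ (f≗g x) (∑-cong xs f≗g)

  ∑-mono∈ : ∀ (xs : List I) {f g : I → ℕ} → (∀ {x} → x ∈ xs → f x ≤ g x) → ∑ xs f ≤ ∑ xs g
  ∑-mono∈ []       f≤g = z≤n
  ∑-mono∈ (x ∷ xs) f≤g = +-mono-≤ (f≤g (here refl)) (∑-mono∈ xs (f≤g ∘ there))

  ∑-mono : ∀ (xs : List I) {f g : I → ℕ} → (∀ x → f x ≤ g x) → ∑ xs f ≤ ∑ xs g
  ∑-mono xs f≤g = ∑-mono∈ xs (λ {x} _ → f≤g x)

  +-interchange : ∀ a b c d → (a + b) + (c + d) ≡ (a + c) + (b + d)
  +-interchange = solve-∀

  ∑-+ : ∀ (xs : List I) (f g : I → ℕ) → ∑[ x ∈ xs ] (f x + g x) ≡ ∑ xs f + ∑ xs g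
  ∑-+ []       f g = refl
  ∑-+ (x ∷ xs) f g = trans (cong (f x + g x +_) (∑-+ xs f g)) (+-interchange (f x) (g x) (∑ xs f) (∑ xs g))

  ∑-*ˡ : ∀ (xs : List I) k (f : I → ℕ) → ∑[ x ∈ xs ] (k * f x) ≡ k * ∑ xs f
  ∑-*ˡ []       k f = sym (*-zeroʳ k)
  ∑-*ˡ (x ∷ xs) k f = trans (cong (k * f x +_) (∑-*ˡ xs k f)) (sym (*-distribˡ-+ k (f x) (∑ xs f)))

  ∑-*ʳ : ∀ (xs : List I) k (f : I → ℕ) → ∑[ x ∈ xs ] (f x * k) ≡ ∑ xs f * k
  ∑-*ʳ xs k f = trans (∑-cong xs (λ x → *-comm (f x) k)) (trans (∑-*ˡ xs k f) (*-comm k _))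

  ∑-const : ∀ (xs : List I) k → ∑[ x ∈ xs ] k ≡ length xs * k
  ∑-const []       k = refl
  ∑-const (x ∷ xs) k = cong (k +_) (∑-const xs k)

  ∑-≤const : ∀ (xs : List I) {f : I → ℕ} k → (∀ {x} → x ∈ xs → f x ≤ k) → ∑ xs f ≤ length xs * k
  ∑-≤const xs k p = ≤-trans (∑-mono∈ xs p) (≤-reflexive (∑-const xs k))

  ∑-≥const : ∀ (xs : List I) {f : I → ℕ} k → (∀ {x} → x ∈ xs → k ≤ f x) → length xs * k ≤ ∑ xs f
  ∑-≥const xs k p = ≤-trans (≤-reflexive (sym (∑-const xs k))) (∑-mono∈ xs p)

  ∑-zero : ∀ (xs : List I) → ∑[ x ∈ xs ] 0 ≡ 0
  ∑-zero xs = trans (∑-const xs 0) (*-zeroʳ (length xs))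

  ∑-swap : ∀ (xs : List I) (ys : List J) (f : I → J → ℕ) →
           ∑[ x ∈ xs ] ∑[ y ∈ ys ] f x y ≡ ∑[ y ∈ ys ] ∑[ x ∈ xs ] f x y
  ∑-swap []       ys f = sym (∑-zero ys)
  ∑-swap (x ∷ xs) ys f = trans (cong (∑ ys (f x) +_) (∑-swap xs ys f)) (sym (∑-+ ys (f x) _))

  ∑-++ : ∀ (xs ys : List I) (f : I → ℕ) → ∑ (xs ++ ys) f ≡ ∑ xs f + ∑ ys f
  ∑-++ []       ys f = refl
  ∑-++ (x ∷ xs) ys f = trans (cong (f x +_) (∑-++ xs ys f)) (sym (+-assoc (f x) _ _))

  ∑-map : ∀ (g : I → J) xs (f : J → ℕ) → ∑ (map g xs) f ≡ ∑ xs (f ∘ g)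
  ∑-map g []       f = refl
  ∑-map g (x ∷ xs) f = cong (f (g x) +_) (∑-map g xs f)

  ∑-× : ∀ (xs : List I) (ys : List J) (f : I × J → ℕ) →
        ∑ (cartesianProduct xs ys) f ≡ ∑[ x ∈ xs ] ∑[ y ∈ ys ] f (x , y)
  ∑-× []       ys f = refl
  ∑-× (x ∷ xs) ys f = trans (∑-++ (map (x ,_) ys) _ f) (cong₂ _+_ (∑-map (x ,_) ys f) (∑-× xs ys f))

  ∑-↭ : ∀ {xs ys : List I} (f : I → ℕ) → xs ↭ ys → ∑ xs f ≡ ∑ ys f
  ∑-↭ f ↭.refl = refl
  ∑-↭ f (prep x p) = cong (f x +_) (∑-↭ f p)
  ∑-↭ {xs = x ∷ y ∷ xs} {ys = y ∷ x ∷ ys} f (swap x y p) = begin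
    f x + (f y + ∑ xs f)  ≡⟨ cong (λ z → f x + (f y + z)) (∑-↭ f p) ⟩
    f x + (f y + ∑ ys f)  ≡⟨ +-assoc (f x) (f y) _ ⟨
    f x + f y + ∑ ys f    ≡⟨ cong (_+ ∑ ys f) (+-comm (f x) (f y)) ⟩
    f y + f x + ∑ ys f    ≡⟨ +-assoc (f y) (f x) _ ⟩
    f y + (f x + ∑ ys f)  ∎
    where open ≡-Reasoning
  ∑-↭ f (↭.trans p q) = trans (∑-↭ f p) (∑-↭ f q)

  term≤∑ : ∀ {xs : List I} (f : I → ℕ) {x} → x ∈ xs → f x ≤ ∑ xs f
  term≤∑ f (here refl) = m≤m+n _ _
  term≤∑ f (there x∈)  = ≤-trans (term≤∑ f x∈) (m≤n+m _ _)

  average : ∀ (xs : List I) (f : I → ℕ) k → 0 < length xs → length xs * k ≤ ∑ xs f →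
            ∃ λ x → x ∈ xs × k ≤ f x
  average (x ∷ xs) f k _ le with k ≤? f x
  ... | yes k≤ = x , here refl , k≤
  ... | no  k≰ with xs
  ...   | []     = ⊥-elim (k≰ (subst₂ _≤_ (+-identityʳ k) (+-identityʳ (f x)) le))
  ...   | y ∷ ys =
    let z , z∈ , k≤ = average (y ∷ ys) f k (s≤s z≤n)
                        (by-combining _ _ 0 (le ⊕ <⇒≤ (≰⇒> k≰)) (lemma k (length (y ∷ ys) * k) (f x) _))
    in z , there z∈ , k≤
    where
    lemma : ∀ k l a b → l + ((a + b) + k) + 0 ≡ b + ((k + l) + a)
    lemma = solve-∀

  𝟙-sound : ∀ {b} → 1 ≤ 𝟙 b → b ≡ true
  𝟙-sound {true} _ = refl

  select : (I → Bool) → List I → List I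
  select p []       = []
  select p (x ∷ xs) = if p x then x ∷ select p xs else select p xs

  ∑-select : ∀ (p : I → Bool) xs (f : I → ℕ) → ∑ (select p xs) f ≡ ∑[ x ∈ xs ] (𝟙 (p x) * f x)
  ∑-select p []       f = refl
  ∑-select p (x ∷ xs) f with p x
  ... | true  = cong₂ _+_ (sym (+-identityʳ (f x))) (∑-select p xs f)
  ... | false = ∑-select p xs f

  length-∑ : ∀ (xs : List I) → length xs ≡ ∑[ x ∈ xs ] 1
  length-∑ xs = trans (sym (*-identityʳ _)) (sym (∑-const xs 1))

  length-select : ∀ (p : I → Bool) xs → length (select p xs) ≡ # p xs
  length-select p xs = trans (length-∑ (select p xs)) (trans (∑-select p xs _) (∑-cong xs (λ x → *-identityʳ _)))

  #-select : ∀ (p q : I → Bool) xs → # q (select p xs) ≡ # (λ x → p x ∧ q x) xs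
  #-select p q xs = trans (∑-select p xs _) (∑-cong xs (λ x → sym (𝟙-∧ (p x) (q x))))

  #≤length : ∀ (p : I → Bool) xs → # p xs ≤ length xs
  #≤length p xs = subst (# p xs ≤_) (*-identityʳ _) (∑-≤const xs 1 (λ {x} _ → 𝟙≤1 (p x)))

  ∈-select⁻ : ∀ (p : I → Bool) {x} xs → x ∈ select p xs → x ∈ xs × p x ≡ true
  ∈-select⁻ p (y ∷ xs) x∈ with p y in eq
  ∈-select⁻ p (y ∷ xs) (here refl) | true = here refl , eq
  ∈-select⁻ p (y ∷ xs) (there x∈)  | true = let a , b = ∈-select⁻ p xs x∈ in there a , b
  ∈-select⁻ p (y ∷ xs) x∈          | false = let a , b = ∈-select⁻ p xs x∈ in there a , b

  ∈-select⁺ : ∀ (p : I → Bool) {x} {xs} → x ∈ xs → p x ≡ true → x ∈ select p xs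
  ∈-select⁺ p (here refl) px rewrite px = here refl
  ∈-select⁺ p {xs = y ∷ xs} (there x∈) px with p y
  ... | true  = there (∈-select⁺ p x∈ px)
  ... | false = ∈-select⁺ p x∈ px

  select-split : ∀ (p : I → Bool) xs → xs ↭ select p xs ++ select (not ∘ p) xs
  select-split p []       = ↭-refl
  select-split p (x ∷ xs) with p x
  ... | true  = prep x (select-split p xs)
  ... | false = ↭-trans (prep x (select-split p xs)) (↭-sym (shift x (select p xs) _))

  ∈-↭-∷ : ∀ {x : I} {xs} → x ∈ xs → ∃ λ ys → xs ↭ x ∷ ys
  ∈-↭-∷ {xs = x ∷ xs} (here refl) = xs , ↭-refl
  ∈-↭-∷ {x = x} {y ∷ xs} (there x∈) = let ys , p = ∈-↭-∷ x∈ in y ∷ ys , ↭-trans (prep y p) (swap y x ↭-refl)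

  find : ∀ (p : I → Bool) xs → 1 ≤ # p xs → ∃ λ x → x ∈ xs × p x ≡ true
  find p (x ∷ xs) le with p x in eq
  ... | true  = x , here refl , eq
  ... | false = let y , y∈ , py = find p xs le in y , there y∈ , py

  infix 4 _≤!_
  _≤!_ : ℕ → ℕ → Bool
  m ≤! n = does (m ≤? n)

  does-sound : ∀ {P : Set} (d : Dec P) → does d ≡ true → P
  does-sound (yes p) _ = p

  does-complete : ∀ {P : Set} (d : Dec P) → P → does d ≡ true
  does-complete (yes _) _ = refl
  does-complete (no ¬p) p = ⊥-elim (¬p p)

  not-true : ∀ {a} → not a ≡ true → a ≡ false
  not-true {false} _ = refl

  does-false : ∀ {P : Set} (d : Dec P) → does d ≡ false → ¬ P
  does-false (no ¬p) _ = ¬p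

  ≤!-sound : ∀ m n → (m ≤! n) ≡ true → m ≤ n
  ≤!-sound m n = does-sound (m ≤? n)

  ≤!-complete : ∀ {m n} → m ≤ n → (m ≤! n) ≡ true
  ≤!-complete {m} {n} = does-complete (m ≤? n)

  ≤!-false : ∀ m n → (m ≤! n) ≡ false → n < m
  ≤!-false m n eq = ≰⇒> (does-false (m ≤? n) eq)

  -- Fractional vertex covers of dense graphs.

  trim-≤ : ∀ d y → ((y ∸ 1) ⊓ d) + (𝟙 (2 + d ≤! y) + 𝟙 (1 ≤! y)) ≤ y
  trim-≤ d zero    = z≤n
  trim-≤ d (suc y) with (2 + d ≤! suc y) in eq
  ... | true  = subst (_≤ suc y) (cong (_+ 2) (sym (m≥n⇒m⊓n≡n (<⇒≤ d<y))))
                  (subst (_≤ suc y) (+-comm 2 d) (s≤s d<y))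
    where
    d<y : d < y
    d<y = ≤-pred (≤!-sound (2 + d) (suc y) eq)
  ... | false = subst (_≤ suc y) (+-comm 1 (y ⊓ d)) (s≤s (m⊓n≤m y d))

  -- Lowering both values by 1 matches the drop of the threshold by 2. Capping at `d` is harmless
  -- because a value `d` covers the pair alone; and a value 0, which cannot be lowered, faces a
  -- value of at least `2 + d`.
  trim-covers : ∀ d y z → 2 + d ≤ y + z → d ≤ ((y ∸ 1) ⊓ d) + ((z ∸ 1) ⊓ d)
  trim-covers d zero    z (s≤s (d<z)) = ≤-reflexive (sym (m≥n⇒m⊓n≡n (∸-monoˡ-≤ 1 (≤-trans (n≤1+n _) (s≤s d<z)))))
  trim-covers d (suc y) zero h = subst (d ≤_) (sym (+-identityʳ _))
    (≤-reflexive (sym (m≥n⇒m⊓n≡n (≤-trans (n≤1+n d) (subst (suc d ≤_) (+-identityʳ y) (≤-pred h))))))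
  trim-covers d (suc y) (suc z) h with ≤-total d y | ≤-total d z
  ... | inj₁ d≤y | _ = ≤-trans (≤-reflexive (sym (m≥n⇒m⊓n≡n d≤y))) (m≤m+n _ _)
  ... | inj₂ _ | inj₁ d≤z = ≤-trans (≤-reflexive (sym (m≥n⇒m⊓n≡n d≤z))) (m≤n+m _ _)
  ... | inj₂ y≤d | inj₂ z≤d = subst₂ (λ u v → d ≤ u + v) (sym (m≤n⇒m⊓n≡m y≤d)) (sym (m≤n⇒m⊓n≡m z≤d))
                                (≤-pred (subst (suc d ≤_) (+-suc y z) (≤-pred h)))

  *1+1* : ∀ p q → p * 1 + 1 * q ≡ p + q
  *1+1* = solve-∀

  -- A covered pair has either two positive values or a zero facing a value of at least `2 + d`, so
  -- `𝟙 e ≤ b y * b z + a y * (1 - b z) + (1 - b y) * a z`. The negative products are moved to the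
  -- left.
  levels-cover : ∀ d y z (e : Bool) → (e ≡ true → 2 + d ≤ y + z) →
    let a = λ u → 𝟙 (2 + d ≤! u) ; b = λ u → 𝟙 (1 ≤! u) in
    𝟙 e + (a y * b z + b y * a z) ≤ b y * b z + (a y + a z)
  levels-cover d y z false h with y | z
  ... | zero  | zero  = z≤n
  ... | zero  | suc z = z≤n
  ... | suc y | zero  = subst (_≤ 𝟙 (2 + d ≤! suc y) + 0) (sym (cong (_+ 0) (*-zeroʳ (𝟙 (2 + d ≤! suc y))))) z≤n
  ... | suc y | suc z = ≤-trans (≤-reflexive (*1+1* (𝟙 (2 + d ≤! suc y)) (𝟙 (2 + d ≤! suc z)))) (n≤1+n _)
  levels-cover d y z true h with y | z
  ... | zero  | z = subst (λ t → 1 ≤ 𝟙 t) (sym (≤!-complete (h refl))) ≤-refl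
  ... | suc y | zero  rewrite ≤!-complete {2 + d} {suc y} (subst (2 + d ≤_) (+-identityʳ (suc y)) (h refl)) = ≤-refl
  ... | suc y | suc z = ≤-reflexive (cong suc (*1+1* (𝟙 (2 + d ≤! suc y)) (𝟙 (2 + d ≤! suc z))))

  -- A fractional vertex cover of more than 7/16 of the pairs has total weight at
  -- least a quarter of the number of vertices.  Peeling off the lowest and the
  -- highest level of f reduces to covers by a full vertices and b ∸ a half
  -- vertices, and b² + 2a(M ∸ b) ≤ 7M²/16 as soon as 2(a + b) ≤ M.
  fractional-cover : ∀ (xs : List I) (e : I → I → Bool) M → length xs ≤ M →
    7 * (M * M) < 16 * (∑[ b ∈ xs ] ∑[ c ∈ xs ] 𝟙 (e b c)) →
    ∀ D (f : I → ℕ) → (∀ {b c} → b ∈ xs → c ∈ xs → e b c ≡ true → 2 * D ≤ f b + f c) →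
    M * D ≤ 2 * ∑ xs f
  fractional-cover xs e M len dense zero f cov = subst (_≤ 2 * ∑ xs f) (sym (*-zeroʳ M)) z≤n
  fractional-cover {I} xs e M len dense (suc D) f cov = 
    by-combining _ _ 0 (rec ⊕ levels ⊕ 2 ⊛ trimmed) (arith M D (∑ xs f) (∑ xs f′) α β)
    where
    d = 2 * D
    a b f′ : I → ℕ
    a x = 𝟙 (2 + d ≤! f x)
    b x = 𝟙 (1 ≤! f x)
    f′ x = (f x ∸ 1) ⊓ d
    α = ∑ xs a
    β = ∑ xs b
    2*suc : 2 * suc D ≡ 2 + d
    2*suc = *-suc 2 D
    cov′ : ∀ {x y} → x ∈ xs → y ∈ xs → e x y ≡ true → 2 + d ≤ f x + f y
    cov′ {x} {y} x∈ y∈ exy = subst (_≤ f x + f y) 2*suc (cov x∈ y∈ exy)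
    rec : M * D ≤ 2 * ∑ xs f′
    rec = fractional-cover xs e M len dense D f′ (λ x∈ y∈ exy → trim-covers d (f _) (f _) (cov′ x∈ y∈ exy))
    trimmed : ∑ xs f′ + (α + β) ≤ ∑ xs f
    trimmed = subst (_≤ ∑ xs f) (trans (∑-+ xs f′ (λ x → a x + b x)) (cong (∑ xs f′ +_) (∑-+ xs a b)))
                (∑-mono xs (λ x → trim-≤ d (f x)))
    S = ∑[ x ∈ xs ] ∑[ y ∈ xs ] 𝟙 (e x y)
    product : ∀ (g h : I → ℕ) → ∑[ x ∈ xs ] ∑[ y ∈ xs ] (g x * h y) ≡ ∑ xs g * ∑ xs h
    product g h = trans (∑-cong xs (λ x → ∑-*ˡ xs (g x) h)) (∑-*ʳ xs (∑ xs h) g)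
    pairs : S + (α * β + β * α) ≤ β * β + (length xs * α + length xs * α)
    pairs = subst₂ _≤_
      (trans (∑-cong xs λ x → trans (∑-+ xs _ _) (cong (∑ xs (λ y → 𝟙 (e x y)) +_) (∑-+ xs _ _)))
        (trans (∑-+ xs _ _) (cong (S +_) (trans (∑-+ xs _ _) (cong₂ _+_ (product a b) (product b a))))))
      (trans (∑-cong xs λ x → trans (∑-+ xs _ _) (cong (∑ xs (λ y → b x * b y) +_) (∑-+ xs _ _)))
        (trans (∑-+ xs _ _) (cong₂ _+_ (product b b)
          (trans (∑-+ xs _ _) (cong₂ _+_
            (trans (∑-cong xs λ x → ∑-const xs (a x)) (∑-*ˡ xs (length xs) a))
            (∑-const xs α))))))
      (∑-mono∈ xs λ {x} x∈ → ∑-mono∈ xs λ {y} y∈ → levels-cover d (f x) (f y) (e x y) (cov′ x∈ y∈))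
    α≤β : α ≤ β
    α≤β = ∑-mono xs λ x → case-≤ (f x)
      where
      case-≤ : ∀ y → 𝟙 (2 + d ≤! y) ≤ 𝟙 (1 ≤! y)
      case-≤ zero    = z≤n
      case-≤ (suc y) = 𝟙≤1 _
    -- Otherwise `pairs` bounds the number of edges by `β² + 2α(M - β)` with `α ≤ β` and
    -- `2(α + β) < M`. In the limit this reaches 7M²/16 at `α = β = M / 4`. The proof substitutes
    -- `k = β - α` and the gap `c`, after which every coefficient of the surplus is positive.
    levels : M ≤ 2 * (α + β)
    levels with M ≤? 2 * (α + β)
    ... | yes le = le
    ... | no  gt = ⊥-elim (absurd (m≤n⇒∃[o]m+o≡n α≤β) (m≤n⇒∃[o]m+o≡n (≰⇒> gt)))
      where
      identity : ∀ α k c S x → let M = suc (2 * (α + (α + k))) + c ; β = α + k in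
        suc (7 * (M * M)) + (16 * (S + (α * β + β * α)) + 32 * α * x)
        ≡ (16 * S + (16 * (β * β + (x * α + x * α)) + 32 * α * M))
        + suc (48 * α * k + 12 * k * k + 24 * α * suc c + 28 * k * suc c + 7 * suc c * suc c)
      identity = solve-∀
      slack : ℕ → ℕ → ℕ
      slack k c = 48 * α * k + 12 * k * k + 24 * α * suc c + 28 * k * suc c + 7 * suc c * suc c
      absurd : ∃ (λ k → α + k ≡ β) → ∃ (λ c → suc (2 * (α + β)) + c ≡ M) → ⊥
      absurd (k , α+k) (c , M≡) = refute (slack k c) (dense ⊕ 16 ⊛ pairs ⊕ 32 * α ⊛ len)
        (subst₂ (λ β M → suc (7 * (M * M)) + (16 * (S + (α * β + β * α)) + 32 * α * length xs)
                       ≡ (16 * S + (16 * (β * β + (length xs * α + length xs * α)) + 32 * α * M)) + suc (slack k c))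
           α+k (trans (cong (λ β → suc (2 * (α + β)) + c) α+k) M≡) (identity α k c S (length xs)))
    arith : ∀ M D F F′ α β → M * suc D + (2 * F′ + (2 * (α + β) + 2 * F)) + 0
                           ≡ 2 * F + (M * D + (M + 2 * (F′ + (α + β))))
    arith = solve-∀

  -- Common neighbourhoods in dense bipartite graphs.

  ∧-true : ∀ {a b} → a ∧ b ≡ true → a ≡ true × b ≡ true
  ∧-true {true} {true} _ = refl , refl

  all-true : ∀ (p : I → Bool) {xs x} → all p xs ≡ true → x ∈ xs → p x ≡ true
  all-true p eq (here refl) = proj₁ (∧-true eq)
  all-true p eq (there x∈)  = all-true p (proj₂ (∧-true eq)) x∈

  ↭-∷ : ∀ {x : I} {xs ys zs} → xs ↭ x ∷ ys → ys ↭ zs → xs ↭ x ∷ zs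
  ↭-∷ {x = x} p q = ↭-trans p (prep x q)

  -- Every y keeps a (1/c)-fraction of the remaining X in its neighbourhood, so
  -- some x is adjacent to a (1/c)-fraction of the surviving Y; iterate.
  common-greedy : ∀ k (X : List I) (Y : List J) (r : I → J → Bool) c L → 0 < c → 0 < length Y → length X ≤ L →
    (∀ {y} → y ∈ Y → L + c * k ≤ c * # (λ x → r x y) X) →
    ∃ λ S → ∃ λ X′ → X ↭ S ++ X′ × length S ≡ k × length Y ≤ c ^ k * # (λ y → all (λ s → r s y) S) Y
  common-greedy zero X Y r c L 0<c 0<Y X≤L rich =
    [] , X , ↭-refl , refl , ≤-reflexive (trans (length-∑ Y) (sym (+-identityʳ _)))
  common-greedy {I} {J} (suc k) X Y r c L 0<c 0<Y X≤L rich
    with average X (λ x → c * # (r x) Y) (length Y) X>0 total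
    where
    total : length X * length Y ≤ ∑[ x ∈ X ] (c * # (r x) Y)
    total = begin
      length X * length Y                ≡⟨ *-comm (length X) _ ⟩
      length Y * length X                ≤⟨ *-monoʳ-≤ (length Y) X≤L ⟩
      length Y * L                       ≤⟨ ∑-≥const Y L (λ y∈ → ≤-trans (m≤m+n L _) (rich y∈)) ⟩
      ∑[ y ∈ Y ] (c * # (λ x → r x y) X)  ≡⟨ ∑-*ˡ Y c _ ⟩
      c * (∑[ y ∈ Y ] # (λ x → r x y) X)  ≡⟨ cong (c *_) (∑-swap Y X _) ⟩
      c * (∑[ x ∈ X ] # (r x) Y)          ≡⟨ ∑-*ˡ X c _ ⟨
      ∑[ x ∈ X ] (c * # (r x) Y)          ∎
      where open ≤-Reasoning
    nonempty : ∀ (X : List I) Y → 0 < length Y → (∀ {y} → y ∈ Y → L + c * suc k ≤ c * # (λ x → r x y) X) → 0 < length X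
    nonempty []      (y ∷ Y) _ h = ⊥-elim (n≮0 (≤-trans 0<c (≤-trans (≤-trans (m≤m*n c (suc k)) (m≤n+m _ L))
                                     (subst (L + c * suc k ≤_) (*-zeroʳ c) (h (here refl))))))
    nonempty (x ∷ X) _       _ h = s≤s z≤n
    X>0 = nonempty X Y 0<Y rich
  ... | x , x∈X , Y≤ =
    let X₁ , X↭ = ∈-↭-∷ x∈X
        Y₁ = select (r x) Y
        |Y₁| = length-select (r x) Y
        Y₁>0 : 0 < length Y₁
        Y₁>0 = ≰⇒> λ Y₁≤0 → <⇒≱ 0<Y (≤-trans Y≤ (≤-reflexive (trans (cong (c *_) (trans (sym |Y₁|) (n≤0⇒n≡0 Y₁≤0))) (*-zeroʳ c))))
        -- Taking `x` out of `X` costs `y` at most one neighbour; the surplus `c * k` in the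
        -- hypothesis provides for one such loss in each round, while `L` stays fixed.
        rich₁ : ∀ {y} → y ∈ Y₁ → L + c * k ≤ c * # (λ x → r x y) X₁
        rich₁ {y} y∈ = by-combining (L + c * k) (c * # (λ x → r x y) X₁) 0
                         (rich (proj₁ (∈-select⁻ (r x) Y y∈)) ⊕ ≤-reflexive (cong (c *_) (∑-↭ (λ x → 𝟙 (r x y)) X↭)) ⊕ c ⊛ 𝟙≤1 (r x y))
                         (arith L c k (# (λ x → r x y) X) (𝟙 (r x y)) (# (λ x → r x y) X₁))
        X₁≤L = ≤-trans (n≤1+n _) (≤-trans (≤-reflexive (sym (↭-length X↭))) X≤L)
        S , X′ , X₁↭ , |S| , Y₁≤ = common-greedy k X₁ Y₁ r c L 0<c Y₁>0 X₁≤L rich₁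
    in x ∷ S , X′ , ↭-∷ X↭ X₁↭ , cong suc |S| , (begin
         length Y                                              ≤⟨ Y≤ ⟩
         c * # (r x) Y                                         ≡⟨ cong (c *_) |Y₁| ⟨
         c * length Y₁                                         ≤⟨ *-monoʳ-≤ c Y₁≤ ⟩
         c * (c ^ k * # (λ y → all (λ s → r s y) S) Y₁)         ≡⟨ *-assoc c (c ^ k) _ ⟨
         c ^ suc k * # (λ y → all (λ s → r s y) S) Y₁           ≡⟨ cong (c ^ suc k *_) (#-select (r x) _ Y) ⟩
         c ^ suc k * # (λ y → all (λ s → r s y) (x ∷ S)) Y      ∎)
    where
    open ≤-Reasoning
    arith : ∀ L c k d i d₁ → L + c * k + (c * d + (c * (i + d₁) + c * 1)) + 0 ≡ c * d₁ + (L + c * suc k + (c * d + c * i))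
    arith = solve-∀

  #-select-≤ : ∀ (p q : I → Bool) xs → # q (select p xs) ≤ # q xs
  #-select-≤ p q xs = ≤-trans (≤-reflexive (#-select p q xs)) (∑-mono xs λ x → 𝟙-∧≤ʳ (p x) (q x))

  -- The `y` of degree below `length X / (2 * κ)` carry at most half of the edges, so at least
  -- `M / (2 * κ)` others remain. On these the greedy choice runs with `c = 4 * κ`: half of the
  -- degree bound serves as the proportion, the other half pays for the `k` vertices used up.
  common-neighbours : ∀ k (X : List I) (Y : List J) (r : I → J → Bool) κ M →
    0 < κ → 0 < length X → 0 < M → length Y ≤ M → length X * M ≤ κ * (∑[ x ∈ X ] # (r x) Y) → 4 * κ * k ≤ length X →
    ∃ λ S → ∃ λ X′ → X ↭ S ++ X′ × length S ≡ k × M ≤ 2 * κ * (4 * κ) ^ k * # (λ y → all (λ s → r s y) S) Y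
  common-neighbours {J = J} k X Y r κ M 0<κ 0<X 0<M Y≤M dense k≤X =
    let S , X′ , X↭ , |S| , rich≤ = common-greedy k X Rich r (4 * κ) (length X) (≤-trans 0<κ (m≤n*m κ 4)) 0<Rich ≤-refl richness
    in S , X′ , X↭ , |S| , (begin
         M                                                                ≤⟨ M≤rich ⟩
         2 * κ * length Rich                                              ≤⟨ *-monoʳ-≤ (2 * κ) (≤-trans rich≤ (*-monoʳ-≤ ((4 * κ) ^ k) (#-select-≤ rich _ Y))) ⟩
         2 * κ * ((4 * κ) ^ k * # (λ y → all (λ s → r s y) S) Y)           ≡⟨ *-assoc (2 * κ) ((4 * κ) ^ k) _ ⟨
         2 * κ * (4 * κ) ^ k * # (λ y → all (λ s → r s y) S) Y             ∎)
    where
    open ≤-Reasoning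
    x = length X
    d : J → ℕ
    d y = # (λ x → r x y) X
    rich : J → Bool
    rich y = x ≤! 2 * κ * d y
    Rich = select rich Y
    pointwise : ∀ y → 2 * κ * d y ≤ 2 * κ * x * 𝟙 (rich y) + x
    pointwise y with rich y in eq
    ... | true  = ≤-trans (*-monoʳ-≤ (2 * κ) (#≤length _ X)) (≤-trans (≤-reflexive (sym (*-identityʳ _))) (m≤m+n _ _))
    ... | false = ≤-trans (<⇒≤ (≤!-false x _ eq)) (m≤n+m x _)
    M≤rich : M ≤ 2 * κ * length Rich
    M≤rich = *-cancelˡ-≤ x {{>-nonZero 0<X}} (by-combining (x * M) (x * (2 * κ * length Rich)) 0
      (2 ⊛ dense ⊕ ≤-reflexive (cong (2 *_) (trans (cong (κ *_) (∑-swap X Y _)) (sym (∑-*ˡ Y κ d))))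
        ⊕ subst₂ _≤_ (trans (∑-cong Y λ y → *-assoc 2 κ (d y)) (∑-*ˡ Y 2 _))
            (trans (∑-+ Y _ _) (cong₂ _+_ (trans (∑-*ˡ Y (2 * κ * x) _) (cong (2 * κ * x *_) (sym (length-select rich Y)))) (∑-const Y x)))
            (∑-mono Y pointwise)
        ⊕ x ⊛ Y≤M)
      (arith x M (κ * (∑[ x ∈ X ] # (r x) Y)) (∑[ y ∈ Y ] (κ * d y)) κ (length Rich) (length Y)))
      where
      arith : ∀ x M s t κ ρ y → x * M + (2 * s + (2 * t + (2 * κ * x * ρ + y * x + x * M))) + 0
                             ≡ x * (2 * κ * ρ) + (2 * (x * M) + (2 * s + (2 * t + x * y)))
      arith = solve-∀
    0<Rich : 0 < length Rich
    0<Rich = ≰⇒> λ le → <⇒≱ 0<M (≤-trans M≤rich (≤-reflexive (trans (cong (2 * κ *_) (n≤0⇒n≡0 le)) (*-zeroʳ (2 * κ)))))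
    richness : ∀ {y} → y ∈ Rich → x + 4 * κ * k ≤ 4 * κ * d y
    richness {y} y∈ = by-combining _ (4 * κ * d y) 0 (k≤X ⊕ 2 ⊛ ≤!-sound x _ (proj₂ (∈-select⁻ rich Y y∈))) (arith x κ k (d y))
      where
      arith : ∀ x κ k d → x + 4 * κ * k + (x + 2 * (2 * κ * d)) + 0 ≡ 4 * κ * d + (4 * κ * k + 2 * x)
      arith = solve-∀

  -- Lists without repetition, and elements of lowest weight.

  unique-++ˡ : ∀ (xs : List I) {ys} → Unique (xs ++ ys) → Unique xs
  unique-++ˡ []       _        = []
  unique-++ˡ (x ∷ xs) (p ∷ ps) = All.tabulate (λ y∈ → All.lookup p (∈-++⁺ˡ y∈)) ∷ unique-++ˡ xs ps

  unique-++ : ∀ {xs ys : List I} → Unique xs → Unique ys → (∀ {x} → x ∈ xs → x ∈ ys → ⊥) → Unique (xs ++ ys)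
  unique-++ []       uy disj = uy
  unique-++ {xs = x ∷ xs} (p ∷ ux) uy disj =
    All.tabulate (λ y∈ → case-∈ (∈-++⁻ xs y∈)) ∷ unique-++ ux uy (disj ∘ there)
    where
    case-∈ : ∀ {y} → y ∈ xs ⊎ y ∈ _ → x ≢ y
    case-∈ (inj₁ y∈) = All.lookup p y∈
    case-∈ (inj₂ y∈) refl = disj (here refl) y∈

  unique-↭ : ∀ {xs ys : List I} → xs ↭ ys → Unique xs → Unique ys
  unique-↭ {I} p = SetoidPerm.Unique-resp-↭ (setoid I) (↭⇒↭ₛ p)

  unique-part : ∀ {xs ps qs : List I} → Unique xs → xs ↭ ps ++ qs → Unique ps
  unique-part {ps = ps} u xs↭ = unique-++ˡ ps (unique-↭ xs↭ u)

  extract : ∀ {l R : List I} → Unique l → (∀ {x} → x ∈ l → x ∈ R) → ∃ λ R′ → R ↭ l ++ R′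
  extract {R = R} [] l⊆R = R , ↭-refl
  extract {l = x ∷ l} (x≢ ∷ u) l⊆R =
    let R₁ , R↭ = ∈-↭-∷ (l⊆R (here refl))
        R′ , R₁↭ = extract u λ y∈ → avoid R↭ (All.lookup x≢ y∈) (l⊆R (there y∈))
    in R′ , ↭-∷ R↭ R₁↭
    where
    avoid : ∀ {R R₁ y} → R ↭ x ∷ R₁ → x ≢ y → y ∈ R → y ∈ R₁
    avoid R↭ x≢y y∈ with ∈-resp-↭ R↭ y∈
    ... | here y≡x = ⊥-elim (x≢y (sym y≡x))
    ... | there y∈ = y∈

  split-at : ∀ k (xs : List I) → k ≤ length xs → ∃ λ ys → ∃ λ zs → xs ≡ ys ++ zs × length ys ≡ k
  split-at zero    xs       _        = [] , xs , refl , refl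
  split-at (suc k) (x ∷ xs) (s≤s le) = let ys , zs , eq , l = split-at k xs le in x ∷ ys , zs , cong (x ∷_) eq , cong suc l

  minimum : ∀ (w : I → ℕ) x xs → ∃ λ y → ∃ λ ys → x ∷ xs ↭ y ∷ ys × (∀ {z} → z ∈ ys → w y ≤ w z)
  minimum w x [] = x , [] , ↭-refl , λ ()
  minimum w x (x′ ∷ xs) with minimum w x′ xs
  ... | y , ys , p , min with ≤-total (w x) (w y)
  ...   | inj₁ x≤y = x , y ∷ ys , prep x p , λ { (here refl) → x≤y ; (there z∈) → ≤-trans x≤y (min z∈) }
  ...   | inj₂ y≤x = y , x ∷ ys , ↭-trans (prep x p) (swap x y ↭-refl) , λ { (here refl) → y≤x ; (there z∈) → min z∈ }

  lowest : ∀ (w : I → ℕ) h xs → h ≤ length xs → ∃ λ lo → ∃ λ hi → ∃ λ t →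
    xs ↭ lo ++ hi × length lo ≡ h × (∀ {x} → x ∈ lo → w x ≤ t) × (∀ {x} → x ∈ hi → t ≤ w x)
  lowest w zero    xs       _        = [] , xs , 0 , ↭-refl , refl , (λ ()) , λ _ → z≤n
  lowest w (suc h) (x ∷ xs) (s≤s le) =
    let y , ys , p , min = minimum w x xs
        lo , hi , t , q , |lo| , lo≤ , ≤hi = lowest w h ys (subst (h ≤_) (suc-injective (↭-length p)) le)
    in y ∷ lo , hi , w y ⊔ t , ↭-∷ p q , cong suc |lo|
       , (λ { (here refl) → m≤m⊔n _ _ ; (there x∈) → ≤-trans (lo≤ x∈) (m≤n⊔m (w y) t) })
       , (λ x∈ → ⊔-lub (min (∈-resp-↭ (↭-sym q) (∈-++⁺ʳ lo x∈))) (≤hi x∈))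

  -- Triple systems, codegrees and degrees.

  record TripleSystem (V : Set) : Set where
    infix 4 _≟_
    field
      edge  : V → V → V → Bool
      swap₁ : ∀ a b c → edge a b c ≡ edge b a c
      swap₂ : ∀ a b c → edge a b c ≡ edge a c b
      edge-≢ : ∀ {a b c} → edge a b c ≡ true → a ≢ b
      _≟_   : DecidableEquality V

    edge-≢₂ : ∀ {a b c} → edge a b c ≡ true → b ≢ c
    edge-≢₂ {a} {b} {c} e = edge-≢ (trans (sym (trans (swap₁ a b c) (swap₂ b a c))) e)

    codegree : List V → V → V → ℕ
    codegree R v u = # (edge v u) R

    -- Ordered pairs: twice the degree of v into R.
    pairs : List V → V → ℕ
    pairs R v = ∑ R (codegree R v)

    codegree≤ : ∀ R v u → codegree R v u ≤ length R
    codegree≤ R v u = #≤length (edge v u) R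

    codegree-++ : ∀ {R} P Q v u → R ↭ P ++ Q → codegree R v u ≡ codegree P v u + codegree Q v u
    codegree-++ P Q v u R↭ = trans (∑-↭ _ R↭) (∑-++ P Q _)

    codegree-sum-swap : ∀ P Q v → ∑ P (codegree Q v) ≡ ∑ Q (codegree P v)
    codegree-sum-swap P Q v = trans (∑-swap P Q _) (∑-cong Q λ u → ∑-cong P λ x → cong 𝟙 (swap₂ v x u))

    -- A pair lost from the link of `v` has a vertex of `P` in one of its two positions, and the
    -- positions are symmetric. The loss is kept as a sum over `P` because the growth argument
    -- weighs it vertex by vertex; where `P` is small, `pairs-remove-crude` is enough.
    pairs-remove : ∀ {R} P Q v → R ↭ P ++ Q → pairs R v ≤ pairs Q v + 2 * ∑ P (codegree R v)
    pairs-remove {R} P Q v R↭ = begin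
      ∑ R (codegree R v)                                                   ≡⟨ trans (∑-↭ _ R↭) (∑-++ P Q _) ⟩
      ∑ P (codegree R v) + ∑ Q (codegree R v)                              ≡⟨ cong (∑ P (codegree R v) +_) (trans (∑-cong Q λ u → codegree-++ P Q v u R↭) (∑-+ Q _ _)) ⟩
      ∑ P (codegree R v) + (∑ Q (codegree P v) + pairs Q v)                ≡⟨ cong (λ z → ∑ P (codegree R v) + (z + pairs Q v)) (codegree-sum-swap Q P v) ⟩
      ∑ P (codegree R v) + (∑ P (codegree Q v) + pairs Q v)                ≤⟨ +-monoʳ-≤ (∑ P (codegree R v)) (+-monoˡ-≤ (pairs Q v) (∑-mono P λ u → ≤-trans (m≤n+m _ _) (≤-reflexive (sym (codegree-++ P Q v u R↭))))) ⟩
      ∑ P (codegree R v) + (∑ P (codegree R v) + pairs Q v)                ≡⟨ arith (∑ P (codegree R v)) (pairs Q v) ⟩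
      pairs Q v + 2 * ∑ P (codegree R v)                                   ∎
      where
      open ≤-Reasoning
      arith : ∀ a b → a + (a + b) ≡ b + 2 * a
      arith = solve-∀

    pairs-remove-crude : ∀ {R} P Q v → R ↭ P ++ Q → pairs R v ≤ pairs Q v + 2 * (length P * length R)
    pairs-remove-crude {R} P Q v R↭ = ≤-trans (pairs-remove P Q v R↭)
      (+-monoʳ-≤ (pairs Q v) (*-monoʳ-≤ 2 (∑-≤const P (length R) λ {u} _ → codegree≤ R v u)))

  -- common-neighbours turns a (1/κ)-fraction into a (1/2κ(4κ)^k)-fraction.  It is
  -- applied to 16G, yielding a density of pairs, and to the result, yielding one
  -- of vertices.
  κ-pairs κ-vertices : (G s : ℕ) → ℕ
  κ-pairs G s = 2 * (16 * G) * (4 * (16 * G)) ^ (s + s)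
  κ-vertices G s = 2 * κ-pairs G s * (4 * κ-pairs G s) ^ suc s

  -- Light complete tripartite blocks.

  module _ (𝓗 : TripleSystem V) (w : V → ℕ) (G E s h : ℕ) where

    open TripleSystem 𝓗

    private
      κ₁ = 16 * G
      κ₂ = κ-pairs G s
      κ₃ = κ-vertices G s

    -- For v of low weight, a (1/16G)-fraction of the pairs in its link has small
    -- weight: otherwise the remaining pairs of the link, covered fractionally by
    -- the excess weight over t, would contradict fractional-cover.
    light-pairs : ∀ R Lo Hi Bd t v → let m = length R ; W = ∑ R w in
      R ↭ (Lo ++ Bd) ++ Hi → 0 < G → 0 < m → (32 * G + E + 1) * length (Lo ++ Bd) ≤ m →
      (∀ {x} → x ∈ Hi → t ≤ w x) → (7 * G + 3) * (m * m) ≤ 16 * G * pairs R v →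
      m * m ≤ 16 * G * (∑[ b ∈ Hi ] ∑[ c ∈ Hi ] 𝟙 (edge v b c ∧ (E * m * (w b + w c + 2 * t) ≤! (E + 1) * (4 * W))))
    light-pairs R Lo Hi Bd t v R↭ 0<G 0<m few t≤ rich = ≮⇒≥ contra
      where
      m = length R
      W = ∑ R w
      y = length (Lo ++ Bd)
      H = length Hi
      light : V → V → Bool
      light b c = E * m * (w b + w c + 2 * t) ≤! (E + 1) * (4 * W)
      S₁ = ∑[ b ∈ Hi ] ∑[ c ∈ Hi ] 𝟙 (edge v b c ∧ light b c)
      S₂ = ∑[ b ∈ Hi ] ∑[ c ∈ Hi ] 𝟙 (edge v b c ∧ not (light b c))
      m≡ : m ≡ y + H
      m≡ = trans (↭-length R↭) (length-++ (Lo ++ Bd))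
      split : ∀ a b → 𝟙 a ≡ 𝟙 (a ∧ b) + 𝟙 (a ∧ not b)
      split true  true  = refl
      split true  false = refl
      split false b     = refl
      S₁+S₂ : pairs Hi v ≡ S₁ + S₂
      S₁+S₂ = trans (∑-cong Hi λ b → trans (∑-cong Hi λ c → split (edge v b c) (light b c)) (∑-+ Hi _ _)) (∑-+ Hi _ _)
      w-split : ∀ {x} → x ∈ Hi → w x ≡ t + (w x ∸ t)
      w-split x∈ = sym (m+[n∸m]≡n (t≤ x∈))
      U = ∑[ x ∈ Hi ] (w x ∸ t)
      U≤ : U + H * t ≤ W
      U≤ = begin
        U + H * t                        ≡⟨ cong (U +_) (∑-const Hi t) ⟨
        U + ∑ Hi (λ _ → t)               ≡⟨ ∑-+ Hi _ _ ⟨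
        ∑[ x ∈ Hi ] (w x ∸ t + t)        ≤⟨ ∑-mono∈ Hi (λ x∈ → ≤-reflexive (m∸n+n≡m (t≤ x∈))) ⟩
        ∑ Hi w                           ≤⟨ m≤n+m _ _ ⟩
        ∑ (Lo ++ Bd) w + ∑ Hi w          ≡⟨ trans (∑-↭ w R↭) (∑-++ (Lo ++ Bd) Hi w) ⟨
        W                                ∎
        where open ≤-Reasoning
      threshold≤ : E * m * t ≤ (E + 1) * W
      threshold≤ = by-combining (E * m * t) ((E + 1) * W) ((E + 1) * U + 32 * G * y * t)
        (≤-reflexive (cong (E * t *_) m≡) ⊕ t ⊛ few ⊕ ≤-reflexive (cong (t *_) m≡) ⊕ (E + 1) ⊛ U≤)
        (arith E m t W U G y H)
        where
        arith : ∀ E m t W U G y H →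
          E * m * t + (E * t * (y + H) + (t * m + (t * (y + H) + (E + 1) * W))) + ((E + 1) * U + 32 * G * y * t)
          ≡ (E + 1) * W + (E * t * m + (t * ((32 * G + E + 1) * y) + (t * m + (E + 1) * (U + H * t))))
        arith = solve-∀
      -- Let `d = (E + 1) * W - E * m * t`. The two weights of a heavy pair exceed `t` by more than
      -- `4 * d / (E * m)` in total, so `f` covers the heavy pairs at level `4 * d + 1` and
      -- `fractional-cover` gives `4 * d < 4 * E * U`. But `U + H * t ≤ W`, and the factor
      -- `(E + 1) / E` makes up for the `y` vertices outside `Hi`, so `4 * E * U ≤ 4 * d`.
      contra : 16 * G * S₁ < m * m → ⊥
      contra few-light = absurd (m≤n⇒∃[o]m+o≡n threshold≤)
        where
        absurd : ∃ (λ d → E * m * t + d ≡ (E + 1) * W) → ⊥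
        absurd (d , d≡) = refute (4 * U) (cancelled ⊕ (4 * E) ⊛ U≤ ⊕ 4 ⊛ U≤ ⊕ (4 * t) ⊛ ≤-trans few′ (≤-reflexive m≡)
                         ⊕ ≤-reflexive (cong (4 *_) (trans (sym d≡) (cong (λ m → E * m * t + d) m≡))))
                       (arith E d U H t y W)
          where
          few′ : (E + 1) * y ≤ m
          few′ = ≤-trans (*-monoˡ-≤ y (≤-trans (m≤n+m (E + 1) (32 * G)) (≤-reflexive (sym (+-assoc (32 * G) E 1))))) few
          arith : ∀ E d U H t y W →
            suc (4 * d) + (4 * E * (U + H * t) + (4 * (U + H * t) + (4 * t * ((E + 1) * y) + 4 * ((E + 1) * W))))
            ≡ (4 * E * U + (4 * E * W + (4 * W + (4 * t * (y + H) + 4 * (E * (y + H) * t + d))))) + suc (4 * U)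
          arith = solve-∀
          many-heavy : 7 * (m * m) < 16 * S₂
          many-heavy = *-cancelˡ-< G (7 * (m * m)) (16 * S₂) (by-combining (suc (G * (7 * (m * m)))) (G * (16 * S₂)) (m * m)
            (rich ⊕ (16 * G) ⊛ pairs-remove-crude (Lo ++ Bd) Hi v R↭ ⊕ ≤-reflexive (cong (16 * G *_) S₁+S₂) ⊕ few-light
              ⊕ m ⊛ ≤-trans (*-monoˡ-≤ y (≤-trans (m≤m+n (32 * G) E) (m≤m+n _ 1))) few)
            (arith₂ G m (pairs R v) (pairs Hi v) y S₁ S₂))
            where
            arith₂ : ∀ G m D D′ y S₁ S₂ →
              suc (G * (7 * (m * m))) + (16 * G * D + (16 * G * (D′ + 2 * (y * m)) + (16 * G * (S₁ + S₂) + (m * m + m * m)))) + m * m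
              ≡ G * (16 * S₂) + ((7 * G + 3) * (m * m) + (16 * G * D + (16 * G * D′ + (suc (16 * G * S₁) + m * (32 * G * y)))))
            arith₂ = solve-∀
          f : V → ℕ
          f x = 2 * (E * m) * (w x ∸ t)
          covers : ∀ {b c} → b ∈ Hi → c ∈ Hi → edge v b c ∧ not (light b c) ≡ true → 2 * (4 * d + 1) ≤ f b + f c
          covers {b} {c} b∈ c∈ eq = by-combining (2 * (4 * d + 1)) (f b + f c) 0
            (2 ⊛ heavy ⊕ ≤-reflexive (cong (λ z → 2 * (E * m) * (z + w c + 2 * t)) (w-split b∈))
              ⊕ ≤-reflexive (cong (λ z → 2 * (E * m) * (t + (w b ∸ t) + z + 2 * t)) (w-split c∈))
              ⊕ ≤-reflexive (cong (8 *_) d≡))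
            (arith₃ E m d W t (w b) (w c) (w b ∸ t) (w c ∸ t))
            where
            heavy : suc ((E + 1) * (4 * W)) ≤ E * m * (w b + w c + 2 * t)
            heavy = ≤!-false (E * m * (w b + w c + 2 * t)) ((E + 1) * (4 * W)) (not-true (proj₂ (∧-true {edge v b c} eq)))
            arith₃ : ∀ E m d W t x y x′ y′ →
              2 * (4 * d + 1) + (2 * (E * m * (x + y + 2 * t)) + (2 * (E * m) * (t + x′ + y + 2 * t)
                + (2 * (E * m) * (t + x′ + (t + y′) + 2 * t) + 8 * ((E + 1) * W)))) + 0
              ≡ (2 * (E * m) * x′ + 2 * (E * m) * y′) + (2 * suc ((E + 1) * (4 * W)) + (2 * (E * m) * (x + y + 2 * t)
                + (2 * (E * m) * (t + x′ + y + 2 * t) + 8 * (E * m * t + d))))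
            arith₃ = solve-∀
          cancelled : suc (4 * d) ≤ 4 * E * U
          cancelled = *-cancelˡ-≤ m {{>-nonZero 0<m}} (begin
            m * suc (4 * d)      ≡⟨ cong (m *_) (+-comm 1 (4 * d)) ⟩
            m * (4 * d + 1)      ≤⟨ fractional-cover Hi (λ b c → edge v b c ∧ not (light b c)) m (≤-trans (m≤n+m H y) (≤-reflexive (sym m≡))) many-heavy (4 * d + 1) f covers ⟩
            2 * ∑ Hi f           ≡⟨ cong (2 *_) (∑-*ˡ Hi (2 * (E * m)) _) ⟩
            2 * (2 * (E * m) * U) ≡⟨ arith₄ E m U ⟩
            m * (4 * E * U)      ∎)
            where
            open ≤-Reasoning
            arith₄ : ∀ E m U → 2 * (2 * (E * m) * U) ≡ m * (4 * E * U)
            arith₄ = solve-∀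

    -- The sizes fit a loose path whose joints alternate between `A` and `B` and whose inner
    -- vertices lie in `C`. Such a path uses two vertices of `C` for each pair of joints, hence the
    -- coefficient 2 of `w c`.
    record LightBlock (R Gd : List V) : Set where
      field
        A B C : List V
        |A| : length A ≡ suc s
        |B| : length B ≡ s
        |C| : length C ≡ s + s
        uniqueA : Unique A
        uniqueB : Unique B
        uniqueC : Unique C
        A⊆ : ∀ {x} → x ∈ A → x ∈ Gd
        B⊆ : ∀ {x} → x ∈ B → x ∈ Gd
        C⊆ : ∀ {x} → x ∈ C → x ∈ Gd
        complete : ∀ {a b c} → a ∈ A → b ∈ B → c ∈ C → edge c a b ≡ true
        light : ∀ {a b c} → a ∈ A → b ∈ B → c ∈ C →
                E * length R * (w a + w b + 2 * w c) ≤ (E + 1) * (4 * ∑ R w)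

    -- C is found among the h lightest good vertices, A and B among the others.
    light-block : ∀ R Gd Bd → let m = length R in
      Unique R → R ↭ Gd ++ Bd → 0 < G → 0 < s → length Bd ≤ h → 2 * (32 * G + E + 1) * h ≤ m →
      4 * κ₁ * (s + s) ≤ h → 4 * κ₂ * suc s ≤ h → κ₃ * s ≤ h →
      (∀ {v} → v ∈ Gd → (7 * G + 3) * (m * m) ≤ 16 * G * pairs R v) →
      LightBlock R Gd
    light-block R Gd Bd uR R↭ 0<G 0<s Bd≤ m≥ h₁ h₂ h₃ rich =
      let Lo , Hi , t , Gd↭ , |Lo| , ≤t , t≤ = lowest w h Gd h≤Gd
      in core Lo Hi t Gd↭ |Lo| ≤t t≤
      where
      m = length R
      W = ∑ R w
      0<κ₁ : 0 < κ₁
      0<κ₁ = ≤-trans 0<G (m≤n*m G 16)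
      pos-^ : ∀ x k → 0 < x → 0 < x ^ k
      pos-^ x k 0<x = m^n>0 x {{>-nonZero 0<x}} k
      0<κ₂ : 0 < κ₂
      0<κ₂ = *-mono-≤ (*-mono-≤ {1} {2} (s≤s z≤n) 0<κ₁) (pos-^ (4 * κ₁) (s + s) (*-mono-≤ {1} {4} (s≤s z≤n) 0<κ₁))
      0<κ₃ : 0 < κ₃
      0<κ₃ = *-mono-≤ (*-mono-≤ {1} {2} (s≤s z≤n) 0<κ₂) (pos-^ (4 * κ₂) (suc s) (*-mono-≤ {1} {4} (s≤s z≤n) 0<κ₂))
      0<h : 0 < h
      0<h = ≤-trans (*-mono-≤ 0<κ₃ 0<s) h₃
      m≡ : m ≡ length Gd + length Bd
      m≡ = trans (↭-length R↭) (length-++ Gd)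
      64h≤m : 64 * h ≤ m
      64h≤m = by-combining (64 * h) m (2 * E * h + 2 * h) (m≥ ⊕ (64 * h) ⊛ 0<G) (arith h m G E)
        where
        arith : ∀ h m G E → 64 * h + (m + 64 * h * G) + (2 * E * h + 2 * h) ≡ m + (2 * (32 * G + E + 1) * h + 64 * h * 1)
        arith = solve-∀
      h≤Gd : h ≤ length Gd
      h≤Gd = by-combining h (length Gd) (62 * h) (64h≤m ⊕ ≤-reflexive m≡ ⊕ Bd≤) (arith h m (length Gd) (length Bd))
        where
        arith : ∀ h m g b → h + (m + (g + b + h)) + 62 * h ≡ g + (64 * h + (m + b))
        arith = solve-∀
      core : ∀ Lo Hi t → Gd ↭ Lo ++ Hi → length Lo ≡ h → (∀ {x} → x ∈ Lo → w x ≤ t) → (∀ {x} → x ∈ Hi → t ≤ w x) → LightBlock R Gd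
      core Lo Hi t Gd↭ |Lo| ≤t t≤ = second (common-neighbours (s + s) Lo (cartesianProduct Hi Hi) r κ₁ (m * m) 0<κ₁
          (subst (0 <_) (sym |Lo|) 0<h) (*-mono-≤ 0<m 0<m) Hi×Hi≤ dense (subst (4 * κ₁ * (s + s) ≤_) (sym |Lo|) h₁))
        where
        0<m : 0 < m
        0<m = ≤-trans 0<h (≤-trans (m≤n*m h 64) 64h≤m)
        R↭′ : R ↭ (Lo ++ Bd) ++ Hi
        R↭′ = ↭-trans R↭ (↭-trans (++⁺ʳ Bd Gd↭) (↭-trans (↭-reflexive (++-assoc Lo Hi Bd))
                (↭-trans (++⁺ˡ Lo (++-comm Hi Bd)) (↭-reflexive (sym (++-assoc Lo Bd Hi))))))
        y≤ : length (Lo ++ Bd) ≤ 2 * h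
        y≤ = ≤-trans (≤-reflexive (trans (length-++ Lo) (cong (_+ length Bd) |Lo|))) (≤-trans (+-monoʳ-≤ h Bd≤) (≤-reflexive (cong (h +_) (sym (+-identityʳ h)))))
        few : (32 * G + E + 1) * length (Lo ++ Bd) ≤ m
        few = ≤-trans (*-monoʳ-≤ (32 * G + E + 1) y≤) (≤-trans (≤-reflexive (arith (32 * G + E + 1) h)) m≥)
          where
          arith : ∀ x h → x * (2 * h) ≡ 2 * x * h
          arith = solve-∀
        |Hi| : length (Lo ++ Bd) + length Hi ≡ m
        |Hi| = sym (trans (↭-length R↭′) (length-++ (Lo ++ Bd)))
        Hi≤m : length Hi ≤ m
        Hi≤m = ≤-trans (m≤n+m _ _) (≤-reflexive |Hi|)
        h≤Hi : h ≤ length Hi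
        h≤Hi = by-combining h (length Hi) (61 * h) (64h≤m ⊕ ≤-reflexive (sym |Hi|) ⊕ y≤) (arith h m (length (Lo ++ Bd)) (length Hi))
          where
          arith : ∀ h m y H → h + (m + (y + H + 2 * h)) + 61 * h ≡ H + (64 * h + (m + y))
          arith = solve-∀
        r : V → V × V → Bool
        r v (b , c) = edge v b c ∧ (E * m * (w b + w c + 2 * t) ≤! (E + 1) * (4 * W))
        Hi×Hi≤ : length (cartesianProduct Hi Hi) ≤ m * m
        Hi×Hi≤ = ≤-trans (≤-reflexive (trans (length-∑ (cartesianProduct Hi Hi)) (trans (∑-× Hi Hi _)
                   (trans (∑-cong Hi λ _ → sym (length-∑ Hi)) (∑-const Hi (length Hi)))))) (*-mono-≤ Hi≤m Hi≤m)
        dense : length Lo * (m * m) ≤ κ₁ * (∑[ v ∈ Lo ] # (r v) (cartesianProduct Hi Hi))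
        dense = ≤-trans (∑-≥const Lo (m * m) λ {v} v∈ → ≤-trans
            (light-pairs R Lo Hi Bd t v R↭′ 0<G 0<m few t≤ (rich (∈-resp-↭ (↭-sym Gd↭) (∈-++⁺ˡ v∈))))
            (*-monoʳ-≤ κ₁ (≤-reflexive (sym (∑-× Hi Hi _)))))
          (≤-reflexive (∑-*ˡ Lo κ₁ _))
        second : (∃ λ C → ∃ λ Lo′ → Lo ↭ C ++ Lo′ × length C ≡ s + s ×
                   m * m ≤ κ₂ * # (λ y → all (λ v → r v y) C) (cartesianProduct Hi Hi)) → LightBlock R Gd
        second (C , Lo′ , Lo↭ , |C| , C≥) = third (common-neighbours (suc s) Hi Hi r₂ κ₂ (length Hi) 0<κ₂
            (≤-trans 0<h h≤Hi) (≤-trans 0<h h≤Hi) ≤-refl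
            (≤-trans (*-mono-≤ Hi≤m Hi≤m) (≤-trans C≥ (*-monoʳ-≤ κ₂ (≤-reflexive (∑-× Hi Hi _))))) (≤-trans h₂ h≤Hi))
          where
          r₂ : V → V → Bool
          r₂ a b = all (λ v → r v (a , b)) C
          third : (∃ λ A → ∃ λ Hi′ → Hi ↭ A ++ Hi′ × length A ≡ suc s ×
                     length Hi ≤ κ₃ * # (λ b → all (λ a → r₂ a b) A) Hi) → LightBlock R Gd
          third (A , Hi′ , Hi↭ , |A| , A≥) = fourth (split-at s Bs s≤)
            where
            Bs = select (λ b → all (λ a → r₂ a b) A) Hi
            s≤ : s ≤ length Bs
            s≤ = *-cancelˡ-≤ κ₃ {{>-nonZero 0<κ₃}} (≤-trans h₃ (≤-trans h≤Hi (≤-trans A≥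
                   (*-monoʳ-≤ κ₃ (≤-reflexive (sym (length-select _ Hi)))))))
            fourth : (∃ λ B → ∃ λ B′ → Bs ≡ B ++ B′ × length B ≡ s) → LightBlock R Gd
            fourth (B , B′ , Bs≡ , |B|) = record
              { A = A ; B = B ; C = C ; |A| = |A| ; |B| = |B| ; |C| = |C|
              ; uniqueA = unique-part uHi Hi↭
              ; uniqueB = unique-++ˡ B (subst Unique Bs≡ (unique-++ˡ Bs (unique-↭ (select-split _ Hi) uHi)))
              ; uniqueC = unique-part (unique-part uGd Gd↭) Lo↭
              ; A⊆ = λ x∈ → Hi⊆ (∈-resp-↭ (↭-sym Hi↭) (∈-++⁺ˡ x∈))
              ; B⊆ = λ x∈ → Hi⊆ (proj₁ (∈B x∈))
              ; C⊆ = λ x∈ → ∈-resp-↭ (↭-sym Gd↭) (∈-++⁺ˡ (∈Lo x∈))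
              ; complete = λ a∈ b∈ c∈ → proj₁ (∧-true (good a∈ b∈ c∈))
              ; light = λ {a} {b} {c} a∈ b∈ c∈ → ≤-trans
                  (*-monoʳ-≤ (E * m) (+-monoʳ-≤ (w a + w b) (*-monoʳ-≤ 2 (≤t (∈Lo c∈)))))
                  (≤!-sound _ ((E + 1) * (4 * W)) (proj₂ (∧-true {edge c a b} (good a∈ b∈ c∈))))
              }
              where
              uGd : Unique Gd
              uGd = unique-part uR R↭
              uHi : Unique Hi
              uHi = unique-part uGd (↭-trans Gd↭ (++-comm Lo Hi))
              Hi⊆ : ∀ {x} → x ∈ Hi → x ∈ Gd
              Hi⊆ x∈ = ∈-resp-↭ (↭-sym Gd↭) (∈-++⁺ʳ Lo x∈)
              ∈Lo : ∀ {x} → x ∈ C → x ∈ Lo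
              ∈Lo x∈ = ∈-resp-↭ (↭-sym Lo↭) (∈-++⁺ˡ x∈)
              ∈B : ∀ {x} → x ∈ B → x ∈ Hi × all (λ a → r₂ a x) A ≡ true
              ∈B x∈ = ∈-select⁻ _ Hi (subst (_ ∈_) (sym Bs≡) (∈-++⁺ˡ x∈))
              good : ∀ {a b c} → a ∈ A → b ∈ B → c ∈ C → r c (a , b) ≡ true
              good {a} {b} a∈ b∈ c∈ = all-true (λ v → r v (a , b)) (all-true (λ a → r₂ a b) (proj₂ (∈B b∈)) a∈) c∈

  -- Loose paths.

  elem : DecidableEquality V → V → List V → Bool
  elem _≟_ v []       = false
  elem _≟_ v (x ∷ xs) = does (v ≟ x) ∨ elem _≟_ v xs

  module _ (𝓗 : TripleSystem V) where

    open TripleSystem 𝓗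

    -- l lists the vertices of the path without its endpoint y, so that paths compose
    -- by _++_ and a closed path Path x x l lists every vertex once.
    data Path : V → V → List V → Set where
      []   : ∀ {x} → Path x x []
      step : ∀ {x u y z l} → edge x u y ≡ true → Path y z l → Path x z (x ∷ u ∷ l)

    _++ₚ_ : ∀ {x y z l l′} → Path x y l → Path y z l′ → Path x z (l ++ l′)
    []       ++ₚ q = q
    step e p ++ₚ q = step e (p ++ₚ q)

    -- Each round lays the edges `a c b` and `b c′ a′`. Twice the weight of its four listed vertices
    -- is the sum of the bounds for `a, b, c` and for `a, b, c′`, hence at most `2 * K` after
    -- scaling by `X`. The endpoint `e` is not counted.
    zigzag : ∀ (w : V → ℕ) X K k a A B C → length A ≡ k → length B ≡ k → length C ≡ k + k →
      (∀ {a′ b c} → a′ ∈ a ∷ A → b ∈ B → c ∈ C → edge c a′ b ≡ true × X * (w a′ + w b + 2 * w c) ≤ K) →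
      ∃ λ e → ∃ λ l → e ∈ a ∷ A × Path a e l × (a ∷ A) ++ B ++ C ↭ l ++ e ∷ [] × X * ∑ l w ≤ k * K
    zigzag w X K zero a [] [] [] |A| |B| |C| h = a , [] , here refl , [] , ↭-refl , ≤-reflexive (*-zeroʳ X)
    zigzag w X K (suc k) a (a′ ∷ A) (b ∷ B) (c ∷ []) |A| |B| |C| h with trans (suc-injective |C|) (+-suc k k)
    ... | ()
    zigzag w X K (suc k) a (a′ ∷ A) (b ∷ B) (c ∷ c′ ∷ C) |A| |B| |C| h =
      let e , l , e∈ , p , l↭ , l≤ = zigzag w X K k a′ A B C (suc-injective |A|) (suc-injective |B|)
            (suc-injective (trans (suc-injective |C|) (+-suc k k))) (λ a∈ b∈ c∈ → h (there a∈) (there b∈) (there (there c∈)))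
      in e , a ∷ c ∷ b ∷ c′ ∷ l , there e∈
       , step (trans (swap₁ a c b) (proj₁ (h (here refl) (here refl) (here refl))))
           (step (trans (swap₁ b c′ a′) (trans (swap₂ c′ b a′) (proj₁ (h (there (here refl)) (here refl) (there (here refl)))))) p)
       , prep a (begin
           a′ ∷ A ++ b ∷ B ++ c ∷ c′ ∷ C     ↭⟨ ++⁺ˡ (a′ ∷ A) (prep b (shifts B (c ∷ c′ ∷ []))) ⟩
           a′ ∷ A ++ (b ∷ c ∷ c′ ∷ []) ++ B ++ C   ↭⟨ shifts (a′ ∷ A) (b ∷ c ∷ c′ ∷ []) ⟩
           b ∷ c ∷ c′ ∷ (a′ ∷ A) ++ B ++ C         ↭⟨ swap b c ↭-refl ⟩
           c ∷ b ∷ c′ ∷ (a′ ∷ A) ++ B ++ C         ↭⟨ ++⁺ˡ (c ∷ b ∷ c′ ∷ []) l↭ ⟩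
           c ∷ b ∷ c′ ∷ l ++ e ∷ []               ∎)
       , *-cancelˡ-≤ 2 (by-combining _ (2 * (K + k * K)) 0
           (proj₂ (h (here refl) (here refl) (here refl)) ⊕ proj₂ (h (here refl) (here refl) (there (here refl))) ⊕ 2 ⊛ l≤)
           (arith X K (k * K) (w a) (w b) (w c) (w c′) (∑ l w)))
      where
      open PermutationReasoning
      arith : ∀ X K k a b c c′ l → 2 * (X * (a + (c + (b + (c′ + l))))) + (K + (K + 2 * k)) + 0
                                ≡ 2 * (K + k) + (X * (a + b + 2 * c) + (X * (a + b + 2 * c′) + 2 * (X * l)))
      arith = solve-∀

    elem-false : ∀ v xs {y} → elem _≟_ v xs ≡ false → y ∈ xs → v ≢ y
    elem-false v (x ∷ xs) eq y∈ with v ≟ x | y∈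
    ... | no v≢x | here refl = v≢x
    ... | no v≢x | there y∈  = elem-false v xs eq y∈

    count-≟ : ∀ {R} x → Unique R → # (λ u → does (u ≟ x)) R ≤ 1
    count-≟ {[]}    x u = z≤n
    count-≟ {y ∷ R} x (y≢ ∷ u) with y ≟ x
    ... | no  _    = count-≟ x u
    ... | yes refl = s≤s (≤-reflexive (absent y≢))
      where
      absent : ∀ {R} → All (y ≢_) R → # (λ u → does (u ≟ y)) R ≡ 0
      absent []        = refl
      absent {z ∷ _} (y≢z ∷ ps) with z ≟ y
      ... | yes refl = ⊥-elim (y≢z refl)
      ... | no  _    = absent ps

    count-elem : ∀ {R} xs → Unique R → # (λ u → elem _≟_ u xs) R ≤ length xs
    count-elem {R} []       u = ≤-reflexive (∑-zero R)
    count-elem {R} (x ∷ xs) u = begin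
      # (λ u → does (u ≟ x) ∨ elem _≟_ u xs) R                      ≤⟨ ∑-mono R (λ u → union (does (u ≟ x)) _) ⟩
      ∑[ u ∈ R ] (𝟙 (does (u ≟ x)) + 𝟙 (elem _≟_ u xs))             ≡⟨ ∑-+ R _ _ ⟩
      # (λ u → does (u ≟ x)) R + # (λ u → elem _≟_ u xs) R           ≤⟨ +-mono-≤ (count-≟ x u) (count-elem xs u) ⟩
      suc (length xs)                                               ∎
      where
      open ≤-Reasoning
      union : ∀ a b → 𝟙 (a ∨ b) ≤ 𝟙 a + 𝟙 b
      union true  b = s≤s z≤n
      union false b = ≤-refl

    count-avoiding : ∀ {R} (p : V → Bool) xs → Unique R → # p R ≤ # (λ u → p u ∧ not (elem _≟_ u xs)) R + length xs
    count-avoiding {R} p xs u = begin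
      # p R                                                                ≤⟨ ∑-mono R (λ u → cases (p u) (elem _≟_ u xs)) ⟩
      ∑[ u ∈ R ] (𝟙 (p u ∧ not (elem _≟_ u xs)) + 𝟙 (elem _≟_ u xs))        ≡⟨ ∑-+ R _ _ ⟩
      # (λ u → p u ∧ not (elem _≟_ u xs)) R + # (λ u → elem _≟_ u xs) R      ≤⟨ +-monoʳ-≤ _ (count-elem xs u) ⟩
      # (λ u → p u ∧ not (elem _≟_ u xs)) R + length xs                     ∎
      where
      open ≤-Reasoning
      cases : ∀ a b → 𝟙 a ≤ 𝟙 (a ∧ not b) + 𝟙 b
      cases true  true  = ≤-refl
      cases true  false = ≤-refl
      cases false b     = z≤n

  ∧-intro : ∀ {a b} → a ≡ true → b ≡ true → a ∧ b ≡ true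
  ∧-intro refl refl = refl

  ∨-introʳ : ∀ a {b} → b ≡ true → a ∨ b ≡ true
  ∨-introʳ true  _ = refl
  ∨-introʳ false p = p

  ∨-introˡ : ∀ {a} b → a ≡ true → a ∨ b ≡ true
  ∨-introˡ b refl = refl

  ∨-true : ∀ {a b} → a ∨ b ≡ true → a ≡ true ⊎ b ≡ true
  ∨-true {true}  _ = inj₁ refl
  ∨-true {false} p = inj₂ p

  #-∩ : ∀ {A : Set} (p q : A → Bool) xs → # p xs + # q xs ≤ length xs + # (λ x → p x ∧ q x) xs
  #-∩ p q xs = subst₂ _≤_ (∑-+ xs _ _) (trans (∑-+ xs _ _) (cong (_+ # (λ x → p x ∧ q x) xs) (sym (length-∑ xs))))
                 (∑-mono xs λ x → cases (p x) (q x))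
    where
    cases : ∀ a b → 𝟙 a + 𝟙 b ≤ 1 + 𝟙 (a ∧ b)
    cases true  b     = ≤-refl
    cases false true  = ≤-refl
    cases false false = z≤n

  am-gm : ∀ a b → 2 * (a * b) ≤ a * a + b * b
  am-gm a b with ≤-total a b
  ... | inj₁ a≤b = ordered a b a≤b
    where
    arith : ∀ a k → 2 * (a * (a + k)) + k * k ≡ a * a + (a + k) * (a + k)
    arith = solve-∀
    ordered : ∀ a b → a ≤ b → 2 * (a * b) ≤ a * a + b * b
    ordered a b a≤b = let k , eq = m≤n⇒∃[o]m+o≡n a≤b in
      subst (λ b → 2 * (a * b) ≤ a * a + b * b) eq (≤-trans (m≤m+n _ (k * k)) (≤-reflexive (arith a k)))
  ... | inj₂ b≤a = let k , eq = m≤n⇒∃[o]m+o≡n b≤a in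
      subst (λ a → 2 * (a * b) ≤ a * a + b * b) eq (≤-trans (m≤m+n _ (k * k)) (≤-reflexive (arith b k)))
    where
    arith : ∀ b k → 2 * ((b + k) * b) + k * k ≡ (b + k) * (b + k) + b * b
    arith = solve-∀

  -- Vertices of large codegree in dense links.

  module Abundance (𝓗 : TripleSystem V) (R : List V) where

    open TripleSystem 𝓗

    private m = length R

    -- By `adj-many`, `adj v` has density at least 5/8 = 80/128. The threshold 49/128 is the
    -- complement of this plus 1/128, so a neighbourhood counted by `big` meets every `adj v` in a
    -- 1/128 proportion.
    adj big : V → V → Bool
    adj v u = m ≤! 128 * codegree R v u
    big v u = 49 * m ≤! 128 * codegree R v u

    Dense : V → Set
    Dense v = 7 * (m * m) ≤ 16 * pairs R v

    -- A vertex outside `adj v` lies in fewer than `m / 128` pairs of the link. Together these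
    -- account for at most `m * m / 128` pairs through either position.
    adjacent-pairs : ∀ v → 128 * pairs R v ≤
      128 * (∑[ u ∈ R ] (𝟙 (adj v u) * # (λ x → edge v u x ∧ adj v x) R)) + 2 * (m * m)
    adjacent-pairs v = begin
      128 * pairs R v
        ≤⟨ *-monoʳ-≤ 128 (∑-mono R λ u → ≤-trans (∑-mono R λ x → cases (adj v u) (adj v x) (edge v u x))
             (≤-reflexive (trans (∑-+ R _ _) (cong₂ _+_ (trans (∑-+ R _ _) (cong₂ _+_ (∑-*ˡ R (𝟙 (adj v u)) _) (∑-*ˡ R (𝟙 (not (adj v u))) _))) refl)))) ⟩
      128 * (∑[ u ∈ R ] (𝟙 (adj v u) * # (λ x → edge v u x ∧ adj v x) R + 𝟙 (not (adj v u)) * codegree R v u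
               + (∑[ x ∈ R ] 𝟙 (not (adj v x)) * 𝟙 (edge v u x))))
        ≡⟨ cong (128 *_) (trans (∑-+ R _ _) (cong₂ _+_ (∑-+ R _ _) crossed)) ⟩
      128 * (main + rest + rest)
        ≡⟨ arith main rest ⟩
      128 * main + 2 * (128 * rest)
        ≤⟨ +-monoʳ-≤ (128 * main) (*-monoʳ-≤ 2 rest≤) ⟩
      128 * main + 2 * (m * m)
        ∎
      where
      open ≤-Reasoning
      main = ∑[ u ∈ R ] (𝟙 (adj v u) * # (λ x → edge v u x ∧ adj v x) R)
      rest = ∑[ u ∈ R ] (𝟙 (not (adj v u)) * codegree R v u)
      arith : ∀ a b → 128 * (a + b + b) ≡ 128 * a + 2 * (128 * b)
      arith = solve-∀
      cases : ∀ a b e → 𝟙 e ≤ 𝟙 a * 𝟙 (e ∧ b) + 𝟙 (not a) * 𝟙 e + 𝟙 (not b) * 𝟙 e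
      cases a     b     false = z≤n
      cases true  true  true  = ≤-refl
      cases true  false true  = ≤-refl
      cases false true  true  = ≤-refl
      cases false false true  = s≤s z≤n
      crossed : ∑[ u ∈ R ] ∑[ x ∈ R ] (𝟙 (not (adj v x)) * 𝟙 (edge v u x)) ≡ rest
      crossed = trans (∑-swap R R _) (∑-cong R λ x → trans (∑-*ˡ R (𝟙 (not (adj v x))) _)
                  (cong (𝟙 (not (adj v x)) *_) (∑-cong R λ u → cong 𝟙 (swap₂ v u x))))
      rest≤ : 128 * rest ≤ m * m
      rest≤ = ≤-trans (≤-reflexive (sym (∑-*ˡ R 128 _))) (∑-≤const R m λ {u} _ → small u)
        where
        small : ∀ u → 128 * (𝟙 (not (adj v u)) * codegree R v u) ≤ m
        small u with adj v u in eq
        ... | true  = z≤n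
        ... | false = ≤-trans (≤-reflexive (cong (128 *_) (*-identityˡ (codegree R v u)))) (<⇒≤ (≤!-false m (128 * codegree R v u) eq))

    -- All but a 1/64 proportion of the pairs lie inside `adj v`, so the square of its density is at
    -- least 7/16 - 1/64 = 27/64, which exceeds (5/8)² = 25/64.
    adj-many : ∀ v → Dense v → 5 * m ≤ 8 * # (adj v) R
    adj-many v dense = ≮⇒≥ λ lt → absurd (m≤n⇒∃[o]m+o≡n lt)
      where
      g = # (adj v) R
      main≤ : ∑[ u ∈ R ] (𝟙 (adj v u) * # (λ x → edge v u x ∧ adj v x) R) ≤ g * g
      main≤ = ≤-trans (∑-mono R λ u → *-monoʳ-≤ (𝟙 (adj v u)) (∑-mono R λ x → 𝟙-∧≤ʳ (edge v u x) (adj v x)))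
                (≤-reflexive (∑-*ʳ R g _))
      absurd : ∃ (λ k → suc (8 * g) + k ≡ 5 * m) → ⊥
      absurd (k , eq) = refute (256 * g * g + 864 * g * (1 + k) + 53 + 108 * k + 54 * k * k)
        (200 ⊛ dense ⊕ 25 ⊛ adjacent-pairs v ⊕ 3200 ⊛ main≤ ⊕ 54 ⊛ ≤-reflexive (cong₂ _*_ eq eq))
        (arith g k (pairs R v) (∑[ u ∈ R ] (𝟙 (adj v u) * # (λ x → edge v u x ∧ adj v x) R)) m)
        where
        arith : ∀ g k D M m →
          200 * (7 * (m * m)) + (25 * (128 * D) + (3200 * M + 54 * ((suc (8 * g) + k) * (suc (8 * g) + k))))
          ≡ (200 * (16 * D) + (25 * (128 * M + 2 * (m * m)) + (3200 * (g * g) + 54 * ((5 * m) * (5 * m)))))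
            + suc (256 * g * g + 864 * g * (1 + k) + 53 + 108 * k + 54 * k * k)
        arith = solve-∀

    -- If few common neighbours z of x and y had 49/128 of R in the link of x,
    -- then with p, q, i the sizes of the two differences and of the intersection
    -- of the neighbourhoods, p ≤ q, the link of x would have density about
    -- p(p + i) + 3i/8 ≤ 25/64.
    common-big-ordered : ∀ x y → 0 < m → Dense x →
      # (λ u → adj x u ∧ not (adj y u)) R ≤ # (λ u → not (adj x u) ∧ adj y u) R →
      m ≤ 128 * # (λ z → adj x z ∧ adj y z ∧ (big x z ∨ big y z)) R
    common-big-ordered x y 0<m dense p≤q = ≮⇒≥ λ lt → absurd lt (m≤n⇒∃[o]m+o≡n 2p+i≤m)
      where
      bad : V → Bool
      bad z = adj x z ∧ adj y z ∧ (big x z ∨ big y z)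
      p = # (λ u → adj x u ∧ not (adj y u)) R
      q = # (λ u → not (adj x u) ∧ adj y u) R
      i = # (λ u → adj x u ∧ adj y u) R
      cnt = # bad R
      main = ∑[ u ∈ R ] (𝟙 (adj x u) * # (λ z → edge x u z ∧ adj x z) R)
      ξ≡ : # (adj x) R ≡ p + i
      ξ≡ = trans (∑-cong R λ u → split (adj x u) (adj y u)) (∑-+ R _ _)
        where
        split : ∀ a b → 𝟙 a ≡ 𝟙 (a ∧ not b) + 𝟙 (a ∧ b)
        split true  true  = refl
        split true  false = refl
        split false b     = refl
      p+q+i≤m : p + q + i ≤ m
      p+q+i≤m = subst₂ _≤_ (trans (∑-+ R _ _) (cong (_+ i) (∑-+ R _ _))) (sym (length-∑ R))
                  (∑-mono R λ u → cases (adj x u) (adj y u))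
        where
        cases : ∀ a b → 𝟙 (a ∧ not b) + 𝟙 (not a ∧ b) + 𝟙 (a ∧ b) ≤ 1
        cases true  true  = ≤-refl
        cases true  false = ≤-refl
        cases false true  = ≤-refl
        cases false false = z≤n
      2p+i≤m : 2 * p + i ≤ m
      2p+i≤m = ≤-trans (+-monoˡ-≤ i (+-monoʳ-≤ p (≤-trans (≤-reflexive (+-identityʳ p)) p≤q))) p+q+i≤m
      -- Three bounds on the degree of `u` inside `adj x`: the size `p + i` of `adj x` if `u` is
      -- outside `adj y`, the threshold of `big` if `u` is common but not `bad`, and the trivial `m`
      -- if it is `bad`.
      pointwise : ∀ u → 128 * (𝟙 (adj x u) * # (λ z → edge x u z ∧ adj x z) R)
                      ≤ 128 * (p + i) * 𝟙 (adj x u ∧ not (adj y u)) + 49 * m * 𝟙 (adj x u ∧ adj y u) + 128 * m * 𝟙 (bad u)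
      pointwise u = cases (adj x u) (adj y u) (big x u) (big y u) refl
        where
        c = # (λ z → edge x u z ∧ adj x z) R
        c≤codegree : c ≤ codegree R x u
        c≤codegree = ∑-mono R λ z → 𝟙-∧≤ˡ (edge x u z) (adj x z)
        c≤ξ : c ≤ p + i
        c≤ξ = ≤-trans (∑-mono R λ z → 𝟙-∧≤ʳ (edge x u z) (adj x z)) (≤-reflexive ξ≡)
        c≤m : c ≤ m
        c≤m = ≤-trans c≤codegree (codegree≤ R x u)
        1* : ∀ c → 128 * (1 * c) ≡ 128 * c * 1
        1* = solve-∀
        cases : ∀ a b d e → big x u ≡ d → 128 * (𝟙 a * c)
                ≤ 128 * (p + i) * 𝟙 (a ∧ not b) + 49 * m * 𝟙 (a ∧ b) + 128 * m * 𝟙 (a ∧ b ∧ (d ∨ e))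
        cases false b     d     e eq = z≤n
        cases true  false d     e eq = ≤-trans (≤-reflexive (1* c)) (≤-trans (*-monoˡ-≤ 1 (*-monoʳ-≤ 128 c≤ξ)) (≤-trans (m≤m+n _ _) (m≤m+n _ _)))
        cases true  true  true  e eq = ≤-trans (≤-reflexive (1* c)) (≤-trans (*-monoˡ-≤ 1 (*-monoʳ-≤ 128 c≤m)) (m≤n+m _ _))
        cases true  true  false e eq = ≤-trans (≤-reflexive (1* c)) (≤-trans (*-monoˡ-≤ 1 (≤-trans (*-monoʳ-≤ 128 c≤codegree) (<⇒≤ (≤!-false (49 * m) _ eq))))
                                         (≤-trans (m≤n+m _ (128 * (p + i) * 0)) (m≤m+n _ _)))
      main≤ : 128 * main ≤ 128 * (p + i) * p + 49 * m * i + 128 * m * cnt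
      main≤ = subst₂ _≤_ (∑-*ˡ R 128 _)
        (trans (∑-+ R _ _) (cong₂ _+_ (trans (∑-+ R _ _) (cong₂ _+_ (∑-*ˡ R (128 * (p + i)) _) (∑-*ˡ R (49 * m) _))) (∑-*ˡ R (128 * m) _)))
        (∑-mono R pointwise)
      absurd : 128 * cnt < m → ∃ (λ j → 2 * p + i + j ≡ m) → ⊥
      absurd lt (j , eq) = refute (3 + 287 * p * p + 848 * p * j + 228 * i * j + 212 * j * j)
        (32 ⊛ dense ⊕ 4 ⊛ adjacent-pairs x ⊕ 4 ⊛ main≤ ⊕ (4 * m) ⊛ lt ⊕ 4 ⊛ 0<m ⊕ am-gm (7 * p) (4 * i))
        (subst (λ m → 32 * (7 * (m * m)) + (4 * (128 * D) + (4 * (128 * main) + (4 * m * suc (128 * cnt) + (4 * 1 + 2 * ((7 * p) * (4 * i))))))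
                    ≡ (32 * (16 * D) + (4 * (128 * main + 2 * (m * m)) + (4 * (128 * (p + i) * p + 49 * m * i + 128 * m * cnt)
                      + (4 * m * m + (4 * m + ((7 * p) * (7 * p) + (4 * i) * (4 * i)))))))
                      + suc (3 + 287 * p * p + 848 * p * j + 228 * i * j + 212 * j * j))
          eq (arith p i j D main cnt))
        where
        D = pairs R x
        arith : ∀ p i j D M c →
          32 * (7 * ((2 * p + i + j) * (2 * p + i + j))) + (4 * (128 * D) + (4 * (128 * M) + (4 * (2 * p + i + j) * suc (128 * c) + (4 * 1 + 2 * ((7 * p) * (4 * i))))))
          ≡ (32 * (16 * D) + (4 * (128 * M + 2 * ((2 * p + i + j) * (2 * p + i + j))) + (4 * (128 * (p + i) * p + 49 * (2 * p + i + j) * i + 128 * (2 * p + i + j) * c)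
            + (4 * (2 * p + i + j) * (2 * p + i + j) + (4 * (2 * p + i + j) + ((7 * p) * (7 * p) + (4 * i) * (4 * i)))))))
            + suc (3 + 287 * p * p + 848 * p * j + 228 * i * j + 212 * j * j)
        arith = solve-∀

    common-big : ∀ x y → 0 < m → Dense x → Dense y →
      m ≤ 128 * # (λ z → adj x z ∧ adj y z ∧ (big x z ∨ big y z)) R
    common-big x y 0<m dx dy with ≤-total (# (λ u → adj x u ∧ not (adj y u)) R) (# (λ u → not (adj x u) ∧ adj y u) R)
    ... | inj₁ le = common-big-ordered x y 0<m dx le
    ... | inj₂ ge = subst (λ c → m ≤ 128 * c) (∑-cong R λ z → cong 𝟙 (rearrange (adj y z) (adj x z) (big y z) (big x z)))
      (common-big-ordered y x 0<m dy (subst₂ _≤_ (∑-cong R λ u → cong 𝟙 (∧-comm (not (adj x u)) (adj y u)))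
                                                 (∑-cong R λ u → cong 𝟙 (∧-comm (adj x u) (not (adj y u)))) ge))
      where
      rearrange : ∀ a b d e → a ∧ b ∧ (d ∨ e) ≡ b ∧ a ∧ (e ∨ d)
      rearrange true  true  d e = ∨-comm d e
      rearrange true  false d e = refl
      rearrange false true  d e = refl
      rearrange false false d e = refl

  -- Tuples chosen vertex by vertex.

  module _ (R : List V) where

    -- The next entry ranges over a set of density at least `1 / C` that may depend on the entries
    -- before it. In this form each entry needs only a codegree argument of its own, and repeated
    -- vertices can be discarded position by position.
    Plenty : ℕ → ∀ k → (Vec V k → Bool) → Set
    Plenty C zero    Q = Q [] ≡ true
    Plenty C (suc k) Q = ∃ λ (S : V → Bool) → length R ≤ C * # S R × (∀ {v} → v ∈ R → S v ≡ true → Plenty C k (Q ∘ (v ∷_)))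

    Plenty-map : ∀ C k {Q Q′ : Vec V k → Bool} → (∀ t → Q t ≡ true → Q′ t ≡ true) → Plenty C k Q → Plenty C k Q′
    Plenty-map C zero    f q             = f [] q
    Plenty-map C (suc k) f (S , S≥ , ps) = S , S≥ , λ v∈ Sv → Plenty-map C k (λ t → f (_ ∷ t)) (ps v∈ Sv)

    ∑^ : ∀ k → (Vec V k → ℕ) → ℕ
    ∑^ zero    f = f []
    ∑^ (suc k) f = ∑[ v ∈ R ] ∑^ k (f ∘ (v ∷_))

    Plenty-count : ∀ C k (Q : Vec V k → Bool) → Plenty C k Q → length R ^ k ≤ C ^ k * ∑^ k (𝟙 ∘ Q)
    Plenty-count C zero    Q q = ≤-reflexive (sym (trans (+-identityʳ _) (cong 𝟙 q)))
    Plenty-count C (suc k) Q (S , S≥ , ps) = begin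
      length R * length R ^ k                                     ≤⟨ *-monoˡ-≤ (length R ^ k) S≥ ⟩
      C * # S R * length R ^ k                                    ≡⟨ trans (*-assoc C _ _) (cong (C *_) (sym (∑-*ʳ R (length R ^ k) (𝟙 ∘ S)))) ⟩
      C * (∑[ v ∈ R ] 𝟙 (S v) * length R ^ k)                     ≤⟨ *-monoʳ-≤ C (∑-mono∈ R λ {v} v∈ → bound v∈ (S v) refl) ⟩
      C * (∑[ v ∈ R ] C ^ k * ∑^ k (λ t → 𝟙 (Q (v ∷ t))))          ≡⟨ cong (C *_) (∑-*ˡ R (C ^ k) _) ⟩
      C * (C ^ k * ∑^ (suc k) (𝟙 ∘ Q))                            ≡⟨ *-assoc C (C ^ k) _ ⟨
      C ^ suc k * ∑^ (suc k) (𝟙 ∘ Q)                              ∎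
      where
      open ≤-Reasoning
      bound : ∀ {v} → v ∈ R → ∀ b → S v ≡ b → 𝟙 b * length R ^ k ≤ C ^ k * ∑^ k (λ t → 𝟙 (Q (v ∷ t)))
      bound v∈ true  Sv = ≤-trans (≤-reflexive (+-identityʳ _)) (Plenty-count C k _ (ps v∈ Sv))
      bound v∈ false Sv = z≤n

    ∑^-cong : ∀ k {f g : Vec V k → ℕ} → (∀ t → f t ≡ g t) → ∑^ k f ≡ ∑^ k g
    ∑^-cong zero    f≗g = f≗g []
    ∑^-cong (suc k) f≗g = ∑-cong R λ v → ∑^-cong k (λ t → f≗g (v ∷ t))

    ∑^-*ˡ : ∀ k c (f : Vec V k → ℕ) → ∑^ k (λ t → c * f t) ≡ c * ∑^ k f
    ∑^-*ˡ zero    c f = refl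
    ∑^-*ˡ (suc k) c f = trans (∑-cong R λ v → ∑^-*ˡ k c _) (∑-*ˡ R c _)

    ∑^-swap : ∀ {A : Set} k (xs : List A) (f : A → Vec V k → ℕ) → ∑[ x ∈ xs ] ∑^ k (f x) ≡ ∑^ k (λ t → ∑[ x ∈ xs ] f x t)
    ∑^-swap zero    xs f = refl
    ∑^-swap (suc k) xs f = trans (∑-swap xs R _) (∑-cong R λ v → ∑^-swap k xs (λ x t → f x (v ∷ t)))

    average^ : ∀ k (f : Vec V k → ℕ) K → 0 < length R → length R ^ k * K ≤ ∑^ k f →
               ∃ λ t → (∀ {v} → v ∈ toList t → v ∈ R) × K ≤ f t
    average^ zero    f K _   le = [] , (λ ()) , ≤-trans (≤-reflexive (sym (+-identityʳ K))) le
    average^ (suc k) f K 0<R le =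
      let v , v∈ , le′ = average R (λ v → ∑^ k (f ∘ (v ∷_))) (length R ^ k * K) 0<R (≤-trans (≤-reflexive (sym (*-assoc (length R) _ K))) le)
          t , t⊆ , K≤ = average^ k (f ∘ (v ∷_)) K 0<R le′
      in v ∷ t , (λ { (here refl) → v∈ ; (there u∈) → t⊆ u∈ }) , K≤

  -- Absorbing tuples and short connections.

  module _ (𝓗 : TripleSystem V) where

    open TripleSystem 𝓗

    fresh : List V → ∀ {k} → Vec V k → Bool
    fresh seen []      = true
    fresh seen (v ∷ t) = not (elem _≟_ v seen) ∧ fresh (v ∷ seen) t

    fresh-avoids : ∀ seen {k} (t : Vec V k) → fresh seen t ≡ true → ∀ {u v} → u ∈ seen → v ∈ toList t → v ≢ u
    fresh-avoids seen (v ∷ t) eq u∈ (here refl) = elem-false 𝓗 v seen (not-true (proj₁ (∧-true eq))) u∈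
    fresh-avoids seen (v ∷ t) eq u∈ (there v∈)  = fresh-avoids (v ∷ seen) t (proj₂ (∧-true {not (elem _≟_ v seen)} eq)) (there u∈) v∈

    fresh-unique : ∀ seen {k} (t : Vec V k) → fresh seen t ≡ true → Unique (toList t)
    fresh-unique seen []      eq = []
    fresh-unique seen (v ∷ t) eq =
      let rest = proj₂ (∧-true {not (elem _≟_ v seen)} eq)
      in All.tabulate (λ u∈ v≡u → fresh-avoids (v ∷ seen) t rest (here refl) u∈ (sym v≡u)) ∷ fresh-unique (v ∷ seen) t rest

    -- The earlier vertices are so few that they fill at most half of the admissible set at every
    -- position, so doubling `C` suffices.
    Plenty-fresh : ∀ {R} C k {Q} seen → Unique R → 2 * C * (length seen + k) ≤ length R →
                   Plenty R C k Q → Plenty R (2 * C) k (λ t → Q t ∧ fresh seen t)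
    Plenty-fresh C zero seen uR big q = ∧-intro q refl
    Plenty-fresh {R} C (suc k) {Q} seen uR big (S , S≥ , ps) = S′ , S′≥ , λ {v} v∈ S′v →
        let Sv , v∉ = ∧-true {S v} S′v
        in Plenty-map R (2 * C) k (λ t eq → let q , f = ∧-true {Q (v ∷ t)} eq in ∧-intro q (∧-intro v∉ f))
             (Plenty-fresh C k {Q ∘ (v ∷_)} (v ∷ seen) uR (subst (λ j → 2 * C * j ≤ length R) (+-suc (length seen) k) big) (ps v∈ Sv))
      where
      S′ : V → Bool
      S′ v = S v ∧ not (elem _≟_ v seen)
      S′≥ : length R ≤ 2 * C * # S′ R
      S′≥ = by-combining (length R) (2 * C * # S′ R) (2 * C * k + 2 * C) (2 ⊛ S≥ ⊕ (2 * C) ⊛ count-avoiding 𝓗 S seen uR ⊕ big)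
              (arith C k (length R) (# S R) (# S′ R) (length seen))
        where
        arith : ∀ C k m s s′ l → m + (2 * (C * s) + (2 * C * (s′ + l) + m)) + (2 * C * k + 2 * C) ≡ 2 * C * s′ + (2 * m + (2 * C * s + 2 * C * (l + suc k)))
        arith = solve-∀

    -- The vertices of a 7-tuple are listed in the order in which plenty-inserts finds
    -- them.  The path v₁ v₂ v₃ v₄ v₅ v₆ v₇ can be rerouted as v₁ v₃ v₂ x v₄ y v₆ v₅ v₇.
    base : Vec V 7 → Bool
    base (v₄ ∷ v₆ ∷ v₅ ∷ v₃ ∷ v₂ ∷ v₁ ∷ v₇ ∷ []) = edge v₁ v₂ v₃ ∧ edge v₃ v₄ v₅ ∧ edge v₅ v₆ v₇

    inserts : V → V → Vec V 7 → Bool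
    inserts x y (v₄ ∷ v₆ ∷ v₅ ∷ v₃ ∷ v₂ ∷ v₁ ∷ v₇ ∷ []) = edge v₂ x v₄ ∧ edge v₄ y v₆

    absorbs : V → V → Vec V 7 → Bool
    absorbs x y t = base t ∧ (inserts x y t ∨ inserts y x t)

    module _ (R : List V) (0<m : 0 < length R) (dense : ∀ v → Abundance.Dense 𝓗 R v) where

      open Abundance 𝓗 R
      private m = length R

      adj-both : ∀ u v → m ≤ 128 * # (λ x → adj u x ∧ adj v x) R
      adj-both u v = by-combining m (128 * b) (31 * m) (16 ⊛ adj-many u (dense u) ⊕ 16 ⊛ adj-many v (dense v) ⊕ 128 ⊛ #-∩ (adj u) (adj v) R)
        (arith m (# (adj u) R) (# (adj v) R) b)
        where
        b = # (λ x → adj u x ∧ adj v x) R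
        arith : ∀ m p q b → m + (16 * (8 * p) + (16 * (8 * q) + 128 * (m + b))) + 31 * m ≡ 128 * b + (16 * (5 * m) + (16 * (5 * m) + 128 * (p + q)))
        arith = solve-∀

      big-adj : ∀ x z v → big x z ≡ true → m ≤ 128 * # (λ u → edge x z u ∧ adj v u) R
      big-adj x z v bg = by-combining m (128 * b) 0 (≤!-sound (49 * m) _ bg ⊕ 16 ⊛ adj-many v (dense v) ⊕ 128 ⊛ #-∩ (edge x z) (adj v) R)
        (arith m (codegree R x z) (# (adj v) R) b)
        where
        b = # (λ u → edge x z u ∧ adj v u) R
        arith : ∀ m p q b → m + (128 * p + (16 * (8 * q) + 128 * (m + b))) + 0 ≡ 128 * b + (49 * m + (16 * (5 * m) + 128 * (p + q)))
        arith = solve-∀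

      rotate : ∀ {a b c} → edge a b c ≡ true → edge c a b ≡ true
      rotate {a} {b} {c} e = trans (swap₁ c a b) (trans (swap₂ a c b) e)

      -- Every vertex is confined by one linear codegree or by two sets `adj`, each of density 5/8.
      -- The exception is `v₂`, which needs both an edge with `x` and `z` and a linear codegree with
      -- `v₃`; this is why `big x z` is required.
      plenty-inserts : ∀ x y z → big x z ≡ true → adj y z ≡ true →
        Plenty R 128 6 (λ t → base (z ∷ t) ∧ inserts x y (z ∷ t))
      plenty-inserts x y z bg ad =
        edge y z , ≤!-sound m _ ad , λ {v₆} _ e₆ →
        (λ u → adj v₆ u ∧ adj z u) , adj-both v₆ z , λ {v₅} _ a₅ →
        edge z v₅ , ≤!-sound m _ (proj₂ (∧-true {adj v₆ v₅} a₅)) , λ {v₃} _ e₃ →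
        (λ u → edge x z u ∧ adj v₃ u) , big-adj x z v₃ bg , λ {v₂} _ e₂ →
        edge v₃ v₂ , ≤!-sound m _ (proj₂ (∧-true {edge x z v₂} e₂)) , λ {v₁} _ e₁ →
        edge v₆ v₅ , ≤!-sound m _ (proj₁ (∧-true {adj v₆ v₅} a₅)) , λ {v₇} _ e₇ →
        ∧-intro (∧-intro (trans (swap₂ v₁ v₂ v₃) (rotate e₁)) (∧-intro (rotate e₃) (trans (swap₁ v₅ v₆ v₇) e₇)))
                (∧-intro (rotate (proj₁ (∧-true e₂))) (trans (swap₁ z y v₆) e₆))

      plenty-absorbs : ∀ x y → Plenty R 128 7 (absorbs x y)
      plenty-absorbs x y = (λ z → adj x z ∧ adj y z ∧ (big x z ∨ big y z)) , common-big x y 0<m (dense x) (dense y) , λ {z} _ Sz →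
        let ax , rest = ∧-true {adj x z} Sz
            ay , bg   = ∧-true {adj y z} rest
        in from-big z ax ay (∨-true {big x z} bg)
        where
        from-big : ∀ z → adj x z ≡ true → adj y z ≡ true → big x z ≡ true ⊎ big y z ≡ true → Plenty R 128 6 (λ t → absorbs x y (z ∷ t))
        from-big z ax ay (inj₁ bx) = Plenty-map R 128 6 (λ t eq → let b , i = ∧-true {base (z ∷ t)} {inserts x y (z ∷ t)} eq in ∧-intro b (∨-introˡ (inserts y x (z ∷ t)) i)) (plenty-inserts x y z bx ay)
        from-big z ax ay (inj₂ by) = Plenty-map R 128 6 (λ t eq → let b , i = ∧-true {base (z ∷ t)} {inserts y x (z ∷ t)} eq in ∧-intro b (∨-introʳ (inserts x y (z ∷ t)) i)) (plenty-inserts y x z by ax)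

    -- The path is `p a z b q`, where `z` has linear codegree with both ends; two sets of density
    -- 5/8 have such a `z` in common. More than 128 vertices make each of these codegrees at least
    -- 2, which leaves a choice of `b` other than `a`.
    connect : ∀ R → Unique R → 128 < length R → ∀ p q → Abundance.Dense 𝓗 R p → Abundance.Dense 𝓗 R q →
      ∃ λ l → ∃ λ R′ → length l ≡ 3 × R ↭ l ++ R′ × Path 𝓗 p q (p ∷ l)
    connect R uR 128<m p q dp dq =
      let z , z∈ , az = find (λ z → adj p z ∧ adj q z) R common
          ap , aq = ∧-true {adj p z} az
          a , a∈ , ea = find (edge p z) R (one (≤!-sound m _ ap))
          b , b∈ , eb = find (λ u → edge q z u ∧ not (elem _≟_ u (a ∷ []))) R (two a (≤!-sound m _ aq))
          eb₁ , eb₂ = ∧-true {edge q z b} eb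
          z≢a = edge-≢₂ ea
          z≢b = edge-≢₂ eb₁
          b≢a = elem-false 𝓗 b (a ∷ []) (not-true eb₂) (here refl)
          R′ , R↭ = extract {l = a ∷ z ∷ b ∷ []}
                      ((z≢a ∘ sym ∷ b≢a ∘ sym ∷ []) ∷ (z≢b ∷ []) ∷ [] ∷ [])
                      (λ { (here refl) → a∈ ; (there (here refl)) → z∈ ; (there (there (here refl))) → b∈ })
      in a ∷ z ∷ b ∷ [] , R′ , refl , R↭
         , step (trans (swap₂ p a z) ea) (step (trans (swap₂ z b q) (trans (swap₁ z q b) eb₁)) [])
      where
      open Abundance 𝓗 R
      m = length R
      common : 1 ≤ # (λ z → adj p z ∧ adj q z) R
      common = ≮⇒≥ λ lt → refute {L = 16 * (5 * m) + (16 * (5 * m) + (128 * (# (adj p) R + # (adj q) R) + (suc 128 + 128 * suc i)))} (31 * m + 128 )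
         (16 ⊛ adj-many p dp ⊕ 16 ⊛ adj-many q dq ⊕ 128 ⊛ #-∩ (adj p) (adj q) R ⊕ 128<m ⊕ 128 ⊛ lt)
         (arith m (# (adj p) R) (# (adj q) R) i)
        where
        i = # (λ z → adj p z ∧ adj q z) R
        arith : ∀ m p q i → 16 * (5 * m) + (16 * (5 * m) + (128 * (p + q) + (suc 128 + 128 * suc i)))
                ≡ (16 * (8 * p) + (16 * (8 * q) + (128 * (m + i) + (m + 128 * 1)))) + suc (31 * m + 128)
        arith = solve-∀
      one : ∀ {c} → m ≤ 128 * c → 1 ≤ c
      one {zero}  le = ⊥-elim (n≮0 (≤-trans 128<m le))
      one {suc c} le = s≤s z≤n
      two : ∀ a {z} → m ≤ 128 * codegree R q z → 1 ≤ # (λ u → edge q z u ∧ not (elem _≟_ u (a ∷ []))) R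
      two a {z} le = +-cancelʳ-≤ 1 1 _ (≤-trans (at-least-2 le) (count-avoiding 𝓗 (edge q z) (a ∷ []) uR))
        where
        at-least-2 : ∀ {c} → m ≤ 128 * c → 2 ≤ c
        at-least-2 {zero}        le = ⊥-elim (n≮0 (≤-trans 128<m le))
        at-least-2 {suc zero}    le = ⊥-elim (<⇒≱ 128<m le)
        at-least-2 {suc (suc c)} le = s≤s (s≤s z≤n)

  prepend-↭ : ∀ {A : Set} {vs l R R′ : List A} {a} N → vs ↭ (l ++ a ∷ []) ++ R → R ↭ N ++ R′ → vs ↭ ((N ++ l) ++ a ∷ []) ++ R′
  prepend-↭ {vs = vs} {l} {R} {R′} {a} N vs↭ R↭ = begin
    vs                              ↭⟨ vs↭ ⟩
    (l ++ a ∷ []) ++ R              ↭⟨ ++⁺ˡ (l ++ a ∷ []) R↭ ⟩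
    (l ++ a ∷ []) ++ N ++ R′        ↭⟨ shifts (l ++ a ∷ []) N ⟩
    N ++ (l ++ a ∷ []) ++ R′        ≡⟨ ++-assoc N (l ++ a ∷ []) R′ ⟨
    (N ++ l ++ a ∷ []) ++ R′        ≡⟨ cong (_++ R′) (++-assoc N l (a ∷ [])) ⟨
    ((N ++ l) ++ a ∷ []) ++ R′      ∎
    where open PermutationReasoning

  pos-term : ∀ {A : Set} (xs : List A) (f : A → ℕ) → 1 ≤ ∑ xs f → ∃ λ x → 1 ≤ f x
  pos-term (x ∷ xs) f le = at (f x) refl le
    where
    at : ∀ k → f x ≡ k → 1 ≤ k + ∑ xs f → ∃ λ x → 1 ≤ f x
    at zero    _  le = pos-term xs f le
    at (suc k) eq _  = x , subst (1 ≤_) (sym eq) (s≤s z≤n)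

  ^-distribʳ-* : ∀ k a b → (a * b) ^ k ≡ a ^ k * b ^ k
  ^-distribʳ-* zero    a b = refl
  ^-distribʳ-* (suc k) a b = trans (cong (a * b *_) (^-distribʳ-* k a b)) (arith a b (a ^ k) (b ^ k))
    where
    arith : ∀ a b x y → a * b * (x * y) ≡ a * x * (b * y)
    arith = solve-∀

  bernoulli : ∀ D q → (D + q) * D ^ q ≤ D * suc D ^ q
  bernoulli D zero    = ≤-reflexive (cong (_* 1) (+-identityʳ D))
  bernoulli D (suc q) = by-combining _ (D * suc D ^ suc q) (q * D ^ q) (suc D ⊛ bernoulli D q) (arith D q (D ^ q) (suc D ^ q))
    where
    arith : ∀ D q x y → (D + suc q) * (D * x) + suc D * (D * y) + q * x ≡ D * (suc D * y) + suc D * ((D + q) * x)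
    arith = solve-∀

  -- Bernoulli's inequality at the exponent `3 * D`: `(1 + 1/D)^(3D) ≥ 1 + 3`.
  quadruple : ∀ D → 0 < D → 4 * D ^ (3 * D) ≤ suc D ^ (3 * D)
  quadruple D 0<D = *-cancelˡ-≤ D {{>-nonZero 0<D}} (≤-trans (≤-reflexive (arith D (D ^ (3 * D)))) (bernoulli D (3 * D)))
    where
    arith : ∀ D x → D * (4 * x) ≡ (D + 3 * D) * x
    arith = solve-∀

  -- Chains of absorbers, and the weighted choice of the next one.

  module _ (𝓗 : TripleSystem V) where

    open TripleSystem 𝓗

    first last : Vec V 7 → V
    first (v₄ ∷ v₆ ∷ v₅ ∷ v₃ ∷ v₂ ∷ v₁ ∷ v₇ ∷ []) = v₁
    last  (v₄ ∷ v₆ ∷ v₅ ∷ v₃ ∷ v₂ ∷ v₁ ∷ v₇ ∷ []) = v₇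

    body : Vec V 7 → List V
    body (v₄ ∷ v₆ ∷ v₅ ∷ v₃ ∷ v₂ ∷ v₁ ∷ v₇ ∷ []) = v₁ ∷ v₂ ∷ v₃ ∷ v₄ ∷ v₅ ∷ v₆ ∷ []

    length-body : ∀ t → length (body t) ≡ 6
    length-body (v₄ ∷ v₆ ∷ v₅ ∷ v₃ ∷ v₂ ∷ v₁ ∷ v₇ ∷ []) = refl

    body-↭ : ∀ t → toList t ↭ body t ++ last t ∷ []
    body-↭ (v₄ ∷ v₆ ∷ v₅ ∷ v₃ ∷ v₂ ∷ v₁ ∷ v₇ ∷ []) = ↭-sym (begin
      v₁ ∷ v₂ ∷ v₃ ∷ v₄ ∷ v₅ ∷ v₆ ∷ v₇ ∷ []  ↭⟨ shift v₄ (v₁ ∷ v₂ ∷ v₃ ∷ []) _ ⟩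
      v₄ ∷ v₁ ∷ v₂ ∷ v₃ ∷ v₅ ∷ v₆ ∷ v₇ ∷ []  ↭⟨ prep v₄ (shift v₆ (v₁ ∷ v₂ ∷ v₃ ∷ v₅ ∷ []) _) ⟩
      v₄ ∷ v₆ ∷ v₁ ∷ v₂ ∷ v₃ ∷ v₅ ∷ v₇ ∷ []  ↭⟨ prep v₄ (prep v₆ (shift v₅ (v₁ ∷ v₂ ∷ v₃ ∷ []) _)) ⟩
      v₄ ∷ v₆ ∷ v₅ ∷ v₁ ∷ v₂ ∷ v₃ ∷ v₇ ∷ []  ↭⟨ prep v₄ (prep v₆ (prep v₅ (shift v₃ (v₁ ∷ v₂ ∷ []) _))) ⟩
      v₄ ∷ v₆ ∷ v₅ ∷ v₃ ∷ v₁ ∷ v₂ ∷ v₇ ∷ []  ↭⟨ prep v₄ (prep v₆ (prep v₅ (prep v₃ (swap v₁ v₂ ↭-refl)))) ⟩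
      v₄ ∷ v₆ ∷ v₅ ∷ v₃ ∷ v₂ ∷ v₁ ∷ v₇ ∷ []  ∎)
      where open PermutationReasoning

    base-path : ∀ t → base 𝓗 t ≡ true → Path 𝓗 (first t) (last t) (body t)
    base-path (v₄ ∷ v₆ ∷ v₅ ∷ v₃ ∷ v₂ ∷ v₁ ∷ v₇ ∷ []) eq =
      let e , eq′ = ∧-true {edge v₁ v₂ v₃} eq ; f , g = ∧-true {edge v₃ v₄ v₅} eq′
      in step e (step f (step g []))

    inserts-path : ∀ t x y → base 𝓗 t ≡ true → inserts 𝓗 x y t ≡ true →
                   ∃ λ l → Path 𝓗 (first t) (last t) l × l ↭ x ∷ y ∷ body t
    inserts-path (v₄ ∷ v₆ ∷ v₅ ∷ v₃ ∷ v₂ ∷ v₁ ∷ v₇ ∷ []) x y eq eq₂ =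
      let e , eq′ = ∧-true {edge v₁ v₂ v₃} eq ; f , g = ∧-true {edge v₃ v₄ v₅} eq′
          i , j = ∧-true {edge v₂ x v₄} eq₂
      in v₁ ∷ v₃ ∷ v₂ ∷ x ∷ v₄ ∷ y ∷ v₆ ∷ v₅ ∷ []
         , step (trans (swap₂ v₁ v₃ v₂) e) (step i (step j (step (trans (swap₁ v₆ v₅ v₇) g) [])))
         , (begin
             v₁ ∷ v₃ ∷ v₂ ∷ x ∷ v₄ ∷ y ∷ v₆ ∷ v₅ ∷ []  ↭⟨ shift x (v₁ ∷ v₃ ∷ v₂ ∷ []) _ ⟩
             x ∷ v₁ ∷ v₃ ∷ v₂ ∷ v₄ ∷ y ∷ v₆ ∷ v₅ ∷ []  ↭⟨ prep x (shift y (v₁ ∷ v₃ ∷ v₂ ∷ v₄ ∷ []) _) ⟩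
             x ∷ y ∷ v₁ ∷ v₃ ∷ v₂ ∷ v₄ ∷ v₆ ∷ v₅ ∷ []  ↭⟨ prep x (prep y (prep v₁ (swap v₃ v₂ (prep v₄ (swap v₆ v₅ ↭-refl))))) ⟩
             x ∷ y ∷ v₁ ∷ v₂ ∷ v₃ ∷ v₄ ∷ v₅ ∷ v₆ ∷ []  ∎)
      where open PermutationReasoning

    absorbs-path : ∀ t x y → absorbs 𝓗 x y t ≡ true → ∃ λ l → Path 𝓗 (first t) (last t) l × l ↭ x ∷ y ∷ body t
    absorbs-path t x y eq = either (∨-true {inserts 𝓗 x y t} or)
      where
      b = proj₁ (∧-true {base 𝓗 t} eq)
      or = proj₂ (∧-true {base 𝓗 t} eq)
      either : inserts 𝓗 x y t ≡ true ⊎ inserts 𝓗 y x t ≡ true → ∃ λ l → Path 𝓗 (first t) (last t) l × l ↭ x ∷ y ∷ body t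
      either (inj₁ i) = inserts-path t x y b i
      either (inj₂ i) = let l , p , l↭ = inserts-path t y x b i in l , p , ↭-trans l↭ (swap y x ↭-refl)

    data Chain : V → V → List (Vec V 7) → List V → Set where
      []     : ∀ {x} → Chain x x [] []
      plain  : ∀ {x y z gs l l′} → Path 𝓗 x y l → Chain y z gs l′ → Chain x z gs (l ++ l′)
      gadget : ∀ {z gs l} t → base 𝓗 t ≡ true → Chain (last t) z gs l → Chain (first t) z (t ∷ gs) (body t ++ l)

    chain-path : ∀ {x y gs l} → Chain x y gs l → Path 𝓗 x y l
    chain-path []             = []
    chain-path (plain p c)    = _++ₚ_ 𝓗 p (chain-path c)
    chain-path (gadget t b c) = _++ₚ_ 𝓗 (base-path t b) (chain-path c)

    absorb-one : ∀ {x z gs l t} a b → Chain x z gs l → t ∈ gs → absorbs 𝓗 a b t ≡ true →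
                 ∃ λ gs′ → ∃ λ l′ → Chain x z gs′ l′ × gs ↭ t ∷ gs′ × l′ ↭ a ∷ b ∷ l
    absorb-one a b (plain {l = l} p c) t∈ ab =
      let gs′ , l′ , c′ , gs↭ , l′↭ = absorb-one a b c t∈ ab
      in gs′ , l ++ l′ , plain p c′ , gs↭ , ↭-trans (++⁺ˡ l l′↭) (shifts l (a ∷ b ∷ []))
    absorb-one a b (gadget {gs = gs} {l} t e c) (here refl) ab =
      let l′ , p , l′↭ = absorbs-path t a b ab
      in gs , l′ ++ l , plain p c , ↭-refl , ++⁺ʳ l l′↭
    absorb-one a b (gadget t e c) (there t∈) ab =
      let gs′ , l′ , c′ , gs↭ , l′↭ = absorb-one a b c t∈ ab
      in t ∷ gs′ , body t ++ l′ , gadget t e c′ , ↭-trans (prep t gs↭) (swap t _ ↭-refl) , ↭-trans (++⁺ˡ (body t) l′↭) (shifts (body t) (a ∷ b ∷ []))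

    -- Each absorption uses up one tuple and so lowers the supply of every other pair by at most
    -- one; `j` absorbers per pair serve `j` pairs, however `U` is paired up.
    absorb-all : ∀ {x z} U j {gs l} → length U ≡ j + j → Chain x z gs l → (∀ a b → j ≤ # (absorbs 𝓗 a b) gs) →
                 ∃ λ l′ → Path 𝓗 x z l′ × l′ ↭ U ++ l
    absorb-all [] j {l = l} |U| c many = l , chain-path c , ↭-refl
    absorb-all (a ∷ []) (suc j) |U| c many with trans (suc-injective |U|) (+-suc j j)
    ... | ()
    absorb-all (a ∷ b ∷ U) (suc j) {gs} {l} |U| c many =
      let t , t∈ , ab = find (absorbs 𝓗 a b) gs (≤-trans (s≤s z≤n) (many a b))
          gs′ , l₁ , c₁ , gs↭ , l₁↭ = absorb-one a b c t∈ ab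
          l′ , p , l′↭ = absorb-all U j (suc-injective (trans (suc-injective |U|) (+-suc j j))) c₁
            (λ x y → +-cancelˡ-≤ 1 j _ (≤-trans (many x y) (≤-trans (≤-reflexive (∑-↭ (𝟙 ∘ absorbs 𝓗 x y) gs↭))
                       (+-monoˡ-≤ (# (absorbs 𝓗 x y) gs′) (𝟙≤1 (absorbs 𝓗 x y t))))))
      in l′ , p , ↭-trans l′↭ (↭-trans (++⁺ˡ U l₁↭) (shifts U (a ∷ b ∷ [])))

    -- The weight 2^(- number of absorbers) is multiplied by `2 ^ length gs` to stay among the
    -- natural numbers: a tuple doubles the weight unless it absorbs the pair.
    weight : V × V → List (Vec V 7) → ℕ
    weight (x , y) []       = 1
    weight (x , y) (t ∷ gs) = if absorbs 𝓗 x y t then weight (x , y) gs else 2 * weight (x , y) gs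

    weight-∷ : ∀ P t gs → weight P (t ∷ gs) + weight P gs * 𝟙 (absorbs 𝓗 (proj₁ P) (proj₂ P) t) ≡ 2 * weight P gs
    weight-∷ (x , y) t gs = cases (absorbs 𝓗 x y t) (weight (x , y) gs)
      where
      once : ∀ w → w + w * 1 ≡ 2 * w
      once = solve-∀
      cases : ∀ b w → (if b then w else 2 * w) + w * 𝟙 b ≡ 2 * w
      cases true  w = once w
      cases false w = trans (cong (2 * w +_) (*-zeroʳ w)) (+-identityʳ _)

    weight-absorbs : ∀ x y gs → 2 ^ # (absorbs 𝓗 x y) gs * weight (x , y) gs ≡ 2 ^ length gs
    weight-absorbs x y []       = refl
    weight-absorbs x y (t ∷ gs) = trans (cases (absorbs 𝓗 x y t) (# (absorbs 𝓗 x y) gs) (weight (x , y) gs)) (cong (2 *_) (weight-absorbs x y gs))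
      where
      arith₁ : ∀ a w → 2 * a * w ≡ 2 * (a * w)
      arith₁ = solve-∀
      arith₂ : ∀ a w → a * (2 * w) ≡ 2 * (a * w)
      arith₂ = solve-∀
      cases : ∀ b k w → 2 ^ (𝟙 b + k) * (if b then w else 2 * w) ≡ 2 * (2 ^ k * w)
      cases true  k w = arith₁ (2 ^ k) w
      cases false k w = arith₂ (2 ^ k) w

    0<weight : ∀ P gs → 0 < weight P gs
    0<weight P@(x , y) []       = s≤s z≤n
    0<weight P@(x , y) (t ∷ gs) = cases (absorbs 𝓗 x y t) (0<weight P gs)
      where
      cases : ∀ b {w} → 0 < w → 0 < (if b then w else 2 * w)
      cases true  h = h
      cases false h = ≤-trans h (m≤m+n _ _)

    plenty-fresh-absorbs : ∀ R c → c ≡ 2 * 128 → Unique R → c * 7 ≤ length R → 0 < length R → (∀ v → Abundance.Dense 𝓗 R v) → ∀ x y →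
      Plenty R c 7 (λ t → absorbs 𝓗 x y t ∧ fresh 𝓗 [] t)
    plenty-fresh-absorbs R .(2 * 128) refl uR m≥ 0<m dense x y = Plenty-fresh 𝓗 128 7 {absorbs 𝓗 x y} [] uR m≥ (plenty-absorbs 𝓗 R 0<m dense x y)

    -- Every pair is absorbed by a `1 / c ^ 7` proportion of all tuples, so on average a tuple
    -- absorbs this proportion of the total weight. The best tuple absorbs a positive weight, hence
    -- at least one pair, and from that pair come its `base` edges and distinct entries. Since `c`
    -- enters through an equation, `c ^ 7` stays symbolic.
    choose-gadget : ∀ R c (vs : List V) gs → c ≡ 2 * 128 → Unique R → c * 7 ≤ length R → 0 < length vs →
      (∀ v → Abundance.Dense 𝓗 R v) → let PP = cartesianProduct vs vs in
      ∃ λ t → (∀ {v} → v ∈ toList t → v ∈ R) × Unique (toList t) × base 𝓗 t ≡ true ×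
        ∑ PP (λ P → weight P gs) ≤ c ^ 7 * (∑[ P ∈ PP ] weight P gs * 𝟙 (absorbs 𝓗 (proj₁ P) (proj₂ P) t))
    choose-gadget R c vs gs c≡ uR m≥ 0<vs dense =
      finish (average^ R 7 (λ t → ∑[ P ∈ PP ] C * (ω P * 𝟙 (Q P t))) Ω 0<m total)
      where
      C = c ^ 7
      PP = cartesianProduct vs vs
      ω : V × V → ℕ
      ω P = weight P gs
      Ω = ∑ PP ω
      Q : V × V → Vec V 7 → Bool
      Q (x , y) t = absorbs 𝓗 x y t ∧ fresh 𝓗 [] t
      0<m : 0 < length R
      0<m = ≤-trans (*-mono-≤ {1} {c} {1} {7} (subst (1 ≤_) (sym c≡) (s≤s z≤n)) (s≤s z≤n)) m≥
      0<Ω : 0 < Ω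
      0<Ω = nonempty vs 0<vs
        where
        nonempty : ∀ vs → 0 < length vs → 0 < ∑ (cartesianProduct vs vs) ω
        nonempty (v ∷ vs) _ = ≤-trans (0<weight (v , v) gs) (m≤m+n _ _)
      positive-factor : ∀ C w {i} → 1 ≤ C * (w * i) → 1 ≤ i
      positive-factor C w {zero}  le = subst (1 ≤_) (trans (cong (C *_) (*-zeroʳ w)) (*-zeroʳ C)) le
      positive-factor C w {suc i} le = s≤s z≤n
      plenty : ∀ P → length R ^ 7 ≤ C * ∑^ R 7 (λ t → 𝟙 (Q P t))
      plenty (x , y) = Plenty-count R c 7 (Q (x , y)) (plenty-fresh-absorbs R c c≡ uR m≥ 0<m dense x y)
      total : length R ^ 7 * Ω ≤ ∑^ R 7 (λ t → ∑[ P ∈ PP ] C * (ω P * 𝟙 (Q P t)))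
      total = begin
        length R ^ 7 * Ω                                              ≡⟨ ∑-*ˡ PP (length R ^ 7) ω ⟨
        ∑[ P ∈ PP ] length R ^ 7 * ω P                                ≤⟨ ∑-mono PP (λ P → *-monoˡ-≤ (ω P) (plenty P)) ⟩
        ∑[ P ∈ PP ] C * ∑^ R 7 (λ t → 𝟙 (Q P t)) * ω P                ≡⟨ ∑-cong PP (λ P → arith C (∑^ R 7 (λ t → 𝟙 (Q P t))) (ω P)) ⟩
        ∑[ P ∈ PP ] C * (ω P * ∑^ R 7 (λ t → 𝟙 (Q P t)))              ≡⟨ ∑-cong PP (λ P → trans (cong (C *_) (sym (∑^-*ˡ R 7 (ω P) (λ t → 𝟙 (Q P t))))) (sym (∑^-*ˡ R 7 C (λ t → ω P * 𝟙 (Q P t))))) ⟩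
        ∑[ P ∈ PP ] ∑^ R 7 (λ t → C * (ω P * 𝟙 (Q P t)))              ≡⟨ ∑^-swap R 7 PP (λ P t → C * (ω P * 𝟙 (Q P t))) ⟩
        ∑^ R 7 (λ t → ∑[ P ∈ PP ] C * (ω P * 𝟙 (Q P t)))              ∎
        where
        open ≤-Reasoning
        arith : ∀ C s w → C * s * w ≡ C * (w * s)
        arith = solve-∀
      finish : (∃ λ t → (∀ {v} → v ∈ toList t → v ∈ R) × Ω ≤ ∑[ P ∈ PP ] C * (ω P * 𝟙 (Q P t))) →
        ∃ λ t → (∀ {v} → v ∈ toList t → v ∈ R) × Unique (toList t) × base 𝓗 t ≡ true ×
          Ω ≤ C * (∑[ P ∈ PP ] ω P * 𝟙 (absorbs 𝓗 (proj₁ P) (proj₂ P) t))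
      finish (t , t⊆ , le) = t , t⊆ , valid (pos-term PP _ (≤-trans 0<Ω le))
        where
        valid : (∃ λ P → 1 ≤ C * (ω P * 𝟙 (Q P t))) → Unique (toList t) × base 𝓗 t ≡ true ×
          Ω ≤ C * (∑[ P ∈ PP ] ω P * 𝟙 (absorbs 𝓗 (proj₁ P) (proj₂ P) t))
        valid (P , 1≤) =
          let ab , fr = ∧-true {absorbs 𝓗 (proj₁ P) (proj₂ P) t} (𝟙-sound (positive-factor C (ω P) 1≤))
          in fresh-unique 𝓗 [] t fr , proj₁ (∧-true {base 𝓗 t} ab)
           , ≤-trans le (≤-trans (≤-reflexive (∑-*ˡ PP C _)) (*-monoʳ-≤ C (∑-mono PP λ P → *-monoʳ-≤ (ω P) (𝟙-∧≤ˡ (absorbs 𝓗 (proj₁ P) (proj₂ P) t) (fresh 𝓗 [] t)))))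

  -- The absorbing path.

  module _ (𝓗 : TripleSystem V) where

    open TripleSystem 𝓗

    remove-few : ∀ {vs R} G P v → vs ↭ P ++ R → 32 * G * length P ≤ length vs →
      (7 * G + 8) * (length vs * length vs) ≤ 16 * G * pairs vs v →
      (7 * G + 7) * (length R * length R) ≤ 16 * G * pairs R v
    remove-few {vs} {R} G P v vs↭ few dense = by-combining ((7 * G + 7) * (m * m)) (16 * G * pairs R v) 0
      (dense ⊕ (16 * G) ⊛ pairs-remove-crude P R v vs↭ ⊕ n ⊛ few ⊕ (7 * G + 7) ⊛ *-mono-≤ m≤n m≤n)
      (arith G n m (length P) (pairs vs v) (pairs R v))
      where
      n = length vs
      m = length R
      m≤n : m ≤ n
      m≤n = ≤-trans (m≤n+m m (length P)) (≤-reflexive (sym (trans (↭-length vs↭) (length-++ P))))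
      arith : ∀ G n m p D D′ → (7 * G + 7) * (m * m) + (16 * G * D + (16 * G * (D′ + 2 * (p * n)) + (n * n + (7 * G + 7) * (n * n)))) + 0
        ≡ 16 * G * D′ + ((7 * G + 8) * (n * n) + (16 * G * D + (n * (32 * G * p) + (7 * G + 7) * (m * m))))
      arith = solve-∀

    rich⇒Dense : ∀ R G x v → 0 < G → 7 * G ≤ x → x * (length R * length R) ≤ 16 * G * pairs R v → Abundance.Dense 𝓗 R v
    rich⇒Dense R G x v 0<G 7G≤x rich = *-cancelˡ-≤ G {{>-nonZero 0<G}} (by-combining (G * (7 * (m * m))) (G * (16 * pairs R v)) 0
        (rich ⊕ (m * m) ⊛ 7G≤x) (arith G m x (pairs R v)))
      where
      m = length R
      arith : ∀ G m x p → G * (7 * (m * m)) + (16 * G * p + m * m * x) + 0 ≡ G * (16 * p) + (x * (m * m) + m * m * (7 * G))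
      arith = solve-∀

    record Partial (vs : List V) (a₀ : V) (R : List V) (gs : List (Vec V 7)) (len : ℕ) : Set where
      constructor partial
      field
        {head} : V
        {verts} : List V
        chain  : Chain 𝓗 head a₀ gs verts
        vs↭    : vs ↭ (verts ++ a₀ ∷ []) ++ R
        |verts| : length verts ≡ len

    module Absorbing (vs : List V) (uvs : Unique vs) (complete : ∀ v → v ∈ vs) (G c D : ℕ) (0<G : 0 < G)
      (c≡ : c ≡ 2 * 128) (D≡ : suc D ≡ 2 * c ^ 7) (n≥ : 2 * (c * 7) ≤ length vs)
      (dense : ∀ v → (7 * G + 8) * (length vs * length vs) ≤ 16 * G * pairs vs v) (a₀ : V) where

      private
        n = length vs
        C = c ^ 7
        PP = cartesianProduct vs vs

      Ω : List (Vec V 7) → ℕ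
      Ω gs = ∑[ P ∈ PP ] weight 𝓗 P gs

      -- At least a `1 / C` proportion of the weight escapes the doubling, so `Ω` grows by a factor
      -- of at most `2 - 1 / C`, which is `D / C`.
      Ω-step : ∀ t gs → Ω gs ≤ C * (∑[ P ∈ PP ] weight 𝓗 P gs * 𝟙 (absorbs 𝓗 (proj₁ P) (proj₂ P) t)) → C * Ω (t ∷ gs) ≤ D * Ω gs
      Ω-step t gs le = by-combining (C * Ω (t ∷ gs)) (D * Ω gs) 0
        (le ⊕ C ⊛ ≤-reflexive (trans (sym (∑-+ PP _ _)) (trans (∑-cong PP (λ P → weight-∷ 𝓗 P t gs)) (∑-*ˡ PP 2 _))) ⊕ ≤-reflexive (cong (_* Ω gs) (sym D≡)))
        (arith C (Ω (t ∷ gs)) (Ω gs) (∑[ P ∈ PP ] weight 𝓗 P gs * 𝟙 (absorbs 𝓗 (proj₁ P) (proj₂ P) t)) D)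
        where
        arith : ∀ C Ω′ Ω s D → C * Ω′ + (C * s + (C * (2 * Ω) + suc D * Ω)) + 0 ≡ D * Ω + (Ω + (C * (Ω′ + s) + 2 * C * Ω))
        arith = solve-∀

      -- A stage adds ten vertices at the front, seven of the tuple and three of the connection;
      -- `a₀` remains the far end and is not listed in the chain.
      Stage : ℕ → Set
      Stage i = ∃ λ gs → ∃ λ R → Partial vs a₀ R gs (10 * i) × length gs ≡ i × C ^ i * Ω gs ≤ D ^ i * Ω []

      Dense-outside : ∀ {R} P → vs ↭ P ++ R → 32 * G * length P ≤ n → ∀ v → Abundance.Dense 𝓗 R v
      Dense-outside {R} P vs↭ few v = rich⇒Dense R G (7 * G + 7) v 0<G (m≤m+n _ 7) (remove-few G P v vs↭ few (dense v))

      stage : ∀ i → 32 * G * (10 * i + 1) ≤ n → Stage i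
      stage zero few =
        let R , vs↭ = ∈-↭-∷ (complete a₀)
        in [] , R , partial [] vs↭ refl , refl , ≤-refl
      stage (suc i) few = extend (stage i (≤-trans (*-monoʳ-≤ (32 * G) (+-monoˡ-≤ 1 (*-monoʳ-≤ 10 (n≤1+n i)))) few))
        where
        few-monotone : ∀ {x} → x ≤ 10 * suc i + 1 → 32 * G * x ≤ n
        few-monotone le = ≤-trans (*-monoʳ-≤ (32 * G) le) few
        extend : Stage i → Stage (suc i)
        extend (gs , R , partial {p} {l} chain vs↭ |l| , |gs| , Ω≤) =
            add (choose-gadget 𝓗 R c vs gs c≡ uR m≥ 0<n (Dense-outside P vs↭ (few-monotone |P|≤)))
          where
          P = l ++ a₀ ∷ []
          |P| : length P ≡ 10 * i + 1
          |P| = trans (length-++ l) (cong (_+ 1) |l|)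
          |P|≤ : length P ≤ 10 * suc i + 1
          |P|≤ = ≤-trans (≤-reflexive |P|) (+-monoˡ-≤ 1 (*-monoʳ-≤ 10 (n≤1+n i)))
          uR : Unique R
          uR = unique-part uvs (↭-trans vs↭ (++-comm P R))
          0<c7 : 1792 ≤ c * 7
          0<c7 = subst (λ c → 1792 ≤ c * 7) (sym c≡) ≤-refl
          0<n : 0 < n
          0<n = ≤-trans (s≤s z≤n) (≤-trans 0<c7 (≤-trans (m≤n*m (c * 7) 2) n≥))
          m≥ : c * 7 ≤ length R
          m≥ = *-cancelˡ-≤ 2 (by-combining (2 * (c * 7)) (2 * length R) (30 * length P)
            (n≥ ⊕ 2 ⊛ ≤-reflexive (trans (↭-length vs↭) (length-++ P)) ⊕ few-monotone |P|≤ ⊕ (32 * length P) ⊛ 0<G) (arith (c * 7) n (length P) (length R) G))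
            where
            arith : ∀ x n p r G → 2 * x + (n + (2 * (p + r) + (n + 32 * p * G))) + 30 * p ≡ 2 * r + (2 * x + (2 * n + (32 * G * p + 32 * p * 1)))
            arith = solve-∀
          add : (∃ λ t → (∀ {v} → v ∈ toList t → v ∈ R) × Unique (toList t) × base 𝓗 t ≡ true ×
                  Ω gs ≤ C * (∑[ P ∈ PP ] weight 𝓗 P gs * 𝟙 (absorbs 𝓗 (proj₁ P) (proj₂ P) t))) → Stage (suc i)
          add (t , t⊆ , ut , bt , Ω≤C) = join (extract ut t⊆)
            where
            join : ∃ (λ R₁ → R ↭ toList t ++ R₁) → Stage (suc i)
            join (R₁ , R↭) = finish (connect 𝓗 R₁ uR₁ 128<m₁ (last 𝓗 t) p (dense₁ (last 𝓗 t)) (dense₁ p))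
              where
              |t| : length (toList t) ≡ 7
              |t| = length-toList t
              uR₁ : Unique R₁
              uR₁ = unique-part uR (↭-trans R↭ (++-comm (toList t) R₁))
              128<m₁ : 128 < length R₁
              128<m₁ = by-combining 129 (length R₁) 1656
                (0<c7 ⊕ m≥ ⊕ ≤-reflexive (trans (↭-length R↭) (trans (length-++ (toList t)) (cong (_+ length R₁) |t|)))) (arith (c * 7) (length R) (length R₁))
                where
                arith : ∀ x r r₁ → 129 + (x + (r + (7 + r₁))) + 1656 ≡ r₁ + (1792 + (x + r))
                arith = solve-∀
              dense₁ : ∀ v → Abundance.Dense 𝓗 R₁ v
              dense₁ = Dense-outside (P ++ toList t) (↭-trans vs↭ (↭-trans (++⁺ˡ P R↭) (↭-reflexive (sym (++-assoc P (toList t) R₁)))))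
                (few-monotone (≤-trans (≤-reflexive (trans (length-++ P) (cong₂ _+_ |P| |t|))) (by-combining (10 * i + 1 + 7) (10 * suc i + 1) 3 (z≤n {0}) (arith i))))
                where
                arith : ∀ i → 10 * i + 1 + 7 + 0 + 3 ≡ 10 * suc i + 1 + 0
                arith = solve-∀
              finish : (∃ λ l₃ → ∃ λ R₂ → length l₃ ≡ 3 × R₁ ↭ l₃ ++ R₂ × Path 𝓗 (last 𝓗 t) p (last 𝓗 t ∷ l₃)) → Stage (suc i)
              finish (l₃ , R₂ , |l₃| , R₁↭ , path) = t ∷ gs , R₂ ,
                  partial (subst (Chain 𝓗 (first 𝓗 t) a₀ (t ∷ gs)) (sym (++-assoc (body 𝓗 t) (last 𝓗 t ∷ l₃) l)) (gadget t bt (plain path chain)))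
                          (prepend-↭ N vs↭ R↭₂)
                          (trans (length-++ N) (trans (cong₂ _+_ (trans (length-++ (body 𝓗 t)) (cong₂ (λ a b → a + suc b) (length-body 𝓗 t) |l₃|)) |l|) (sym (*-suc 10 i))))
                  , cong suc |gs|
                  , (begin
                      C ^ suc i * Ω (t ∷ gs)    ≡⟨ arith C (C ^ i) (Ω (t ∷ gs)) ⟩
                      C ^ i * (C * Ω (t ∷ gs))  ≤⟨ *-monoʳ-≤ (C ^ i) (Ω-step t gs Ω≤C) ⟩
                      C ^ i * (D * Ω gs)        ≡⟨ arith₂ (C ^ i) D (Ω gs) ⟩
                      D * (C ^ i * Ω gs)        ≤⟨ *-monoʳ-≤ D Ω≤ ⟩
                      D * (D ^ i * Ω [])        ≡⟨ *-assoc D (D ^ i) _ ⟨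
                      D ^ suc i * Ω []          ∎)
                where
                open ≤-Reasoning
                arith : ∀ C x y → C * x * y ≡ x * (C * y)
                arith = solve-∀
                arith₂ : ∀ x D y → x * (D * y) ≡ D * (x * y)
                arith₂ = solve-∀
                N = body 𝓗 t ++ last 𝓗 t ∷ l₃
                R↭₂ : R ↭ N ++ R₂
                R↭₂ = ↭-trans R↭ (↭-trans (++⁺ (body-↭ 𝓗 t) R₁↭) (↭-reflexive
                  (trans (++-assoc (body 𝓗 t) (last 𝓗 t ∷ []) (l₃ ++ R₂)) (sym (++-assoc (body 𝓗 t) (last 𝓗 t ∷ l₃) R₂)))))

      Ω[] : Ω [] ≡ n * n
      Ω[] = trans (∑-× vs vs _) (trans (∑-cong vs λ x → trans (∑-const vs 1) (*-identityʳ n)) (∑-const vs n))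

      0<D : 0 < D
      0<D = ≤-pred (≤-trans (*-monoʳ-≤ 2 (m^n>0 c {{>-nonZero (subst (0 <_) (sym c≡) (s≤s z≤n))}} 7)) (≤-reflexive (sym D≡)))

      -- With `k = 3 * D * r`, a pair absorbed `a` times has weight `2 ^ (k - a)`, which is at most
      -- `Ω gs ≤ (D / C)^k * n²`. As `2 * C = suc D`, this reads `(suc D / D)^k ≤ 2 ^ a * n²`. By
      -- `quadruple` the left side is at least `4 ^ r`, so `n² < 2 ^ r` excludes `a < r`.
      absorbed-often : ∀ r gs → length gs ≡ 3 * D * r → C ^ (3 * D * r) * Ω gs ≤ D ^ (3 * D * r) * Ω [] → n * n < 2 ^ r →
        ∀ x y → r ≤ # (absorbs 𝓗 x y) gs
      absorbed-often r gs |gs| Ω≤ small x y = ≮⇒≥ λ a<r → <⇒≱ (strict a<r) upper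
        where
        k = 3 * D * r
        a = # (absorbs 𝓗 x y) gs
        w = weight 𝓗 (x , y) gs
        w≤Ω : w ≤ Ω gs
        w≤Ω = term≤∑ (λ P → weight 𝓗 P gs) (∈-cartesianProduct⁺ (complete x) (complete y))
        upper : 2 ^ r * 2 ^ r ≤ 2 ^ a * (n * n)
        upper = *-cancelˡ-≤ (D ^ k) {{>-nonZero (m^n>0 D {{>-nonZero 0<D}} k)}} (begin
          D ^ k * (2 ^ r * 2 ^ r)            ≡⟨ cong (D ^ k *_) (sym (^-distribʳ-* r 2 2)) ⟩
          D ^ k * 4 ^ r                      ≡⟨ cong (_* 4 ^ r) (sym (^-*-assoc D (3 * D) r)) ⟩
          (D ^ (3 * D)) ^ r * 4 ^ r          ≡⟨ *-comm ((D ^ (3 * D)) ^ r) _ ⟩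
          4 ^ r * (D ^ (3 * D)) ^ r          ≡⟨ ^-distribʳ-* r 4 (D ^ (3 * D)) ⟨
          (4 * D ^ (3 * D)) ^ r              ≤⟨ ^-monoˡ-≤ r (quadruple D 0<D) ⟩
          (suc D ^ (3 * D)) ^ r              ≡⟨ ^-*-assoc (suc D) (3 * D) r ⟩
          suc D ^ k                          ≡⟨ cong (_^ k) D≡ ⟩
          (2 * C) ^ k                        ≡⟨ ^-distribʳ-* k 2 C ⟩
          2 ^ k * C ^ k                      ≡⟨ cong (λ j → 2 ^ j * C ^ k) |gs| ⟨
          2 ^ length gs * C ^ k              ≡⟨ cong (_* C ^ k) (weight-absorbs 𝓗 x y gs) ⟨
          2 ^ a * w * C ^ k                  ≤⟨ *-monoˡ-≤ (C ^ k) (*-monoʳ-≤ (2 ^ a) w≤Ω) ⟩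
          2 ^ a * Ω gs * C ^ k               ≡⟨ arith (2 ^ a) (Ω gs) (C ^ k) ⟩
          2 ^ a * (C ^ k * Ω gs)             ≤⟨ *-monoʳ-≤ (2 ^ a) Ω≤ ⟩
          2 ^ a * (D ^ k * Ω [])             ≡⟨ cong (λ z → 2 ^ a * (D ^ k * z)) Ω[] ⟩
          2 ^ a * (D ^ k * (n * n))          ≡⟨ arith₂ (2 ^ a) (D ^ k) (n * n) ⟩
          D ^ k * (2 ^ a * (n * n))          ∎)
          where
          open ≤-Reasoning
          arith : ∀ a b c → a * b * c ≡ a * (c * b)
          arith = solve-∀
          arith₂ : ∀ a b c → a * (b * c) ≡ b * (a * c)
          arith₂ = solve-∀
        strict : a < r → 2 ^ a * (n * n) < 2 ^ r * 2 ^ r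
        strict a<r = ≤-<-trans (*-monoˡ-≤ (n * n) (^-monoʳ-≤ 2 (<⇒≤ a<r))) (*-monoʳ-< (2 ^ r) {{>-nonZero (m^n>0 2 r)}} small)

  -- The target for 16 G N times the number of pairs in the link of a vertex,
  -- when m of the initial N vertices remain; the cubic term makes the target
  -- decrease a little faster than a uniformly random removal of vertices would.
  target : (G N m : ℕ) → ℕ
  target G N m = (7 * G + 4) * N * (m * m) + 3 * (m * m * m)

  target-drop : (G N b m : ℕ) → ℕ
  target-drop G N b m = (7 * G + 4) * N * (2 * m * b + b * b) + (9 * m * m * b + 9 * m * b * b + 3 * b * b * b)

  target-+ : ∀ G N b m → target G N (b + m) ≡ target G N m + target-drop G N b m
  target-+ = lemma
    where
    lemma : ∀ G N b m → (7 * G + 4) * N * ((b + m) * (b + m)) + 3 * ((b + m) * (b + m) * (b + m))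
      ≡ (7 * G + 4) * N * (m * m) + 3 * (m * m * m) + ((7 * G + 4) * N * (2 * m * b + b * b) + (9 * m * m * b + 9 * m * b * b + 3 * b * b * b))
    lemma = solve-∀

  target-drop≤ : ∀ G N b m → 0 < G → b + m ≤ N → target-drop G N b m ≤ 32 * G * b * (N * N)
  target-drop≤ G N b m 0<G le = by-combining (target-drop G N b m) (32 * G * b * (N * N)) (9 * b * b * m + 6 * b * b * b + b * (N * N) + (7 * G + 4) * N * (b * b))
    ((2 * (7 * G + 4) * b * N) ⊛ le ⊕ (9 * b) ⊛ *-mono-≤ le le ⊕ (18 * b * (N * N)) ⊛ 0<G) (arith G N b m)
    where
    arith : ∀ G N b m → (7 * G + 4) * N * (2 * m * b + b * b) + (9 * m * m * b + 9 * m * b * b + 3 * b * b * b)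
      + (2 * (7 * G + 4) * b * N * N + (9 * b * (N * N) + 18 * b * (N * N) * G)) + (9 * b * b * m + 6 * b * b * b + b * (N * N) + (7 * G + 4) * N * (b * b))
      ≡ 32 * G * b * (N * N) + (2 * (7 * G + 4) * b * N * (b + m) + (9 * b * ((b + m) * (b + m)) + 18 * b * (N * N) * 1))
    arith = solve-∀

  -- Removing an average vertex costs a vertex on target about `2 * target / m`, that is
  -- `2(7G + 4)Nm + 6m²`, while the target falls by its derivative `2(7G + 4)Nm + 9m²`. The gain of
  -- `3m²` per vertex pays for the factor `(E + 1) / E` on the `4 * s` block vertices and for four
  -- connecting vertices of arbitrary load, the summand with 128.
  drop-dominates : ∀ G N s E m → let b = 4 * s + 4 ; M = b + m in
    32 * G * N ≤ s * M → s * (7 * G + 7) ≤ 16 * G * E → M ≤ N → b * b ≤ M →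
    8 * s * (E + 1) * target G N M + 128 * G * N * E * (M * M) ≤ E * M * target-drop G N b m
  drop-dominates G N s E m sM sE M≤N b²≤M = ≤-trans (≤-reflexive (arith₁ G N s E M)) (≤-trans (*-monoʳ-≤ M reduced) (≤-reflexive (arith₂ E M (target-drop G N b m))))
    where
    b = 4 * s + 4
    M = b + m
    arith₁ : ∀ G N s E M → 8 * s * (E + 1) * ((7 * G + 4) * N * (M * M) + 3 * (M * M * M)) + 128 * G * N * E * (M * M)
      ≡ M * (8 * s * (E + 1) * ((7 * G + 4) * N * M + 3 * (M * M)) + 128 * G * N * E * M)
    arith₁ = solve-∀
    arith₂ : ∀ E M x → M * (E * x) ≡ E * M * x
    arith₂ = solve-∀
    reduced : 8 * s * (E + 1) * ((7 * G + 4) * N * M + 3 * (M * M)) + 128 * G * N * E * M ≤ E * target-drop G N b m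
    reduced = by-combining _ (E * target-drop G N b m) (E * (7 * (7 * G + 4) * N * M + 27 * M * M + 3 * b * b * b + 128 * G * M * N))
      ((12 * E * M) ⊛ sM ⊕ (8 * N * M) ⊛ sE ⊕ (24 * s * M) ⊛ M≤N ⊕ (E * (7 * G + 4) * N) ⊛ b²≤M ⊕ (9 * E * M) ⊛ b²≤M)
      (arith G N s E m)
      where
      arith : ∀ G N s E m →
        8 * s * (E + 1) * ((7 * G + 4) * N * (4 * s + 4 + m) + 3 * ((4 * s + 4 + m) * (4 * s + 4 + m))) + 128 * G * N * E * (4 * s + 4 + m)
        + (12 * E * (4 * s + 4 + m) * (s * (4 * s + 4 + m)) + (8 * N * (4 * s + 4 + m) * (16 * G * E) + (24 * s * (4 * s + 4 + m) * N
          + (E * (7 * G + 4) * N * (4 * s + 4 + m) + 9 * E * (4 * s + 4 + m) * (4 * s + 4 + m)))))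
        + (E * (7 * (7 * G + 4) * N * (4 * s + 4 + m) + 27 * (4 * s + 4 + m) * (4 * s + 4 + m) + 3 * (4 * s + 4) * (4 * s + 4) * (4 * s + 4) + 128 * G * (4 * s + 4 + m) * N))
        ≡ E * ((7 * G + 4) * N * (2 * m * (4 * s + 4) + (4 * s + 4) * (4 * s + 4)) + (9 * m * m * (4 * s + 4) + 9 * m * (4 * s + 4) * (4 * s + 4) + 3 * (4 * s + 4) * (4 * s + 4) * (4 * s + 4)))
        + (12 * E * (4 * s + 4 + m) * (32 * G * N) + (8 * N * (4 * s + 4 + m) * (s * (7 * G + 7)) + (24 * s * (4 * s + 4 + m) * (4 * s + 4 + m)
          + (E * (7 * G + 4) * N * ((4 * s + 4) * (4 * s + 4)) + 9 * E * (4 * s + 4 + m) * ((4 * s + 4) * (4 * s + 4))))))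
      arith = solve-∀

  -- Here `A` is the planned drop and `B` the actual loss. The square of `e + B - A` has linear part
  -- `2e(B - A)`, and `(A - B)²` is at most `X * X`. If the subtraction truncates, `e′ = 0` and
  -- `am-gm` is enough.
  square-step : ∀ e e′ A B X → e′ ≤ (e + B) ∸ A → A ≤ X → B ≤ X → e′ * e′ + 2 * (e * A) ≤ e * e + 2 * (e * B) + X * X
  square-step e e′ A B X e′≤ A≤X B≤X = cases (≤-total A (e + B))
    where
    cases : A ≤ e + B ⊎ e + B ≤ A → e′ * e′ + 2 * (e * A) ≤ e * e + 2 * (e * B) + X * X
    cases (inj₂ le) = begin
      e′ * e′ + 2 * (e * A)          ≡⟨ cong (λ z → z * z + 2 * (e * A)) (n≤0⇒n≡0 (≤-trans e′≤ (≤-reflexive (m≤n⇒m∸n≡0 le)))) ⟩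
      2 * (e * A)                    ≤⟨ am-gm e A ⟩
      e * e + A * A                  ≤⟨ +-mono-≤ (m≤m+n (e * e) _) (*-mono-≤ A≤X A≤X) ⟩
      e * e + 2 * (e * B) + X * X    ∎
      where open ≤-Reasoning
    cases (inj₁ le) = by-combining (e′ * e′ + 2 * (e * A)) (e * e + 2 * (e * B) + X * X) 0
        (*-mono-≤ e′≤ e′≤ ⊕ square-≤ (≤-total A B) ⊕ ≤-reflexive (expand f (m+[n∸m]≡n le)))
        (arith e e′ A B f X)
      where
      f = (e + B) ∸ A
      difference : ∀ a b → a ≤ b → b ≤ X → a * a + b * b ≤ X * X + 2 * (a * b)
      difference a b a≤b b≤X = let k , eq = m≤n⇒∃[o]m+o≡n a≤b in
        subst (λ b → a * a + b * b ≤ X * X + 2 * (a * b)) eq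
          (≤-trans (≤-reflexive (lemma a k)) (+-monoˡ-≤ (2 * (a * (a + k))) (*-mono-≤ (k≤X k eq) (k≤X k eq))))
        where
        k≤X : ∀ k → a + k ≡ b → k ≤ X
        k≤X k eq = ≤-trans (m≤n+m k a) (≤-trans (≤-reflexive eq) b≤X)
        lemma : ∀ a k → a * a + (a + k) * (a + k) ≡ k * k + 2 * (a * (a + k))
        lemma = solve-∀
      square-≤ : A ≤ B ⊎ B ≤ A → A * A + B * B ≤ X * X + 2 * (A * B)
      square-≤ (inj₁ A≤B) = difference A B A≤B B≤X
      square-≤ (inj₂ B≤A) = subst₂ (λ x y → x ≤ X * X + 2 * y) (+-comm (B * B) (A * A)) (*-comm B A) (difference B A B≤A A≤X)
      expand : ∀ f → A + f ≡ e + B → f * f + 2 * (e * A) + 2 * (A * B) ≡ e * e + 2 * (e * B) + (A * A + B * B)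
      expand f eq = begin
        f * f + 2 * (e * A) + 2 * (A * B)          ≡⟨ lemma₁ f e A B ⟩
        f * f + 2 * A * (e + B)                    ≡⟨ cong (λ z → f * f + 2 * A * z) eq ⟨
        f * f + 2 * A * (A + f)                    ≡⟨ lemma₂ f A ⟩
        (A + f) * (A + f) + A * A                  ≡⟨ cong (λ z → z * z + A * A) eq ⟩
        (e + B) * (e + B) + A * A                  ≡⟨ lemma₃ e A B ⟩
        e * e + 2 * (e * B) + (A * A + B * B)      ∎
        where
        open ≡-Reasoning
        lemma₁ : ∀ f e A B → f * f + 2 * (e * A) + 2 * (A * B) ≡ f * f + 2 * A * (e + B)
        lemma₁ = solve-∀
        lemma₂ : ∀ f A → f * f + 2 * A * (A + f) ≡ (A + f) * (A + f) + A * A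
        lemma₂ = solve-∀
        lemma₃ : ∀ e A B → (e + B) * (e + B) + A * A ≡ e * e + 2 * (e * B) + (A * A + B * B)
        lemma₃ = solve-∀
      arith : ∀ e e′ A B f X → e′ * e′ + 2 * (e * A) + (f * f + (X * X + 2 * (A * B) + (e * e + 2 * (e * B) + (A * A + B * B)))) + 0
        ≡ e * e + 2 * (e * B) + X * X + (e′ * e′ + (A * A + B * B + (f * f + 2 * (e * A) + 2 * (A * B))))
      arith = solve-∀

  shift-∸ : ∀ a d c x → a + d ≤ c + x → a ∸ c ≤ x ∸ d
  shift-∸ a d c x le = begin
    a ∸ c                  ≡⟨ [m+n]∸[m+o]≡n∸o d a c ⟨
    (d + a) ∸ (d + c)      ≤⟨ ∸-monoˡ-≤ (d + c) (≤-trans (≤-reflexive (+-comm d a)) le) ⟩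
    (c + x) ∸ (d + c)      ≡⟨ cong ((c + x) ∸_) (+-comm d c) ⟩
    (c + x) ∸ (c + d)      ≡⟨ [m+n]∸[m+o]≡n∸o c x d ⟩
    x ∸ d                  ∎
    where open ≤-Reasoning

  -- Deficits and their sum of squares.

  module Potential (𝓗 : TripleSystem V) (L : List V) (G N s E Z K : ℕ) where

    open TripleSystem 𝓗

    b X : ℕ
    b = 4 * s + 4
    X = 32 * G * b * (N * N)

    -- Vertices above the target have deficit 0 and do not contribute to Φ.
    deficit : List V → V → ℕ
    deficit R v = target G N (length R) ∸ 16 * G * N * pairs R v

    Φ : List V → ℕ
    Φ R = ∑[ v ∈ L ] deficit R v * deficit R v

    σ : List V → ℕ
    σ R = ∑ L (deficit R)

    load : List V → V → ℕ
    load R u = ∑[ v ∈ L ] deficit R v * codegree R v u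

    ∑-load : ∀ R P → ∑ P (load R) ≡ ∑[ v ∈ L ] deficit R v * ∑ P (codegree R v)
    ∑-load R P = trans (∑-swap P L _) (∑-cong L λ v → ∑-*ˡ P (deficit R v) _)

    load≤ : ∀ R u → load R u ≤ length R * σ R
    load≤ R u = ≤-trans (∑-mono L λ v → *-monoʳ-≤ (deficit R v) (codegree≤ R v u))
      (≤-reflexive (trans (∑-*ʳ L (length R) (deficit R)) (*-comm (σ R) _)))

    -- Only vertices below the target have a positive deficit, and for these
    -- `16 * G * N * pairs R v` is at most the target. This makes the mean load comparable with the
    -- planned drop.
    total-load≤ : ∀ R → 16 * G * N * ∑ R (load R) ≤ target G N (length R) * σ R
    total-load≤ R = ≤-trans (≤-reflexive (trans (cong (16 * G * N *_) (∑-load R R)) (sym (∑-*ˡ L (16 * G * N) _))))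
      (≤-trans (∑-mono L λ v → term v) (≤-reflexive (∑-*ˡ L (target G N (length R)) _)))
      where
      T = target G N (length R)
      swap₃ : ∀ x e p → x * (e * p) ≡ e * (x * p)
      swap₃ = solve-∀
      positive-part : ∀ T x → (T ∸ x) * x ≤ T * (T ∸ x)
      positive-part T x with ≤-total x T
      ... | inj₁ x≤T = ≤-trans (*-monoʳ-≤ (T ∸ x) x≤T) (≤-reflexive (*-comm (T ∸ x) T))
      ... | inj₂ T≤x = ≤-trans (≤-reflexive (cong (_* x) (m≤n⇒m∸n≡0 T≤x))) z≤n
      term : ∀ v → 16 * G * N * (deficit R v * pairs R v) ≤ T * deficit R v
      term v = ≤-trans (≤-reflexive (swap₃ (16 * G * N) (deficit R v) (pairs R v))) (positive-part T (16 * G * N * pairs R v))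

    -- By `slow`, the losses weighted by the deficits do not exceed the planned drop, so the linear
    -- terms of `square-step` contribute nothing and each tracked vertex adds at most the square of
    -- `X`, which bounds loss and drop alike.
    potential-step : ∀ {R} P R′ → 0 < G → R ↭ P ++ R′ → length P ≡ b → length R ≤ N →
      16 * G * N * (2 * ∑ P (load R)) ≤ target-drop G N b (length R′) * σ R → Φ R′ ≤ Φ R + length L * (X * X)
    potential-step {R} P R′ 0<G R↭ |P| m≤N slow = by-combining (Φ R′) (Φ R + length L * (X * X)) 0
        (summed ⊕ 2 ⊛ ≤-trans (≤-reflexive ∑eB) slow)
        (arith (Φ R′) (Φ R) (length L * (X * X)) (∑[ v ∈ L ] deficit R v * B v) (σ R) Δ)
      where
      Δ = target-drop G N b (length R′)
      m≡ : b + length R′ ≡ length R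
      m≡ = sym (trans (↭-length R↭) (trans (length-++ P) (cong (_+ length R′) |P|)))
      B : V → ℕ
      B v = 16 * G * N * (2 * ∑ P (codegree R v))
      ∑eB : ∑[ v ∈ L ] deficit R v * B v ≡ 16 * G * N * (2 * ∑ P (load R))
      ∑eB = trans (∑-cong L (λ v → lemma (deficit R v) (16 * G * N) (∑ P (codegree R v))))
              (trans (∑-*ˡ L (16 * G * N * 2) _) (trans (cong (16 * G * N * 2 *_) (sym (∑-load R P))) (*-assoc (16 * G * N) 2 _)))
        where
        lemma : ∀ e x c → e * (x * (2 * c)) ≡ x * 2 * (e * c)
        lemma = solve-∀
      next : ∀ v → deficit R′ v ≤ (deficit R v + B v) ∸ Δ
      next v = shift-∸ (target G N (length R′)) Δ (16 * G * N * pairs R′ v) (deficit R v + B v)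
        (by-combining (target G N (length R′) + Δ) (16 * G * N * pairs R′ v + (deficit R v + B v)) 0
          (≤-reflexive (trans (sym (target-+ G N b (length R′))) (cong (target G N) m≡))
            ⊕ m≤n+m∸n (target G N (length R)) (16 * G * N * pairs R v)
            ⊕ (16 * G * N) ⊛ pairs-remove P R′ v R↭)
          (lemma (target G N (length R′) + Δ) (target G N (length R)) (16 * G * N) (pairs R v) (pairs R′ v) (deficit R v) (∑ P (codegree R v))))
        where
        lemma : ∀ t T x d d′ e c → t + (T + (x * d + e + x * (d′ + 2 * c))) + 0 ≡ (x * d′ + (e + x * (2 * c))) + (t + (T + x * d))
        lemma = solve-∀
      B≤ : ∀ v → B v ≤ X
      B≤ v = ≤-trans (*-monoʳ-≤ (16 * G * N) (*-monoʳ-≤ 2 (≤-trans (∑-≤const P N λ {u} _ → ≤-trans (codegree≤ R v u) m≤N) (≤-reflexive (cong (_* N) |P|)))))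
               (≤-reflexive (lemma G N b))
        where
        lemma : ∀ G N b → 16 * G * N * (2 * (b * N)) ≡ 32 * G * b * (N * N)
        lemma = solve-∀
      Δ≤ : Δ ≤ X
      Δ≤ = target-drop≤ G N b (length R′) 0<G (≤-trans (≤-reflexive m≡) m≤N)
      summed : Φ R′ + 2 * (σ R * Δ) ≤ Φ R + 2 * (∑[ v ∈ L ] deficit R v * B v) + length L * (X * X)
      summed = subst₂ _≤_
        (trans (∑-+ L _ _) (cong (Φ R′ +_) (trans (∑-*ˡ L 2 _) (cong (2 *_) (∑-*ʳ L Δ (deficit R))))))
        (trans (∑-+ L _ _) (cong₂ _+_ (trans (∑-+ L _ _) (cong (Φ R +_) (∑-*ˡ L 2 _))) (∑-const L (X * X))))
        (∑-mono L λ v → square-step (deficit R v) (deficit R′ v) Δ (B v) X (next v) Δ≤ (B≤ v))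
      arith : ∀ p q x S σ Δ → p + (q + 2 * S + x + 2 * (Δ * σ)) + 0 ≡ q + x + (p + 2 * (σ * Δ) + 2 * S)
      arith = solve-∀

    -- `l` is the path through a light block, within a factor `(E + 1) / E` of the mean load; `Q`
    -- consists of the four remaining vertices, whose load is bounded only by `load≤`.
    slow-loss : ∀ R (R′ l Q : List V) → 0 < E → 0 < length R → b + length R′ ≡ length R → length Q ≡ 4 →
      32 * G * N ≤ s * length R → s * (7 * G + 7) ≤ 16 * G * E → length R ≤ N → b * b ≤ length R →
      E * length R * ∑ l (load R) ≤ s * ((E + 1) * (4 * ∑ R (load R))) →
      16 * G * N * (2 * ∑ (l ++ Q) (load R)) ≤ target-drop G N b (length R′) * σ R
    slow-loss R R′ l Q 0<E 0<m m≡ |Q| sM sE m≤N b²≤m low = *-cancelˡ-≤ (E * m) {{>-nonZero (*-mono-≤ 0<E 0<m)}}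
        (by-combining _ (E * m * (target-drop G N b m′ * σ R)) 0
          (≤-reflexive (cong (λ z → 32 * G * N * (E * m) * z) (∑-++ l Q (load R))) ⊕ (32 * G * N) ⊛ low ⊕ (32 * G * N * (E * m)) ⊛ Q≤ ⊕ (8 * s * (E + 1)) ⊛ total-load≤ R ⊕ *-monoʳ-≤ (σ R) dominated)
          (arith G N E m (∑ (l ++ Q) (load R)) (∑ l (load R)) (∑ Q (load R)) s (∑ R (load R)) (σ R) (target G N m) (target-drop G N b m′)))
      where
      m = length R
      m′ = length R′
      Q≤ : ∑ Q (load R) ≤ 4 * (m * σ R)
      Q≤ = ≤-trans (∑-≤const Q (m * σ R) (λ {u} _ → load≤ R u)) (≤-reflexive (cong (_* (m * σ R)) |Q|))
      dominated : 8 * s * (E + 1) * target G N m + 128 * G * N * E * (m * m) ≤ E * m * target-drop G N b m′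
      dominated = subst (λ M → 8 * s * (E + 1) * target G N M + 128 * G * N * E * (M * M) ≤ E * M * target-drop G N b m′) m≡
        (drop-dominates G N s E m′ (subst (λ M → 32 * G * N ≤ s * M) (sym m≡) sM) sE (≤-trans (≤-reflexive m≡) m≤N) (≤-trans b²≤m (≤-reflexive (sym m≡))))
      arith : ∀ G N E m t x q s W σ T Δ →
        E * m * (16 * G * N * (2 * t)) + (32 * G * N * (E * m) * (x + q) + (32 * G * N * (s * ((E + 1) * (4 * W))) + (32 * G * N * (E * m) * (4 * (m * σ))
          + (8 * s * (E + 1) * (T * σ) + σ * (E * m * Δ))))) + 0
        ≡ E * m * (Δ * σ) + (32 * G * N * (E * m) * t + (32 * G * N * (E * m * x) + (32 * G * N * (E * m) * q
          + (8 * s * (E + 1) * (16 * G * N * W) + σ * (8 * s * (E + 1) * T + 128 * G * N * E * (m * m))))))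
      arith = solve-∀

    good : List V → V → Bool
    good R v = deficit R v ≤! N * (length R * length R)

    good⇒rich : ∀ R v → 0 < N → good R v ≡ true → (7 * G + 3) * (length R * length R) ≤ 16 * G * pairs R v
    good⇒rich R v 0<N gd = *-cancelˡ-≤ N {{>-nonZero 0<N}} (by-combining (N * ((7 * G + 3) * (m * m))) (N * (16 * G * pairs R v)) (3 * (m * m * m))
        (≤!-sound (deficit R v) (N * (m * m)) gd ⊕ m≤n+m∸n (target G N m) (16 * G * N * pairs R v)) (arith G N m (pairs R v) (deficit R v)))
      where
      m = length R
      arith : ∀ G N m p e → N * ((7 * G + 3) * (m * m)) + (N * (m * m) + (16 * G * N * p + e)) + 3 * (m * m * m)
        ≡ N * (16 * G * p) + (e + ((7 * G + 4) * N * (m * m) + 3 * (m * m * m)))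
      arith = solve-∀

    -- A bad vertex contributes at least `(N * (m * m))²` to `Φ R`, which is of order N⁶ because `m`
    -- is at least `N / (2 * Z)`. The bound on `Φ R` is of order N⁶ too, since `X` is of order N²
    -- and `length L` of order N; the quotient is a constant.
    few-bad : ∀ R → 0 < N → 0 < length R → N ≤ 2 * Z * length R → length L ≤ 4 * N → Φ R ≤ N * (length L * (X * X)) →
      4 * ((32 * G * b) * (32 * G * b)) * ((2 * Z) * (2 * Z) * ((2 * Z) * (2 * Z))) < K → # (not ∘ good R) L < K
    few-bad R 0<N 0<m N≤ L≤ Φ≤ K> = ≤-<-trans (*-cancelˡ-≤ (y * y) {{>-nonZero (*-mono-≤ 0<y 0<y)}} (begin
        y * y * # (not ∘ good R) L                       ≡⟨ ∑-*ˡ L (y * y) _ ⟨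
        ∑[ v ∈ L ] y * y * 𝟙 (not (good R v))            ≤⟨ ∑-mono L large ⟩
        Φ R                                              ≤⟨ Φ≤ ⟩
        N * (length L * (X * X))                         ≤⟨ *-monoʳ-≤ N (*-monoˡ-≤ (X * X) L≤) ⟩
        N * (4 * N * (X * X))                            ≡⟨ arith₁ N (32 * G * b) ⟩
        4 * (N * N) * (32 * G * b * (32 * G * b)) * (N * N * (N * N))    ≤⟨ *-monoʳ-≤ (4 * (N * N) * (32 * G * b * (32 * G * b))) (*-mono-≤ (*-mono-≤ N≤ N≤) (*-mono-≤ N≤ N≤)) ⟩
        4 * (N * N) * (32 * G * b * (32 * G * b)) * (2 * Z * m * (2 * Z * m) * (2 * Z * m * (2 * Z * m)))    ≡⟨ arith₂ N (32 * G * b) (2 * Z) m ⟩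
        y * y * (4 * ((32 * G * b) * (32 * G * b)) * ((2 * Z) * (2 * Z) * ((2 * Z) * (2 * Z))))     ∎)) K>
      where
      open ≤-Reasoning
      m = length R
      y = N * (m * m)
      0<y : 0 < y
      0<y = *-mono-≤ 0<N (*-mono-≤ 0<m 0<m)
      large : ∀ v → y * y * 𝟙 (not (good R v)) ≤ deficit R v * deficit R v
      large v = by-cases (good R v) refl
        where
        by-cases : ∀ g → good R v ≡ g → y * y * 𝟙 (not g) ≤ deficit R v * deficit R v
        by-cases true  eq = ≤-trans (≤-reflexive (*-zeroʳ (y * y))) z≤n
        by-cases false eq = let y≤ = <⇒≤ (≤!-false (deficit R v) y eq) in ≤-trans (≤-reflexive (*-identityʳ (y * y))) (*-mono-≤ y≤ y≤)
      arith₁ : ∀ N x → N * (4 * N * (x * (N * N) * (x * (N * N)))) ≡ 4 * (N * N) * (x * x) * (N * N * (N * N))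
      arith₁ = solve-∀
      arith₂ : ∀ N x z m → 4 * (N * N) * (x * x) * (z * m * (z * m) * (z * m * (z * m))) ≡ N * (m * m) * (N * (m * m)) * (4 * (x * x) * (z * z * (z * z)))
      arith₂ = solve-∀

  -- Growing the path block by block.

  module _ (𝓗 : TripleSystem V) where

    open TripleSystem 𝓗

    rich-remove : ∀ {R} G x y b P R′ v → y ≡ suc x → R ↭ P ++ R′ → length P ≤ b → 32 * G * b ≤ length R →
      y * (length R * length R) ≤ 16 * G * pairs R v → x * (length R′ * length R′) ≤ 16 * G * pairs R′ v
    rich-remove {R} G x .(suc x) b P R′ v refl R↭ P≤ b≤ rich = by-combining (x * (m′ * m′)) (16 * G * pairs R′ v) 0
        (rich ⊕ (16 * G) ⊛ pairs-remove-crude P R′ v R↭ ⊕ (32 * G * m) ⊛ P≤ ⊕ m ⊛ b≤ ⊕ x ⊛ *-mono-≤ m′≤m m′≤m)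
        (arith x G m m′ (pairs R v) (pairs R′ v) (length P) b)
      where
      m = length R
      m′ = length R′
      m′≤m : m′ ≤ m
      m′≤m = ≤-trans (m≤n+m m′ (length P)) (≤-reflexive (sym (trans (↭-length R↭) (length-++ P))))
      arith : ∀ x G m m′ p p′ l b → x * (m′ * m′) + (16 * G * p + (16 * G * (p′ + 2 * (l * m)) + (32 * G * m * b + (m * m + x * (m * m))))) + 0
        ≡ 16 * G * p′ + (suc x * (m * m) + (16 * G * p + (32 * G * m * l + (m * (32 * G * b) + x * (m′ * m′)))))
      arith = solve-∀

    -- A vertex in two of the classes would occur twice in an edge completed by any vertex of the
    -- third, so disjointness follows from completeness once the classes are nonempty.
    block-unique : ∀ A B C → 0 < length A → 0 < length B → 0 < length C → Unique A → Unique B → Unique C →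
      (∀ {a b c} → a ∈ A → b ∈ B → c ∈ C → edge c a b ≡ true) → Unique (A ++ B ++ C)
    block-unique (a ∷ A) (b ∷ B) (c ∷ C) _ _ _ uA uB uC comp = unique-++ uA
      (unique-++ uB uC λ x∈B x∈C → edge-≢ (trans (swap₂ _ _ _) (comp (here refl) x∈B x∈C)) refl)
      λ x∈A x∈BC → clash x∈A (∈-++⁻ (b ∷ B) x∈BC)
      where
      clash : ∀ {x} → x ∈ a ∷ A → x ∈ b ∷ B ⊎ x ∈ c ∷ C → ⊥
      clash x∈A (inj₁ x∈B) = edge-≢₂ (comp x∈A x∈B (here refl)) refl
      clash x∈A (inj₂ x∈C) = edge-≢ (comp x∈A (here refl) x∈C) refl

  module Growth (𝓗 : TripleSystem V) (vs : List V) (uvs : Unique vs) (complete : ∀ v → v ∈ vs) (a₀ : V)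
    (gs : List (Vec V 7)) (G N s E Z K h M : ℕ)
    (0<G : 0 < G) (0<s : 0 < s) (0<Z : 0 < Z) (0<E : 0 < E) (sZ : 32 * G * Z ≤ s) (sE : s * (7 * G + 7) ≤ 16 * G * E)
    (K> : 4 * ((32 * G * (4 * s + 4)) * (32 * G * (4 * s + 4))) * ((2 * Z) * (2 * Z) * ((2 * Z) * (2 * Z))) < K) (K≤h : K ≤ h)
    (h₁ : 4 * (16 * G) * (s + s) ≤ h) (h₂ : 4 * κ-pairs G s * suc s ≤ h) (h₃ : κ-vertices G s * s ≤ h)
    (M₁ : 2 * (32 * G + E + 1) * h ≤ M) (M₂ : (4 * s + 4) * (4 * s + 4) ≤ M) (M₃ : 32 * G * (4 * s + 4) ≤ M) (M₄ : 128 + (4 * s + 4) < M)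
    (N≥ : 2 * Z * M ≤ N) (L≤ : length (vs ++ replicate K a₀) ≤ 4 * N) where

    open TripleSystem 𝓗

    open Potential 𝓗 (vs ++ replicate K a₀) G N s E Z K hiding (b)

    private
      b = 4 * s + 4
      L = vs ++ replicate K a₀
      Y = length L * (X * X)

    -- `slow` says `Φ R ≤ (N - length R) * Y`: each step removes vertices and adds at most `Y`. A
    -- step is taken only while `N ≤ Z * length R`, so that `N≤`, with its factor 2, still holds
    -- after the last one.
    record State (R : List V) : Set where
      constructor state
      field
        {head} : V
        {verts} : List V
        chain  : Chain 𝓗 head a₀ gs verts
        vs↭    : vs ↭ (verts ++ a₀ ∷ []) ++ R
        rich   : (7 * G + 2) * (length R * length R) ≤ 16 * G * pairs R head
        slow   : Φ R + length R * Y ≤ N * Y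
        R≤     : length R ≤ N
        N≤     : N ≤ 2 * Z * length R

    large : ∀ {m} → N ≤ 2 * Z * m → M ≤ m
    large {m} N≤ = *-cancelˡ-≤ (2 * Z) {{>-nonZero (*-mono-≤ {1} {2} (s≤s z≤n) 0<Z)}} (≤-trans N≥ N≤)

    0<M : 0 < M
    0<M = ≤-trans (s≤s z≤n) M₄

    0<N : 0 < N
    0<N = ≤-trans (*-mono-≤ (*-mono-≤ {1} {2} (s≤s z≤n) 0<Z) 0<M) N≥

    -- Fewer than K of the tracked vertices are bad, and a₀ is tracked K times.
    few-bad-state : ∀ {R} → State R → # (not ∘ good R) L < K
    few-bad-state {R} st = few-bad R 0<N (≤-trans 0<M (large N≤)) N≤ L≤ (≤-trans (m≤m+n (Φ R) _) slow) K>
      where open State st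

    a₀-good : ∀ {R} → State R → good R a₀ ≡ true
    a₀-good {R} st = decide (good R a₀) refl
      where
      decide : ∀ g → good R a₀ ≡ g → g ≡ true
      decide true  _  = refl
      decide false eq = ⊥-elim (<⇒≱ (few-bad-state st) (begin
        K                                                            ≡⟨ length-replicate K ⟨
        length (replicate K a₀)                                      ≡⟨ count K ⟩
        # (not ∘ good R) (replicate K a₀)                            ≤⟨ m≤n+m _ (# (not ∘ good R) vs) ⟩
        # (not ∘ good R) vs + # (not ∘ good R) (replicate K a₀)      ≡⟨ ∑-++ vs (replicate K a₀) _ ⟨
        # (not ∘ good R) L                                           ∎))
        where
        open ≤-Reasoning
        count : ∀ k → length (replicate k a₀) ≡ # (not ∘ good R) (replicate k a₀)
        count zero    = refl
        count (suc k) = cong₂ _+_ (sym (cong (𝟙 ∘ not) eq)) (count k)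

    Smaller : List V → Set
    Smaller R = ∃ λ R′ → State R′ × length R′ < length R

    -- The block goes in front: from `a` through the block to `e`, then by three vertices to the old
    -- `head`. As a good vertex of `R`, the new head `a` has slack 3, and removing the `b` vertices
    -- leaves the slack 2 that the next connection needs. Its later deficit is irrelevant, because
    -- by then it is no longer an end.
    step-block : ∀ R → State R → N ≤ Z * length R → LightBlock 𝓗 (load R) G E s h R (select (good R) R) → Smaller R
    step-block R st N≤Zm block = with-A A refl
      where
      open State st
      open LightBlock block
      m = length R
      W = ∑ R (load R)
      P₀ = verts ++ a₀ ∷ []
      Gd = select (good R) R
      uR : Unique R
      uR = unique-part uvs (↭-trans vs↭ (++-comm P₀ R))
      M≤m : M ≤ m
      M≤m = large N≤
      good-rich : ∀ {v} → v ∈ Gd → (7 * G + 3) * (m * m) ≤ 16 * G * pairs R v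
      good-rich {v} v∈ = good⇒rich R v 0<N (proj₂ (∈-select⁻ (good R) R v∈))
      with-A : ∀ A′ → A ≡ A′ → Smaller R
      with-A [] eq = ⊥-elim (0≢1+n (trans (cong length (sym eq)) |A|))
      with-A (a ∷ A′) eq = joined (zigzag 𝓗 (load R) (E * m) ((E + 1) * (4 * W)) s a A′ B C
          (suc-injective (trans (cong length (sym eq)) |A|)) |B| |C|
          (λ a∈ b∈ c∈ → complete′ a∈ b∈ c∈ , light (from-A a∈) b∈ c∈))
        where
        from-A : ∀ {x} → x ∈ a ∷ A′ → x ∈ A
        from-A = subst (_ ∈_) (sym eq)
        complete′ : ∀ {a′ b c} → a′ ∈ a ∷ A′ → b ∈ B → c ∈ C → edge c a′ b ≡ true
        complete′ a∈ b∈ c∈ = LightBlock.complete block (from-A a∈) b∈ c∈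
        T = (a ∷ A′) ++ B ++ C
        uT : Unique T
        uT = block-unique 𝓗 (a ∷ A′) B C (s≤s z≤n) (subst (0 <_) (sym |B|) 0<s) (subst (0 <_) (sym |C|) (≤-trans 0<s (m≤m+n s s)))
               (subst Unique eq uniqueA) uniqueB uniqueC complete′
        T⊆ : ∀ {x} → x ∈ T → x ∈ R
        T⊆ x∈ = proj₁ (∈-select⁻ (good R) R (cases (∈-++⁻ (a ∷ A′) x∈)))
          where
          cases₂ : ∀ {x} → x ∈ B ⊎ x ∈ C → x ∈ Gd
          cases₂ (inj₁ x∈) = B⊆ x∈
          cases₂ (inj₂ x∈) = C⊆ x∈
          cases : ∀ {x} → x ∈ a ∷ A′ ⊎ x ∈ B ++ C → x ∈ Gd
          cases (inj₁ x∈) = A⊆ (from-A x∈)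
          cases (inj₂ x∈) = cases₂ (∈-++⁻ B x∈)
        |T| : length T ≡ 4 * s + 1
        |T| = trans (length-++ (a ∷ A′)) (trans (cong₂ _+_ (trans (cong length (sym eq)) |A|) (trans (length-++ B) (cong₂ _+_ |B| |C|))) (arith s))
          where
          arith : ∀ s → suc s + (s + (s + s)) ≡ 4 * s + 1
          arith = solve-∀
        joined : (∃ λ e → ∃ λ l → e ∈ a ∷ A′ × Path 𝓗 a e l × T ↭ l ++ e ∷ [] × E * m * ∑ l (load R) ≤ s * ((E + 1) * (4 * W))) → Smaller R
        joined (e , l , e∈ , path , T↭ , low) = removed (extract uT T⊆)
          where
          |l| : length l ≡ 4 * s
          |l| = +-cancelʳ-≡ 1 (length l) (4 * s) (trans (sym (length-++ l)) (trans (sym (↭-length T↭)) |T|))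
          removed : (∃ λ R₁ → R ↭ T ++ R₁) → Smaller R
          removed (R₁ , R↭) = finish (connect 𝓗 R₁ (unique-part uR (↭-trans R↭ (++-comm T R₁))) 128<m₁ e head
              (rich⇒Dense 𝓗 R₁ G (7 * G + 2) e 0<G (m≤m+n _ 2) (shrink (7 * G + 2) (7 * G + 3) e (+-suc (7 * G) 2) (good-rich (A⊆ (from-A e∈)))))
              (rich⇒Dense 𝓗 R₁ G (7 * G + 1) head 0<G (m≤m+n _ 1) (shrink (7 * G + 1) (7 * G + 2) head (+-suc (7 * G) 1) rich)))
            where
            T≤b : length T ≤ b
            T≤b = ≤-trans (≤-reflexive |T|) (+-monoʳ-≤ (4 * s) (s≤s z≤n))
            shrink : ∀ x y v → y ≡ suc x → y * (m * m) ≤ 16 * G * pairs R v → x * (length R₁ * length R₁) ≤ 16 * G * pairs R₁ v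
            shrink x y v y≡ = rich-remove 𝓗 G x y b T R₁ v y≡ R↭ T≤b (≤-trans M₃ M≤m)
            128<m₁ : 128 < length R₁
            128<m₁ = by-combining 129 (length R₁) 0 (M₄ ⊕ M≤m ⊕ ≤-reflexive (trans (↭-length R↭) (length-++ T)) ⊕ T≤b)
              (arith b M m (length T) (length R₁))
              where
              arith : ∀ b M m t r → 129 + (M + (m + (t + r + b))) + 0 ≡ r + (suc (128 + b) + (M + (m + t)))
              arith = solve-∀
            finish : (∃ λ l₃ → ∃ λ R₂ → length l₃ ≡ 3 × R₁ ↭ l₃ ++ R₂ × Path 𝓗 e head (e ∷ l₃)) → Smaller R
            finish (l₃ , R₂ , |l₃| , R₁↭ , path₃) = R₂ , state
                (subst (Chain 𝓗 a a₀ gs) (sym (++-assoc l (e ∷ l₃) verts)) (plain path (plain path₃ chain)))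
                (prepend-↭ P vs↭ R↭₂)
                (rich-remove 𝓗 G (7 * G + 2) (7 * G + 3) b P R₂ a (+-suc (7 * G) 2) R↭₂ (≤-reflexive |P|) (≤-trans M₃ M≤m) (good-rich (A⊆ (from-A (here refl)))))
                (by-combining (Φ R₂ + length R₂ * Y) (N * Y) 0
                  (potential-step P R₂ 0<G R↭₂ |P| R≤ lost ⊕ slow ⊕ *-monoˡ-≤ Y smaller) (arith (Φ R₂) (length R₂) Y (Φ R) m N))
                (≤-trans (<⇒≤ smaller) R≤)
                (by-combining N (2 * Z * length R₂) 0 (2 ⊛ N≤Zm ⊕ (2 * Z) ⊛ ≤-reflexive (sym m≡) ⊕ ≤-trans (*-monoʳ-≤ (2 * Z) b≤M) N≥) (arith₂ N Z m b (length R₂)))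
              , smaller
              where
              P = l ++ e ∷ l₃
              |P| : length P ≡ b
              |P| = trans (length-++ l) (cong₂ (λ x y → x + suc y) |l| |l₃|)
              R↭₂ : R ↭ P ++ R₂
              R↭₂ = ↭-trans R↭ (↭-trans (++⁺ T↭ R₁↭) (↭-reflexive
                (trans (++-assoc l (e ∷ []) (l₃ ++ R₂)) (sym (++-assoc l (e ∷ l₃) R₂)))))
              m≡ : b + length R₂ ≡ m
              m≡ = sym (trans (↭-length R↭₂) (trans (length-++ P) (cong (_+ length R₂) |P|)))
              smaller : length R₂ < m
              smaller = ≤-trans (+-monoˡ-≤ (length R₂) (≤-trans (s≤s z≤n) (m≤n+m 4 (4 * s)))) (≤-reflexive m≡)
              b≤M : b ≤ M
              b≤M = ≤-trans (m≤n+m b 129) M₄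
              sM : 32 * G * N ≤ s * m
              sM = by-combining (32 * G * N) (s * m) 0 ((32 * G) ⊛ N≤Zm ⊕ m ⊛ sZ) (lemma G N Z m s)
                where
                lemma : ∀ G N Z m s → 32 * G * N + (32 * G * (Z * m) + m * s) + 0 ≡ s * m + (32 * G * N + m * (32 * G * Z))
                lemma = solve-∀
              lost : 16 * G * N * (2 * ∑ P (load R)) ≤ target-drop G N b (length R₂) * σ R
              lost = slow-loss R R₂ l (e ∷ l₃) 0<E (≤-trans 0<M M≤m) m≡ (cong suc |l₃|) sM sE R≤ (≤-trans M₂ M≤m) low
              arith : ∀ p r Y q m N → p + r * Y + (q + Y + (N * Y + m * Y)) + 0 ≡ N * Y + (p + (q + m * Y + (suc r * Y)))
              arith = solve-∀
              arith₂ : ∀ N Z m b r → N + (2 * (Z * m) + (2 * Z * (b + r) + N)) + 0 ≡ 2 * Z * r + (2 * N + (2 * Z * m + 2 * Z * b))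
              arith₂ = solve-∀

    step-state : ∀ R → State R → N ≤ Z * length R → Smaller R
    step-state R st N≤Zm = step-block R st N≤Zm
        (light-block 𝓗 (load R) G E s h R (select (good R) R) (select (not ∘ good R) R) uR (select-split (good R) R) 0<G 0<s
          few (≤-trans M₁ (large N≤)) h₁ h₂ h₃ (λ {v} v∈ → good⇒rich R v 0<N (proj₂ (∈-select⁻ (good R) R v∈))))
      where
      open State st
      P₀ = verts ++ a₀ ∷ []
      uR : Unique R
      uR = unique-part uvs (↭-trans vs↭ (++-comm P₀ R))
      few : length (select (not ∘ good R) R) ≤ h
      few = begin
        length (select (not ∘ good R) R)                    ≡⟨ length-select (not ∘ good R) R ⟩
        # (not ∘ good R) R                                  ≤⟨ m≤n+m _ (# (not ∘ good R) P₀) ⟩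
        # (not ∘ good R) P₀ + # (not ∘ good R) R            ≡⟨ trans (∑-↭ _ vs↭) (∑-++ P₀ R _) ⟨
        # (not ∘ good R) vs                                 ≤⟨ m≤m+n _ _ ⟩
        # (not ∘ good R) vs + # (not ∘ good R) (replicate K a₀)   ≡⟨ ∑-++ vs (replicate K a₀) _ ⟨
        # (not ∘ good R) L                                  ≤⟨ <⇒≤ (few-bad-state st) ⟩
        K                                                   ≤⟨ K≤h ⟩
        h                                                   ∎
        where open ≤-Reasoning

    grow : ∀ j R → length R ≤ j → State R → ∃ λ R′ → State R′ × Z * length R′ < N
    grow j R R≤j st = decide j R≤j (N ≤? Z * length R)
      where
      continue : ∀ j → length R ≤ suc j → Smaller R → ∃ λ R′ → State R′ × Z * length R′ < N
      continue j R≤j (R′ , st′ , R′<R) = grow j R′ (≤-pred (≤-trans R′<R R≤j)) st′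
      decide : ∀ j → length R ≤ j → Dec (N ≤ Z * length R) → ∃ λ R′ → State R′ × Z * length R′ < N
      decide j       R≤j (no N>)  = R , st , ≰⇒> N>
      decide (suc j) R≤j (yes N≤) = continue j R≤j (step-state R st N≤)
      decide zero    R≤0 (yes N≤) = ⊥-elim (<⇒≱ 0<M (≤-trans (large (State.N≤ st)) R≤0))

    close : ∀ R → State R → ∃ λ U → ∃ λ l → Chain 𝓗 a₀ a₀ gs l × vs ↭ l ++ U × length U ≤ length R
    close R st = finish (connect 𝓗 R uR (≤-trans (s≤s (m≤m+n 128 b)) (≤-trans M₄ (large N≤))) a₀ head
        (rich⇒Dense 𝓗 R G (7 * G + 3) a₀ 0<G (m≤m+n _ 3) (good⇒rich R a₀ 0<N (a₀-good st)))
        (rich⇒Dense 𝓗 R G (7 * G + 2) head 0<G (m≤m+n _ 2) rich))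
      where
      open State st
      P₀ = verts ++ a₀ ∷ []
      uR : Unique R
      uR = unique-part uvs (↭-trans vs↭ (++-comm P₀ R))
      finish : (∃ λ l₃ → ∃ λ U → length l₃ ≡ 3 × R ↭ l₃ ++ U × Path 𝓗 a₀ head (a₀ ∷ l₃)) → ∃ λ U → ∃ λ l → Chain 𝓗 a₀ a₀ gs l × vs ↭ l ++ U × length U ≤ length R
      finish (l₃ , U , |l₃| , R↭ , path) = U , (a₀ ∷ l₃) ++ verts , plain path chain
        , (begin
            vs                                   ↭⟨ vs↭ ⟩
            (verts ++ a₀ ∷ []) ++ R              ↭⟨ ++⁺ (++-comm verts (a₀ ∷ [])) R↭ ⟩
            (a₀ ∷ verts) ++ l₃ ++ U              ↭⟨ prep a₀ (shifts verts l₃) ⟩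
            a₀ ∷ l₃ ++ verts ++ U                ≡⟨ cong (a₀ ∷_) (++-assoc l₃ verts U) ⟨
            ((a₀ ∷ l₃) ++ verts) ++ U            ∎)
        , ≤-trans (m≤n+m _ _) (≤-reflexive (sym (trans (↭-length R↭) (length-++ l₃))))
        where open PermutationReasoning

  -- Assembling the cycle.

  suc≤2^ : ∀ j → suc j ≤ 2 ^ j
  suc≤2^ zero    = ≤-refl
  suc≤2^ (suc j) = by-combining (suc (suc j)) (2 * 2 ^ j) j (2 ⊛ suc≤2^ j) (arith j (2 ^ j))
    where
    arith : ∀ j x → suc (suc j) + 2 * x + j ≡ 2 * x + 2 * suc j
    arith = solve-∀

  -- With `j = r / 4`, the hypotheses give `n < (j + 1)²`, and `j + 1 ≤ 2 ^ j` turns the fourth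
  -- power of `j + 1` into at most `2 ^ (4 * j)`.
  square<power : ∀ Z r n → n < Z * suc r → 16 * Z ≤ r → n * n < 2 ^ r
  square<power Z r n n< r≥ = begin-strict
      n * n                                            <⟨ *-mono-< n<jj n<jj ⟩
      (suc j * suc j) * (suc j * suc j)                ≤⟨ *-mono-≤ (*-mono-≤ (suc≤2^ j) (suc≤2^ j)) (*-mono-≤ (suc≤2^ j) (suc≤2^ j)) ⟩
      (2 ^ j * 2 ^ j) * (2 ^ j * 2 ^ j)                ≡⟨ arith (2 ^ j) ⟩
      (2 ^ j) ^ 4                                      ≡⟨ ^-*-assoc 2 j 4 ⟩
      2 ^ (j * 4)                                      ≤⟨ ^-monoʳ-≤ 2 (≤-trans (m≤n+m (j * 4) (r % 4)) (≤-reflexive (sym r≡))) ⟩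
      2 ^ r                                            ∎
    where
    open ≤-Reasoning
    j = r / 4
    r≡ : r ≡ r % 4 + j * 4
    r≡ = m≡m%n+[m/n]*n r 4
    r< : suc r ≤ 4 * suc j
    r< = by-combining (suc r) (4 * suc j) 0 (≤-reflexive r≡ ⊕ m%n<n r 4) (lemma r (r % 4) j)
      where
      lemma : ∀ r t j → suc r + (t + j * 4 + 4) + 0 ≡ 4 * suc j + (r + suc t)
      lemma = solve-∀
    4Z≤ : 4 * Z ≤ suc j
    4Z≤ = *-cancelˡ-≤ 4 (by-combining (4 * (4 * Z)) (4 * suc j) 1 (r≥ ⊕ r<) (lemma Z r j))
      where
      lemma : ∀ Z r j → 4 * (4 * Z) + (r + 4 * suc j) + 1 ≡ 4 * suc j + (16 * Z + suc r)
      lemma = solve-∀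
    n<jj : n < suc j * suc j
    n<jj = ≤-trans n< (≤-trans (*-monoʳ-≤ Z r<) (≤-trans (≤-reflexive (lemma Z (suc j))) (*-monoˡ-≤ (suc j) 4Z≤)))
      where
      lemma : ∀ Z x → Z * (4 * x) ≡ 4 * Z * x
      lemma = solve-∀
    arith : ∀ x → (x * x) * (x * x) ≡ x * (x * (x * (x * 1)))
    arith = solve-∀

  module _ (𝓗 : TripleSystem V) where

    open TripleSystem 𝓗

    path-even : ∀ {x y l} → Path 𝓗 x y l → 2 ∣ length l
    path-even []         = divides 0 refl
    path-even (step _ p) = ∣m∣n⇒∣m+n (divides 1 refl) (path-even p)

    loose-cycle : ∀ (vs : List V) (G c D Z s E K h M r : ℕ) → let n = length vs ; b = 4 * s + 4 in
      Unique vs → (∀ v → v ∈ vs) → 2 ∣ n → 0 < G → c ≡ 2 * 128 → suc D ≡ 2 * c ^ 7 →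
      0 < s → 0 < Z → 0 < E → 32 * G * Z ≤ s → s * (7 * G + 7) ≤ 16 * G * E →
      4 * ((32 * G * b) * (32 * G * b)) * ((2 * Z) * (2 * Z) * ((2 * Z) * (2 * Z))) < K → K ≤ h →
      4 * (16 * G) * (s + s) ≤ h → 4 * κ-pairs G s * suc s ≤ h → κ-vertices G s * s ≤ h →
      2 * (32 * G + E + 1) * h ≤ M → b * b ≤ M → 32 * G * b ≤ M → 128 + b < M →
      1920 * G * D ≤ Z → Z * r ≤ n → n < Z * suc r → 16 * Z ≤ r →
      64 * G ≤ n → 4 * Z * M ≤ n → 2 * (c * 7) ≤ n →
      (∀ v → (7 * G + 8) * (n * n) ≤ 16 * G * pairs vs v) →
      ∃ λ a → ∃ λ l → Path 𝓗 a a l × l ↭ vs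
    loose-cycle vs G c D Z s E K h M r uvs complete 2∣n 0<G c≡ D≡ 0<s 0<Z 0<E sZ sE K> K≤h h₁ h₂ h₃ M₁ M₂ M₃ M₄ ZD Zr≤ n< r≥ n≥₁ n≥₂ n≥₃ dense =
        start vs complete dense
      where
      n = length vs
      b = 4 * s + 4
      k = 3 * D * r
      0<M : 0 < M
      0<M = ≤-trans (s≤s z≤n) M₄
      -- 1920 = 2 · 32 · 10 · 3: ten vertices for each of the `3 * D * r` stages, the factor
      -- `32 * G` demanded by `stage`, and a factor 2 that leaves room for the single vertex `a₀`.
      gadgets-fit : 32 * G * (10 * k + 1) ≤ n
      gadgets-fit = *-cancelˡ-≤ 2 (by-combining (2 * (32 * G * (10 * k + 1))) (2 * n) 0 (r ⊛ ZD ⊕ Zr≤ ⊕ n≥₁) (lemma G D r Z n))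
        where
        lemma : ∀ G D r Z n → 2 * (32 * G * (10 * (3 * D * r) + 1)) + (r * Z + (n + n)) + 0 ≡ 2 * n + (r * (1920 * G * D) + (Z * r + 64 * G))
        lemma = solve-∀
      start : ∀ ws → (∀ v → v ∈ ws) → (∀ v → (7 * G + 8) * (n * n) ≤ 16 * G * pairs vs v) → ∃ λ a → ∃ λ l → Path 𝓗 a a l × l ↭ vs
      start [] none _ = ⊥-elim (nonempty vs refl)
        where
        nonempty : ∀ xs → vs ≡ xs → ⊥
        nonempty []      eq = <⇒≱ (≤-trans (*-mono-≤ (*-mono-≤ {1} {4} (s≤s z≤n) 0<Z) 0<M) n≥₂) (≤-reflexive (cong length eq))
        nonempty (v ∷ _) eq = case none v of λ ()
      start (a₀ ∷ _) _ _ = absorbed (stage k gadgets-fit)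
        where
        open Absorbing 𝓗 vs uvs complete G c D 0<G c≡ D≡ n≥₃ dense a₀
        absorbed : Stage k → ∃ λ a → ∃ λ l → Path 𝓗 a a l × l ↭ vs
        absorbed (gs , R₀ , partial {p} {l₀} chain₀ vs↭ |l₀| , |gs| , Ω≤) = grown (grow N R₀ ≤-refl initial)
          where
          N = length R₀
          P = l₀ ++ a₀ ∷ []
          |P| : length P ≡ 10 * k + 1
          |P| = trans (length-++ l₀) (cong (_+ 1) |l₀|)
          n≡ : n ≡ length P + N
          n≡ = trans (↭-length vs↭) (length-++ P)
          few : 32 * G * length P ≤ n
          few = ≤-trans (≤-reflexive (cong (32 * G *_) |P|)) gadgets-fit
          n≤2N : n ≤ 2 * N
          n≤2N = by-combining n (2 * N) (30 * length P) (2 ⊛ ≤-reflexive n≡ ⊕ few ⊕ (32 * length P) ⊛ 0<G) (lemma n N (length P) G)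
            where
            lemma : ∀ n N p G → n + (2 * (p + N) + (n + 32 * p * G)) + 30 * p ≡ 2 * N + (2 * n + (32 * G * p + 32 * p * 1))
            lemma = solve-∀
          N≥ : 2 * Z * M ≤ N
          N≥ = *-cancelˡ-≤ 2 (≤-trans (≤-reflexive (lemma Z M)) (≤-trans n≥₂ n≤2N))
            where
            lemma : ∀ Z M → 2 * (2 * Z * M) ≡ 4 * Z * M
            lemma = solve-∀
          K≤N : K ≤ N
          K≤N = ≤-trans K≤h (≤-trans (m≤n*m h (2 * (32 * G + E + 1)) {{>-nonZero (*-mono-≤ {1} {2} (s≤s z≤n) (m≤n+m 1 (32 * G + E)))}})
                  (≤-trans M₁ (≤-trans (m≤n*m M (2 * Z) {{>-nonZero (*-mono-≤ {1} {2} (s≤s z≤n) 0<Z)}}) N≥)))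
          L≤ : length (vs ++ replicate K a₀) ≤ 4 * N
          L≤ = by-combining (length (vs ++ replicate K a₀)) (4 * N) N
                 (≤-reflexive (trans (length-++ vs) (cong (n +_) (length-replicate K))) ⊕ n≤2N ⊕ K≤N) (lemma (length (vs ++ replicate K a₀)) n K N)
            where
            lemma : ∀ L n K N → L + (n + K + (2 * N + N)) + N ≡ 4 * N + (L + (n + K))
            lemma = solve-∀
          open Growth 𝓗 vs uvs complete a₀ gs G N s E Z K h M 0<G 0<s 0<Z 0<E sZ sE K> K≤h h₁ h₂ h₃ M₁ M₂ M₃ M₄ N≥ L≤
          open Potential 𝓗 (vs ++ replicate K a₀) G N s E Z K using (deficit; Φ; X)
          rich₀ : ∀ v → (7 * G + 7) * (N * N) ≤ 16 * G * pairs R₀ v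
          rich₀ v = remove-few 𝓗 G P v vs↭ few (dense v)
          deficit≡0 : ∀ v → deficit R₀ v ≡ 0
          deficit≡0 v = m≤n⇒m∸n≡0 (by-combining (target G N N) (16 * G * N * pairs R₀ v) 0 (N ⊛ rich₀ v) (lemma G N (pairs R₀ v)))
            where
            lemma : ∀ G N p → (7 * G + 4) * N * (N * N) + 3 * (N * N * N) + N * (16 * G * p) + 0 ≡ 16 * G * N * p + N * ((7 * G + 7) * (N * N))
            lemma = solve-∀
          Φ≡0 : Φ R₀ ≡ 0
          Φ≡0 = trans (∑-cong (vs ++ replicate K a₀) (λ v → cong (λ z → z * z) (deficit≡0 v))) (∑-zero (vs ++ replicate K a₀))
          initial : State R₀
          initial = state chain₀ vs↭ (≤-trans (*-monoˡ-≤ (N * N) (+-monoʳ-≤ (7 * G) {2} {7} (s≤s (s≤s z≤n)))) (rich₀ p))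
            (≤-reflexive (cong (_+ N * (length (vs ++ replicate K a₀) * (X * X))) Φ≡0)) ≤-refl
            (m≤n*m N (2 * Z) {{>-nonZero (*-mono-≤ {1} {2} (s≤s z≤n) 0<Z)}})
          grown : (∃ λ R → State R × Z * length R < N) → ∃ λ a → ∃ λ l → Path 𝓗 a a l × l ↭ vs
          grown (R , st , ZR<N) = closed (close R st)
            where
            R≤r : length R ≤ r
            R≤r = ≤-pred (*-cancelˡ-< Z (length R) (suc r) (≤-trans (≤-trans ZR<N (≤-trans (m≤n+m N (length P)) (≤-reflexive (sym n≡)))) (<⇒≤ n<)))
            closed : (∃ λ U → ∃ λ l → Chain 𝓗 a₀ a₀ gs l × vs ↭ l ++ U × length U ≤ length R) → ∃ λ a → ∃ λ l → Path 𝓗 a a l × l ↭ vs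
            -- A closed path lists an even number of vertices, so the parity of `n` passes to `U`.
            -- With `length U = j + j ≤ r`, the `r` absorbers of each pair exceed the `j` that are
            -- needed.
            closed (U , l , chain , vs↭′ , U≤R) = halve (∣m+n∣m⇒∣n (subst (2 ∣_) (trans (↭-length vs↭′) (length-++ l)) 2∣n) (path-even (chain-path 𝓗 chain)))
              where
              halve : 2 ∣ length U → ∃ λ a → ∃ λ l → Path 𝓗 a a l × l ↭ vs
              halve (divides j |U|) =
                let |U|′ = trans |U| (trans (*-comm j 2) (cong (j +_) (+-identityʳ j)))
                    l′ , path , l′↭ = absorb-all 𝓗 U j |U|′ chain λ x y →
                      ≤-trans (≤-trans (≤-trans (m≤m+n j j) (≤-reflexive (sym |U|′))) (≤-trans U≤R R≤r))
                        (absorbed-often r gs |gs| Ω≤ (square<power Z r n n< r≥) x y)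
                in a₀ , l′ , path , ↭-trans l′↭ (↭-trans (++-comm U l) (↭-sym vs↭′))

  -- Hypergraphs as triple systems.

  private variable
    n : ℕ

  ∣p∪q∣≤∣p∣+∣q∣ : ∀ (p q : Subset n) → ∣ p ∪ q ∣ ≤ ∣ p ∣ + ∣ q ∣
  ∣p∪q∣≤∣p∣+∣q∣ []          []          = z≤n
  ∣p∪q∣≤∣p∣+∣q∣ (true ∷ p)  (true ∷ q)  = s≤s (≤-trans (∣p∪q∣≤∣p∣+∣q∣ p q) (+-monoʳ-≤ ∣ p ∣ (n≤1+n ∣ q ∣)))
  ∣p∪q∣≤∣p∣+∣q∣ (true ∷ p)  (false ∷ q) = s≤s (∣p∪q∣≤∣p∣+∣q∣ p q)
  ∣p∪q∣≤∣p∣+∣q∣ (false ∷ p) (true ∷ q)  = ≤-trans (s≤s (∣p∪q∣≤∣p∣+∣q∣ p q)) (≤-reflexive (sym (+-suc ∣ p ∣ ∣ q ∣)))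
  ∣p∪q∣≤∣p∣+∣q∣ (false ∷ p) (false ∷ q) = ∣p∪q∣≤∣p∣+∣q∣ p q

  triple-degenerate : ∀ (a c : Fin n) → ∣ triple a a c ∣ ≤ 2
  triple-degenerate a c = begin
    ∣ ⁅ a ⁆ ∪ (⁅ a ⁆ ∪ ⁅ c ⁆) ∣    ≡⟨ cong ∣_∣ (∪-assoc ⁅ a ⁆ ⁅ a ⁆ ⁅ c ⁆) ⟨
    ∣ (⁅ a ⁆ ∪ ⁅ a ⁆) ∪ ⁅ c ⁆ ∣    ≡⟨ cong (λ p → ∣ p ∪ ⁅ c ⁆ ∣) (∪-idem ⁅ a ⁆) ⟩
    ∣ ⁅ a ⁆ ∪ ⁅ c ⁆ ∣              ≤⟨ ∣p∪q∣≤∣p∣+∣q∣ ⁅ a ⁆ ⁅ c ⁆ ⟩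
    ∣ ⁅ a ⁆ ∣ + ∣ ⁅ c ⁆ ∣          ≡⟨ cong₂ _+_ (∣⁅x⁆∣≡1 a) (∣⁅x⁆∣≡1 c) ⟩
    2                              ∎
    where open ≤-Reasoning

  tripleSystem : Hypergraph3 n → TripleSystem (Fin n)
  tripleSystem H = record
    { edge   = λ a b c → isEdge H (triple a b c)
    ; swap₁  = λ a b c → cong (isEdge H) (trans (sym (∪-assoc ⁅ a ⁆ ⁅ b ⁆ ⁅ c ⁆)) (trans (cong (_∪ ⁅ c ⁆) (∪-comm ⁅ a ⁆ ⁅ b ⁆)) (∪-assoc ⁅ b ⁆ ⁅ a ⁆ ⁅ c ⁆)))
    ; swap₂  = λ a b c → cong (λ p → isEdge H (⁅ a ⁆ ∪ p)) (∪-comm ⁅ b ⁆ ⁅ c ⁆)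
    ; edge-≢ = λ { {a} {.a} {c} e refl → <⇒≱ {2} {3} ≤-refl (subst (_≤ 2) (uniform H _ e) (triple-degenerate a c)) }
    ; _≟_    = Fin._≟_
    }

  detach : ∀ (s : Subset n) v → Vec.lookup s v ≡ true → ∃ λ t → s ≡ ⁅ v ⁆ ∪ t × ∣ s ∣ ≡ suc ∣ t ∣
  detach (true ∷ s) zero    eq = false ∷ s , cong (true ∷_) (sym (∪-identityˡ s)) , refl
  detach (true ∷ s) (suc v) eq  = let t , s≡ , |s| = detach s v eq in true ∷ t , cong (true ∷_) s≡ , cong suc |s|
  detach (false ∷ s) (suc v) eq = let t , s≡ , |s| = detach s v eq in false ∷ t , cong (false ∷_) s≡ , |s|

  nonempty : ∀ (s : Subset n) {k} → ∣ s ∣ ≡ suc k → ∃ λ v → Vec.lookup s v ≡ true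
  nonempty (true ∷ s)  eq = zero , refl
  nonempty (false ∷ s) eq = let v , v∈ = nonempty s eq in suc v , v∈

  empty : ∀ (s : Subset n) → ∣ s ∣ ≡ 0 → s ≡ ∅
  empty []          eq = refl
  empty (false ∷ s) eq = cong (false ∷_) (empty s eq)

  as-triple : ∀ (s : Subset n) v → ∣ s ∣ ≡ 3 → Vec.lookup s v ≡ true → ∃ λ a → ∃ λ b → s ≡ triple v a b
  as-triple s v |s| v∈ =
    let t , s≡ , |s|≡ = detach s v v∈
        |t| = cong pred (trans (sym |s|≡) |s|)
        a , a∈ = nonempty t |t|
        u , t≡ , |t|≡ = detach t a a∈
        |u| = cong pred (trans (sym |t|≡) |t|)
        b , b∈ = nonempty u |u|
        w , u≡ , |u|≡ = detach u b b∈
        w≡ = empty w (cong pred (trans (sym |u|≡) |u|))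
    in a , b , trans s≡ (cong (⁅ v ⁆ ∪_) (trans t≡ (cong (⁅ a ⁆ ∪_) (trans u≡ (trans (cong (⁅ b ⁆ ∪_) w≡) (∪-identityʳ ⁅ b ⁆))))))

  same : Subset n → Subset n → Bool
  same []          []          = true
  same (true ∷ s)  (true ∷ t)  = same s t
  same (false ∷ s) (false ∷ t) = same s t
  same (true ∷ s)  (false ∷ t) = false
  same (false ∷ s) (true ∷ t)  = false

  same-refl : ∀ (s : Subset n) → same s s ≡ true
  same-refl []          = refl
  same-refl (true ∷ s)  = same-refl s
  same-refl (false ∷ s) = same-refl s

  same-sound : ∀ (s t : Subset n) → same s t ≡ true → s ≡ t
  same-sound []          []          _  = refl
  same-sound (true ∷ s)  (true ∷ t)  eq = cong (true ∷_) (same-sound s t eq)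
  same-sound (false ∷ s) (false ∷ t) eq = cong (false ∷_) (same-sound s t eq)

  count-same : ∀ (t : Subset n) → # (same t) (allSubsets n) ≤ 1
  count-same []              = ≤-refl
  count-same {suc n} (x ∷ t) = ≤-trans (≤-reflexive (trans (∑-++ (map (true ∷_) (allSubsets n)) _ _)
      (cong₂ _+_ (∑-map (true ∷_) (allSubsets n) _) (∑-map (false ∷_) (allSubsets n) _)))) (halves x)
    where
    halves : ∀ x → # (λ s → same (x ∷ t) (true ∷ s)) (allSubsets n) + # (λ s → same (x ∷ t) (false ∷ s)) (allSubsets n) ≤ 1
    halves true  = ≤-trans (≤-reflexive (trans (cong (# (same t) (allSubsets n) +_) (∑-zero (allSubsets n))) (+-identityʳ _))) (count-same t)
    halves false = ≤-trans (≤-reflexive (cong (_+ # (same t) (allSubsets n)) (∑-zero (allSubsets n)))) (count-same t)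

  two-terms : ∀ {A : Set} {xs : List A} (f : A → ℕ) {x y} → x ∈ xs → y ∈ xs → x ≢ y → f x + f y ≤ ∑ xs f
  two-terms f (here refl) (here refl) x≢y = ⊥-elim (x≢y refl)
  two-terms f {x} (here refl) (there y∈) x≢y = +-monoʳ-≤ (f x) (term≤∑ f y∈)
  two-terms f {x} {y} (there x∈) (here refl) x≢y = ≤-trans (≤-reflexive (+-comm (f x) (f y))) (+-monoʳ-≤ (f y) (term≤∑ f x∈))
  two-terms f (there x∈) (there y∈)  x≢y = ≤-trans (two-terms f x∈ y∈ x≢y) (m≤n+m _ _)

  length-filter-≟ : ∀ {A : Set} (p : A → Bool) xs → length (filter (λ x → p x Bool.≟ true) xs) ≡ # p xs
  length-filter-≟ p []       = refl
  length-filter-≟ p (x ∷ xs) with p x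
  ... | true  = cong suc (length-filter-≟ p xs)
  ... | false = length-filter-≟ p xs

  -- Double counting of the `s, a, b` with `triple v a b` equal to the edge `s`: an edge through `v`
  -- arises from two ordered pairs, which differ because `a ≢ b`, and a pair determines at most one
  -- entry of `allSubsets n`.
  2deg≤pairs : ∀ (H : Hypergraph3 n) v → 2 * deg H v ≤ TripleSystem.pairs (tripleSystem H) (allFin n) v
  2deg≤pairs {n} H v = begin
    2 * deg H v                                                    ≡⟨ cong (2 *_) (length-filter-≟ (λ s → isEdge H s ∧ Vec.lookup s v) (allSubsets n)) ⟩
    2 * # (λ s → isEdge H s ∧ Vec.lookup s v) (allSubsets n)        ≡⟨ ∑-*ˡ (allSubsets n) 2 _ ⟨
    ∑[ s ∈ allSubsets n ] 2 * 𝟙 (isEdge H s ∧ Vec.lookup s v)       ≤⟨ ∑-mono (allSubsets n) (λ s → twice s (isEdge H s) (Vec.lookup s v) refl refl) ⟩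
    ∑[ s ∈ allSubsets n ] ∑[ a ∈ vs ] ∑[ b ∈ vs ] 𝟙 (isEdge H (triple v a b)) * 𝟙 (same (triple v a b) s)
      ≡⟨ trans (∑-swap (allSubsets n) vs _) (∑-cong vs λ a → trans (∑-swap (allSubsets n) vs _) (∑-cong vs λ b → ∑-*ˡ (allSubsets n) (𝟙 (isEdge H (triple v a b))) _)) ⟩
    ∑[ a ∈ vs ] ∑[ b ∈ vs ] 𝟙 (isEdge H (triple v a b)) * # (same (triple v a b)) (allSubsets n)
      ≤⟨ ∑-mono vs (λ a → ∑-mono vs λ b → ≤-trans (*-monoʳ-≤ (𝟙 (isEdge H (triple v a b))) (count-same (triple v a b))) (≤-reflexive (*-identityʳ _))) ⟩
    ∑[ a ∈ vs ] ∑[ b ∈ vs ] 𝟙 (isEdge H (triple v a b))            ∎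
    where
    open ≤-Reasoning
    open TripleSystem (tripleSystem H)
    vs = allFin n
    f : Subset n → Fin n → Fin n → ℕ
    f s a b = 𝟙 (isEdge H (triple v a b)) * 𝟙 (same (triple v a b) s)
    hit : ∀ s a b → isEdge H s ≡ true → s ≡ triple v a b → 1 ≤ f s a b
    hit s a b e refl = ≤-reflexive (sym (cong₂ _*_ (cong 𝟙 e) (cong 𝟙 (same-refl (triple v a b)))))
    twice : ∀ s e l → isEdge H s ≡ e → Vec.lookup s v ≡ l → 2 * 𝟙 (e ∧ l) ≤ ∑[ a ∈ vs ] ∑[ b ∈ vs ] f s a b
    twice s false l     es ls = z≤n
    twice s true  false es ls = z≤n
    twice s true  true  es ls =
      let a , b , s≡ = as-triple s v (uniform H s es) ls
          a≢b = edge-≢₂ {v} {a} {b} (trans (cong (isEdge H) (sym s≡)) es)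
          s≡′ = trans s≡ (cong (⁅ v ⁆ ∪_) (∪-comm ⁅ a ⁆ ⁅ b ⁆))
      in ≤-trans (+-mono-≤ (≤-trans (hit s a b es s≡) (term≤∑ (f s a) (∈-allFin b))) (≤-trans (hit s b a es s≡′) (term≤∑ (f s b) (∈-allFin a))))
           (two-terms (λ a → ∑ vs (f s a)) (∈-allFin a) (∈-allFin b) a≢b)

  -- From closed paths to cyclic orderings.

  lookup-injective : ∀ {A : Set} {xs : List A} → Unique xs → ∀ {i j} → lookup xs i ≡ lookup xs j → i ≡ j
  lookup-injective (p ∷ u) {zero}  {zero}  eq = refl
  lookup-injective {xs = x ∷ xs} (p ∷ u) {zero}  {suc j} eq = ⊥-elim (All.lookup p (∈-lookup {xs = xs} j) eq)
  lookup-injective {xs = x ∷ xs} (p ∷ u) {suc i} {zero}  eq = ⊥-elim (All.lookup p (∈-lookup {xs = xs} i) (sym eq))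
  lookup-injective (p ∷ u) {suc i} {suc j} eq = cong suc (lookup-injective u eq)

  module _ {V : Set} (𝓗 : TripleSystem V) where

    open TripleSystem 𝓗

    -- The second alternative is the last edge, which ends at the unlisted endpoint `y`. For a
    -- closed path that is the vertex at position 0, the wrap-around of the cyclic order.
    Next : List V → V → ℕ → V → Set
    Next l y i z = (∃ λ (k : Fin (length l)) → toℕ k ≡ 2 + i × lookup l k ≡ z) ⊎ (2 + i ≡ length l × z ≡ y)

    path-edge : ∀ {x y l} → Path 𝓗 x y l → ∀ m (i j : Fin (length l)) z → toℕ i ≡ 2 * m → toℕ j ≡ suc (toℕ i) →
      Next l y (toℕ i) z → edge (lookup l i) (lookup l j) z ≡ true
    path-edge (step e [])         zero zero (suc zero) z i≡ j≡ (inj₁ (suc (suc ()) , _))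
    path-edge (step e (step _ _)) zero zero (suc zero) z i≡ j≡ (inj₁ (suc (suc zero) , _ , refl)) = e
    path-edge (step e [])         zero zero (suc zero) z i≡ j≡ (inj₂ (_ , refl)) = e
    path-edge (step e (step _ _)) zero zero (suc zero) z i≡ j≡ (inj₂ (() , _))
    path-edge {y = y} (step {x} {u} {_} {_} {l} e p) (suc m) (suc (suc i)) (suc (suc j)) z i≡ j≡ next =
      path-edge p m i j z (+-cancelˡ-≡ 2 (toℕ i) (2 * m) (trans i≡ (*-suc 2 m))) (+-cancelˡ-≡ 2 (toℕ j) (suc (toℕ i)) j≡) (peel next)
      where
      peel : Next (x ∷ u ∷ l) y (2 + toℕ i) z → Next l y (toℕ i) z
      peel (inj₁ (suc (suc k) , k≡ , eq)) = inj₁ (k , +-cancelˡ-≡ 2 (toℕ k) (2 + toℕ i) k≡ , eq)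
      peel (inj₂ (len , eq)) = inj₂ (+-cancelˡ-≡ 2 (2 + toℕ i) (length l) len , eq)
    path-edge (step e p) (suc m) (suc (suc i)) (suc zero) z i≡ () next
    path-edge (step e p) (suc m) (suc zero) j z i≡ j≡ next = ⊥-elim (0≢1+n (suc-injective (trans i≡ (*-suc 2 m))))
    path-edge (step e p) (suc m) zero j z () j≡ next

  toLooseHamiltonCycle : ∀ (H : Hypergraph3 n) {a l} → Path (tripleSystem H) a a l → l ↭ allFin n → LooseHamiltonCycle H
  toLooseHamiltonCycle {n} H {a} {l} path l↭ = mk⤖ {to = σ} (injective , surjective) , edges
    where
    |l| : length l ≡ n
    |l| = trans (↭-length l↭) (length-tabulate {n = n} id)
    uniq : Unique l
    uniq = unique-↭ (↭-sym l↭) (allFin⁺ n)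
    σ : Fin n → Fin n
    σ i = lookup l (cast (sym |l|) i)
    injective : ∀ {i j} → σ i ≡ σ j → i ≡ j
    injective {i} {j} eq = toℕ-injective (trans (sym (toℕ-cast (sym |l|) i)) (trans (cong toℕ (lookup-injective uniq eq)) (toℕ-cast (sym |l|) j)))
    position : ∀ k i → toℕ i ≡ toℕ k → cast (sym |l|) i ≡ k
    position k i eq = toℕ-injective (trans (toℕ-cast (sym |l|) i) eq)
    surjective : ∀ v → ∃ λ i → ∀ {j} → j ≡ i → σ j ≡ v
    surjective v =
      let v∈ = ∈-resp-↭ (↭-sym l↭) (∈-allFin v)
      in cast |l| (index v∈) , λ { refl → trans (cong (lookup l) (position (index v∈) _ (toℕ-cast |l| (index v∈)))) (sym (lookup-index v∈)) }
    starts : ∀ {x y l} → Path (tripleSystem H) x y l → (k : Fin (length l)) → toℕ k ≡ 0 → lookup l k ≡ x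
    starts (step _ _) zero _ = refl
    edges : ∀ i j k → (∃ λ m → toℕ i ≡ 2 * m) → toℕ j ≡ suc (toℕ i) → (toℕ k ≡ 2 + toℕ i ⊎ (2 + toℕ i ≡ n × toℕ k ≡ 0)) →
            isEdge H (triple (σ i) (σ j) (σ k)) ≡ true
    edges i j k (m , i≡) j≡ next = path-edge (tripleSystem H) path m (c i) (c j) (σ k)
        (trans (tc i) i≡) (trans (tc j) (trans j≡ (cong suc (sym (tc i))))) (convert next)
      where
      c : Fin n → Fin (length l)
      c = cast (sym |l|)
      tc : ∀ i → toℕ (c i) ≡ toℕ i
      tc = toℕ-cast (sym |l|)
      convert : toℕ k ≡ 2 + toℕ i ⊎ (2 + toℕ i ≡ n × toℕ k ≡ 0) → Next (tripleSystem H) l a (toℕ (c i)) (σ k)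
      convert (inj₁ eq) = inj₁ (c k , trans (tc k) (trans eq (cong (2 +_) (sym (tc i)))) , refl)
      convert (inj₂ (eq , k≡0)) = inj₂ (trans (cong (2 +_) (tc i)) (trans eq (sym |l|)) , starts path (c k) (trans (tc k) k≡0))

  -- The rational degree condition and the choice of constants.

  open import Data.Nat.Combinatorics using (_C_; nC1≡n; nCk+nC[k+1]≡[n+1]C[k+1])

  2C2+n≡n² : ∀ n → 2 * (n C 2) + n ≡ n * n
  2C2+n≡n² zero    = refl
  2C2+n≡n² (suc n) = begin
    2 * (suc n C 2) + suc n              ≡⟨ cong (λ z → 2 * z + suc n) (nCk+nC[k+1]≡[n+1]C[k+1] n 1) ⟨
    2 * (n C 1 + n C 2) + suc n          ≡⟨ cong (λ z → 2 * (z + n C 2) + suc n) (nC1≡n n) ⟩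
    2 * (n + n C 2) + suc n              ≡⟨ lemma n (n C 2) ⟩
    2 * n + 1 + (2 * (n C 2) + n)        ≡⟨ cong (2 * n + 1 +_) (2C2+n≡n² n) ⟩
    2 * n + 1 + n * n                    ≡⟨ lemma₂ n ⟩
    suc n * suc n                        ∎
    where
    open ≡-Reasoning
    lemma : ∀ n c → 2 * (n + c) + suc n ≡ 2 * n + 1 + (2 * c + n)
    lemma = solve-∀
    lemma₂ : ∀ n → 2 * n + 1 + n * n ≡ suc n * suc n
    lemma₂ = solve-∀

  -- A positive rational with denominator `suc q` is at least `1 / suc q`, and only this bound on
  -- the slack is kept: 7/16 plus it equals `(7 * suc q + 16) / (16 * suc q)`.
  clear-denominators : ∀ γ → γ ℚ.> 0ℚ → ∃ λ q → ∀ d c →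
    (ℤ.+ d ℚ./ 1) ℚ.> ((ℤ.+ 7 ℚ./ 16 ℚ.+ γ) ℚ.* (ℤ.+ c ℚ./ 1)) → (7 * suc q + 16) * c ≤ 16 * suc q * d
  clear-denominators (mkℚ (ℤ.+ zero)  q cop) (ℚ.*<* (ℤ.+<+ ()))
  clear-denominators (mkℚ ℤ.-[1+ p ]  q cop) (ℚ.*<* ())
  clear-denominators γ@(mkℚ (ℤ.+ suc p) q cop) _ = q , λ d c gt → by-combining ((7 * suc q + 16) * c) (16 * suc q * d) (16 * p * c)
      (<⇒≤ (cleared d c gt)) (lemma p q c d)
    where
    lemma : ∀ p q c d → (7 * suc q + 16) * c + d * (16 * suc q * 1) + 16 * p * c ≡ 16 * suc q * d + (7 * suc q + suc p * 16) * c * 1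
    lemma = solve-∀
    numeral : ∀ m → toℚᵘ (ℤ.+ m ℚ./ 1) ℚᵘ.≃ mkℚᵘ (ℤ.+ m) 0
    numeral m = ℚ.toℚᵘ-fromℚᵘ (mkℚᵘ (ℤ.+ m) 0)
    product : ∀ c → toℚᵘ ((ℤ.+ 7 ℚ./ 16 ℚ.+ γ) ℚ.* (ℤ.+ c ℚ./ 1)) ℚᵘ.≃ (mkℚᵘ (ℤ.+ 7) 15 ℚᵘ.+ mkℚᵘ (ℤ.+ suc p) q) ℚᵘ.* mkℚᵘ (ℤ.+ c) 0
    product c = ℚᵘ.≃-trans (ℚ.toℚᵘ-homo-* (ℤ.+ 7 ℚ./ 16 ℚ.+ γ) (ℤ.+ c ℚ./ 1))
                  (ℚᵘ.*-cong (ℚ.toℚᵘ-homo-+ (ℤ.+ 7 ℚ./ 16) γ) (numeral c))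
    cleared : ∀ d c → (ℤ.+ d ℚ./ 1) ℚ.> ((ℤ.+ 7 ℚ./ 16 ℚ.+ γ) ℚ.* (ℤ.+ c ℚ./ 1)) → (7 * suc q + suc p * 16) * c * 1 < d * (16 * suc q * 1)
    cleared d c gt = ℤ.drop‿+<+ (subst₂ ℤ._<_
      (trans (cong (ℤ._* ℤ.+ 1) (sym (ℤ.pos-* (7 * suc q + suc p * 16) c))) (sym (ℤ.pos-* ((7 * suc q + suc p * 16) * c) 1)))
      (sym (ℤ.pos-* d (16 * suc q * 1)))
      (ℚᵘ.drop-*<* unnormalised))
      where
      unnormalised : (mkℚᵘ (ℤ.+ 7) 15 ℚᵘ.+ mkℚᵘ (ℤ.+ suc p) q) ℚᵘ.* mkℚᵘ (ℤ.+ c) 0 ℚᵘ.< mkℚᵘ (ℤ.+ d) 0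
      unnormalised = ℚᵘ.<-respʳ-≃ (numeral d) (ℚᵘ.<-respˡ-≃ (product c) (ℚ.toℚᵘ-mono-< gt))

  -- Each constant depends on earlier ones only. `D` encodes the proportion of absorbing tuples; `Z`
  -- makes the absorbers fit; `s` makes four connecting vertices negligible beside a block while a
  -- `1 / Z` proportion remains; `E` is the precision of light blocks; `K` exceeds the number of bad
  -- vertices; `h` is the number of lightest vertices that supply `C`; `M` is a number of remaining
  -- vertices at which blocks and connections can still be found.
  module Constants (c D G : ℕ) (c≡ : c ≡ 2 * 128) (D≡ : suc D ≡ 2 * c ^ 7) (0<G : 0 < G) where

    Z s E b K h M n₀ : ℕ
    Z = 1920 * G * D
    s = 32 * G * Z
    E = 2 * Z * (7 * G + 7)
    b = 4 * s + 4
    K = suc (4 * ((32 * G * b) * (32 * G * b)) * ((2 * Z) * (2 * Z) * ((2 * Z) * (2 * Z))))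
    h = K + (4 * (16 * G) * (s + s) + (4 * κ-pairs G s * suc s + κ-vertices G s * s))
    M = 2 * (32 * G + E + 1) * h + (b * b + (32 * G * b + (129 + b)))
    n₀ = 64 * G + (4 * Z * M + (2 * (c * 7) + 16 * Z * Z))

    0<D : 0 < D
    0<D = ≤-pred (≤-trans (*-monoʳ-≤ 2 (m^n>0 c {{>-nonZero (subst (0 <_) (sym c≡) (s≤s z≤n))}} 7)) (≤-reflexive (sym D≡)))

    0<Z : 0 < Z
    0<Z = *-mono-≤ (*-mono-≤ {1} {1920} (s≤s z≤n) 0<G) 0<D

    0<s : 0 < s
    0<s = *-mono-≤ (*-mono-≤ {1} {32} (s≤s z≤n) 0<G) 0<Z

    0<E : 0 < E
    0<E = *-mono-≤ (*-mono-≤ {1} {2} (s≤s z≤n) 0<Z) (≤-trans (s≤s z≤n) (m≤n+m 7 (7 * G)))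

    sE : s * (7 * G + 7) ≤ 16 * G * E
    sE = ≤-reflexive (lemma G Z)
      where
      lemma : ∀ G Z → 32 * G * Z * (7 * G + 7) ≡ 16 * G * (2 * Z * (7 * G + 7))
      lemma = solve-∀

    loose-cycle-eventually : ∀ (𝓗 : TripleSystem V) (vs : List V) → let n = length vs in
      Unique vs → (∀ v → v ∈ vs) → 2 ∣ n → n₀ ≤ n → (∀ v → (7 * G + 8) * (n * n) ≤ 16 * G * TripleSystem.pairs 𝓗 vs v) →
      ∃ λ a → ∃ λ l → Path 𝓗 a a l × l ↭ vs
    loose-cycle-eventually 𝓗 vs uvs complete 2∣n n₀≤n dense =
        loose-cycle 𝓗 vs G c D Z s E K h M (N / Z) uvs complete 2∣n 0<G c≡ D≡ 0<s 0<Z 0<E ≤-refl sE ≤-refl (m≤m+n K _)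
          (≤-trans (m≤m+n _ _) (m≤n+m _ K)) (≤-trans (≤-trans (m≤m+n _ _) (m≤n+m _ (4 * (16 * G) * (s + s)))) (m≤n+m _ K))
          (≤-trans (≤-trans (m≤n+m _ (4 * κ-pairs G s * suc s)) (m≤n+m _ (4 * (16 * G) * (s + s)))) (m≤n+m _ K))
          (m≤m+n _ _) (≤-trans (m≤m+n _ _) (m≤n+m _ M₁)) (≤-trans (≤-trans (m≤m+n _ _) (m≤n+m _ (b * b))) (m≤n+m _ M₁))
          (≤-trans (≤-trans (m≤n+m _ (32 * G * b)) (m≤n+m _ (b * b))) (m≤n+m _ M₁))
          ≤-refl (≤-trans (≤-reflexive (*-comm Z (N / Z))) (m/n*n≤m N Z)) n<
          (≤-trans (≤-reflexive (sym (m*n/n≡m (16 * Z) Z))) (/-monoˡ-≤ Z (≤-trans (≤-trans (m≤n+m _ (2 * (c * 7))) (≤-trans (m≤n+m _ (4 * Z * M)) (m≤n+m _ (64 * G)))) n₀≤n)))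
          (≤-trans (m≤m+n _ _) n₀≤n) (≤-trans (≤-trans (m≤m+n _ _) (m≤n+m _ (64 * G))) n₀≤n)
          (≤-trans (≤-trans (≤-trans (m≤m+n _ _) (m≤n+m _ (4 * Z * M))) (m≤n+m _ (64 * G))) n₀≤n) dense
      where
      N = length vs
      M₁ = 2 * (32 * G + E + 1) * h
      instance
        Z≢0 : NonZero Z
        Z≢0 = >-nonZero 0<Z
      n< : N < Z * suc (N / Z)
      n< = by-combining (suc N) (Z * suc (N / Z)) 0 (≤-reflexive (m≡m%n+[m/n]*n N Z) ⊕ m%n<n N Z) (lemma N (N % Z) (N / Z) Z)
        where
        lemma : ∀ n t j Z → suc n + (t + j * Z + Z) + 0 ≡ Z * suc j + (n + suc t)
        lemma = solve-∀

  minimum-degree⇒loose-cycle : ∀ γ → γ ℚ.> 0ℚ → Σ ℕ λ n₀ → ∀ n → n₀ < n → 2 ∣ n → ∀ (H : Hypergraph3 n) →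
    (∀ v → (ℤ.+ deg H v ℚ./ 1) ℚ.> ((ℤ.+ 7 ℚ./ 16 ℚ.+ γ) ℚ.* (ℤ.+ (n C 2) ℚ./ 1))) → LooseHamiltonCycle H
  minimum-degree⇒loose-cycle γ γ>0 = from-integers (clear-denominators γ γ>0)
    where
    c : ℕ
    c = 2 * 128
    from-integers : (∃ λ q → ∀ d e → (ℤ.+ d ℚ./ 1) ℚ.> ((ℤ.+ 7 ℚ./ 16 ℚ.+ γ) ℚ.* (ℤ.+ e ℚ./ 1)) → (7 * suc q + 16) * e ≤ 16 * suc q * d) →
      Σ ℕ λ n₀ → ∀ n → n₀ < n → 2 ∣ n → ∀ (H : Hypergraph3 n) →
      (∀ v → (ℤ.+ deg H v ℚ./ 1) ℚ.> ((ℤ.+ 7 ℚ./ 16 ℚ.+ γ) ℚ.* (ℤ.+ (n C 2) ℚ./ 1))) → LooseHamiltonCycle H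
    from-integers (q , cleared) = n₀ + (suc q + 2) , λ n n> 2∣n H degrees →
        let open TripleSystem (tripleSystem H)
            a , l , path , l↭ = loose-cycle-eventually (tripleSystem H) (allFin n) (allFin⁺ n) ∈-allFin
              (subst (2 ∣_) (sym (length-tabulate {n = n} id)) 2∣n)
              (≤-trans (≤-trans (m≤m+n n₀ _) (<⇒≤ n>)) (≤-reflexive (sym (length-tabulate {n = n} id))))
              (λ v → subst (λ x → (7 * (8 * suc q) + 8) * (x * x) ≤ 16 * (8 * suc q) * pairs (allFin n) v) (sym (length-tabulate {n = n} id))
                (dense n (deg H v) (pairs (allFin n) v) (≤-trans (m≤n+m _ n₀) (<⇒≤ n>)) (cleared (deg H v) (n C 2) (degrees v)) (2deg≤pairs H v)))
        in toLooseHamiltonCycle H path l↭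
      where
      open Constants c (pred (2 * c ^ 7)) (8 * suc q) refl refl (s≤s z≤n) using (n₀; loose-cycle-eventually)
      -- Passing from `2 * (n C 2)` to `n * n` costs a multiple of `n`. With `G = 8 * suc q` the
      -- slack shrinks from 128 to 8, and the surplus of 120 covers that cost as soon as
      -- `suc q + 2 ≤ n`.
      dense : ∀ n d p → suc q + 2 ≤ n → (7 * suc q + 16) * (n C 2) ≤ 16 * suc q * d → 2 * d ≤ p →
        (7 * (8 * suc q) + 8) * (n * n) ≤ 16 * (8 * suc q) * p
      dense n d p n≥ deg≥ p≥ = by-combining ((7 * (8 * suc q) + 8) * (n * n)) (16 * (8 * suc q) * p) (n * (64 * suc q + 112))
          (16 ⊛ deg≥ ⊕ (128 * suc q) ⊛ p≥ ⊕ (56 * suc q + 128) ⊛ ≤-reflexive (sym (2C2+n≡n² n)) ⊕ (120 * n) ⊛ n≥)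
          (lemma (suc q) n (n C 2) d p)
        where
        lemma : ∀ q n c d p → (7 * (8 * q) + 8) * (n * n) + (16 * (16 * q * d) + (128 * q * p + ((56 * q + 128) * (2 * c + n) + 120 * n * n))) + n * (64 * q + 112)
          ≡ 16 * (8 * q) * p + (16 * ((7 * q + 16) * c) + (128 * q * (2 * d) + ((56 * q + 128) * (n * n) + 120 * n * (q + 2))))
        lemma = solve-∀

open import Data.Nat using (ℕ; _<_)
open import Data.Nat.Divisibility using (_∣_)
open import Data.Nat.Combinatorics using (_C_)
open import Data.Integer using (+_)
open import Data.Rational using (ℚ; _/_; _+_; _*_; _>_; 0ℚ)
open import Data.Product using (Σ)

theorem1p3 : ∀ (γ : ℚ) → γ > 0ℚ →
    Σ ℕ λ n₀ → ∀ (n : ℕ) → n₀ < n → 2 ∣ n →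
    ∀ (H : Hypergraph3 n) →
    (∀ (v : _) → (+ deg H v / 1) > (((+ 7 / 16) + γ) * (+ (n C 2) / 1))) →
    LooseHamiltonCycle H
theorem1p3 = LooseCycles.minimum-degree⇒loose-cycle
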